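{- There is a polynomial time algorithm that, given a finite data set $P\subset\mathbb{R}$ and $\varepsilon\in(0,1)$, outputs an $\varepsilon$-coreset of $P$ for (one-dimensional) $1$-Median of size $\tilde{O}(\varepsilon^{ -1/2})$.
   Context: For a finite $P\subset\mathbb{R}$ and a center $c\in\mathbb{R}$, the $1$-Median cost is $\mathrm{cost}(P,c)=\sum_{p\in P}|p-c|$. An $\varepsilon$-coreset of $P$ for $1$-Median is a subset $S\subseteq P$ with a weight function $w:S\to\mathbb{R}_{\ge 0}$ such that for every $c\in\mathbb{R}$, $$(1-\varepsilon)\,\mathrm{cost}(P,c)\le\sum_{p\in S}w(p)\,|p-c|\le(1+\varepsilon)\,\mathrm{cost}(P,c).$$ Its size is $|S|$. The notation $\tilde{O}(\varepsilon^{ -1/2})$ means a bound of the form $C\,\varepsilon^{ -1/2}(1+\log(1/\varepsilon))^{C}$ for a universal constant $C>0$, independent of $P$, $|P|$ and $\varepsilon$. -}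

module Defs where

open import Level using (0ℓ)
open import Algebra.Bundles using (CommutativeRing; Semiring)
open import Algebra.Structures using (IsCommutativeRing)
import Algebra.Construct.NaturalChoice.Max as Max
import Algebra.Definitions.RawSemiring as RawSemiringDefs
import Algebra.Properties.Ring as RingProperties
open import Data.Bool using (Bool; true; false; if_then_else_; _∧_)
open import Data.Fin using (Fin; toℕ; fromℕ<)
open import Data.Nat as ℕ using (ℕ)
open import Data.Product using (_×_; _,_; ∃; ∃-syntax; proj₁)
open import Data.Sum using (inj₁; inj₂)
open import Data.Vec.Functional using (Vector)
open import Function.Definitions using (Injective)
open import Relation.Binary using (Rel; IsDecTotalOrder; DecTotalOrder)
import Relation.Binary.Construct.NonStrictToStrict as NonStrictToStrict
open import Relation.Binary.PropositionalEquality using (_≡_)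
open import Relation.Nullary using (¬_; does; yes; no; contradiction)

-- The real numbers, axiomatised as a Dedekind-complete ordered field.
-- Classically these axioms have exactly one model up to isomorphism.
-- Decidability of the order is classical trichotomy.  The inverse is total
-- with an unspecified value at 0.

record RealNumbers : Set₁ where
  infix  8 -_
  infixl 9 _⁻¹
  infixl 7 _*_
  infixl 6 _+_
  infix  4 _≈_ _≤_
  field
    ℝ    : Set
    _≈_  : Rel ℝ 0ℓ
    _≤_  : Rel ℝ 0ℓ
    _+_  : ℝ → ℝ → ℝ
    _*_  : ℝ → ℝ → ℝ
    -_   : ℝ → ℝ
    _⁻¹  : ℝ → ℝ
    0#   : ℝ
    1#   : ℝ
    isCommutativeRing : IsCommutativeRing _≈_ _+_ _*_ -_ 0# 1#
    isDecTotalOrder   : IsDecTotalOrder _≈_ _≤_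
    0≉1               : ¬ (0# ≈ 1#)
    ⁻¹-cong           : ∀ {x y} → x ≈ y → x ⁻¹ ≈ y ⁻¹
    *-inverseʳ        : ∀ {x} → ¬ (x ≈ 0#) → x * x ⁻¹ ≈ 1#
    +-monoˡ-≤         : ∀ z {x y} → x ≤ y → x + z ≤ y + z
    *-nonneg          : ∀ {x y} → 0# ≤ x → 0# ≤ y → 0# ≤ x * y

  UpperBound : (ℝ → Set) → ℝ → Set
  UpperBound A b = ∀ x → A x → x ≤ b

  LeastUpperBound : (ℝ → Set) → ℝ → Set
  LeastUpperBound A s = UpperBound A s × (∀ b → UpperBound A b → s ≤ b)

  field
    complete : (A : ℝ → Set) → ∃ A → ∃ (UpperBound A) → ∃ (LeastUpperBound A)

  sup : (A : ℝ → Set) → ∃ A → ∃ (UpperBound A) → ℝ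
  sup A inhabited bounded = proj₁ (complete A inhabited bounded)

  commutativeRing : CommutativeRing 0ℓ 0ℓ
  commutativeRing = record { isCommutativeRing = isCommutativeRing }

  decTotalOrder : DecTotalOrder 0ℓ 0ℓ 0ℓ
  decTotalOrder = record { isDecTotalOrder = isDecTotalOrder }

  open DecTotalOrder decTotalOrder public using (_≤?_)
  open NonStrictToStrict _≈_ _≤_ public using (_<_)
  open Max (DecTotalOrder.totalOrder decTotalOrder) public using (_⊔_)
  open CommutativeRing commutativeRing public using (_-_)
  open RawSemiringDefs
    (Semiring.rawSemiring (CommutativeRing.semiring commutativeRing)) public
    using (sum; _^_) renaming (_×_ to _×ℝ_)

  ∣_∣ : ℝ → ℝ
  ∣ x ∣ = x ⊔ (- x)

  fromℕ : ℕ → ℝ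
  fromℕ n = n ×ℝ 1#

module OrderLemmas (𝓡 : RealNumbers) where
  open RealNumbers 𝓡
  open CommutativeRing commutativeRing
    using (sym; trans; +-comm; +-assoc; +-identityˡ; +-identityʳ; +-congˡ
          ; -‿cong; -‿inverseˡ; -‿inverseʳ; *-comm; *-identityˡ; ring)
  open DecTotalOrder decTotalOrder
    using (total; antisym; ≤-respˡ-≈; ≤-respʳ-≈)
    renaming (trans to ≤-trans)
  open RingProperties ring using ([y-z]x≈yx-zx; -‿distribˡ-*; -‿involutive)

  x≤y⇒0≤y-x : ∀ {x y} → x ≤ y → 0# ≤ y - x
  x≤y⇒0≤y-x {x} x≤y = ≤-respˡ-≈ (-‿inverseʳ x) (+-monoˡ-≤ (- x) x≤y)

  0≤y-x⇒x≤y : ∀ {x y} → 0# ≤ y - x → x ≤ y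
  0≤y-x⇒x≤y {x} {y} p =
    ≤-respˡ-≈ (+-identityˡ x)
      (≤-respʳ-≈ (trans (+-assoc y (- x) x)
                   (trans (+-congˡ (-‿inverseˡ x)) (+-identityʳ y)))
        (+-monoˡ-≤ x p))

  *-monoˡ-≤ : ∀ {x y z} → 0# ≤ z → x ≤ y → x * z ≤ y * z
  *-monoˡ-≤ {x} {y} {z} 0≤z x≤y =
    0≤y-x⇒x≤y (≤-respʳ-≈ ([y-z]x≈yx-zx z y x)
      (*-nonneg (x≤y⇒0≤y-x x≤y) 0≤z))

  0≤1 : 0# ≤ 1#
  0≤1 with total 0# 1#
  ... | inj₁ 0≤1′ = 0≤1′
  ... | inj₂ 1≤0 = ≤-respʳ-≈ [-1][-1]≈1 (*-nonneg 0≤-1 0≤-1)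
    where
    0≤-1 : 0# ≤ - 1#
    0≤-1 = ≤-respʳ-≈ (+-identityˡ (- 1#)) (x≤y⇒0≤y-x 1≤0)
    [-1][-1]≈1 : (- 1#) * (- 1#) ≈ 1#
    [-1][-1]≈1 =
      trans (sym (-‿distribˡ-* 1# (- 1#)))
        (trans (-‿cong (*-identityˡ (- 1#)))
          (-‿involutive 1#))

  1≤x⇒x⁻¹≤1 : ∀ {x} → 1# ≤ x → x ⁻¹ ≤ 1#
  1≤x⇒x⁻¹≤1 {x} 1≤x with total (x ⁻¹) 1#
  ... | inj₁ x⁻¹≤1 = x⁻¹≤1
  ... | inj₂ 1≤x⁻¹ =
    ≤-respˡ-≈ (*-identityˡ (x ⁻¹)) (≤-respʳ-≈ (*-inverseʳ x≉0)
      (*-monoˡ-≤ (≤-trans 0≤1 1≤x⁻¹) 1≤x))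
    where
    x≉0 : ¬ (x ≈ 0#)
    x≉0 x≈0 = 0≉1 (antisym 0≤1 (≤-respʳ-≈ x≈0 1≤x))

  1≤ε⁻¹ : ∀ {ε} → 0# < ε → ε < 1# → 1# ≤ ε ⁻¹
  1≤ε⁻¹ {ε} (0≤ε , 0≉ε) (ε≤1 , ε≉1) with total 1# (ε ⁻¹)
  ... | inj₁ 1≤ε⁻¹′ = 1≤ε⁻¹′
  ... | inj₂ ε⁻¹≤1 = contradiction (antisym ε≤1 1≤ε) ε≉1
    where
    1≤ε : 1# ≤ ε
    1≤ε = ≤-respˡ-≈ (trans (*-comm (ε ⁻¹) ε) (*-inverseʳ (λ ε≈0 → 0≉ε (sym ε≈0))))
            (≤-respʳ-≈ (*-identityˡ ε) (*-monoˡ-≤ 0≤ε ε⁻¹≤1))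

  y²≤x⇒y≤1+x : ∀ {x} → 0# ≤ x → UpperBound (λ y → y * y ≤ x) (1# + x)
  y²≤x⇒y≤1+x {x} 0≤x y y²≤x with total y 1#
  ... | inj₁ y≤1 = ≤-trans y≤1
    (≤-respˡ-≈ (+-identityˡ 1#) (≤-respʳ-≈ (+-comm x 1#) (+-monoˡ-≤ 1# 0≤x)))
  ... | inj₂ 1≤y =
    ≤-trans (≤-respˡ-≈ (*-identityˡ y) (*-monoˡ-≤ (≤-trans 0≤1 1≤y) 1≤y))
      (≤-trans y²≤x (≤-respˡ-≈ (+-identityˡ x) (+-monoˡ-≤ x 0≤1)))

module RealFunctions (𝓡 : RealNumbers) where
  open RealNumbers 𝓡
  open OrderLemmas 𝓡
  open CommutativeRing commutativeRing
    using (trans; sym; +-comm; +-assoc; +-identityˡ; +-congˡ; +-congʳ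
          ; -‿inverseʳ; -‿inverseˡ; *-comm; *-identityˡ; zeroˡ)
  open DecTotalOrder decTotalOrder
    using (≤-respˡ-≈; ≤-respʳ-≈)
    renaming (trans to ≤-trans; refl to ≤-refl)

  √ : (x : ℝ) → 0# ≤ x → ℝ
  √ x 0≤x = sup (λ y → y * y ≤ x)
                (0# , ≤-respˡ-≈ (sym (zeroˡ 0#)) 0≤x)
                (1# + x , y²≤x⇒y≤1+x 0≤x)

  -- LowerDarbouxSum a b s: s = Σᵢ (tᵢ₊₁ - tᵢ) / tᵢ₊₁ for some partition
  -- a = t₀ ≤ t₁ ≤ … ≤ tₖ = b.  For a > 0 these are the lower Darboux sums of
  -- the decreasing function t ↦ 1 / t on [a , b].
  data LowerDarbouxSum : ℝ → ℝ → ℝ → Set where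
    stop : ∀ {a} → LowerDarbouxSum a a 0#
    step : ∀ {a t b s} → a ≤ t → LowerDarbouxSum t b s →
           LowerDarbouxSum a b ((t - a) * t ⁻¹ + s)

  trivialPartition : ∀ {a b} → a ≤ b → ∃ (LowerDarbouxSum a b)
  trivialPartition a≤b = _ , step a≤b stop

  darboux-bounded : ∀ {a b s} → 1# ≤ a → LowerDarbouxSum a b s → a + s ≤ b
  darboux-bounded {a} 1≤a stop =
    ≤-respˡ-≈ (trans (sym (+-identityˡ a)) (+-comm 0# a)) ≤-refl
  darboux-bounded {a} {b} 1≤a (step {t = t} {s = s} a≤t p) =
    ≤-trans
      (≤-respʳ-≈ rearrange (≤-respˡ-≈ (+-comm (q + s) a)
        (+-monoˡ-≤ a (+-monoˡ-≤ s q≤t-a))))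
      (darboux-bounded 1≤t p)
    where
    q : ℝ
    q = (t - a) * t ⁻¹
    1≤t : 1# ≤ t
    1≤t = ≤-trans 1≤a a≤t
    q≤t-a : q ≤ t - a
    q≤t-a = ≤-respˡ-≈ (*-comm (t ⁻¹) (t - a)) (≤-respʳ-≈ (*-identityˡ (t - a))
              (*-monoˡ-≤ (x≤y⇒0≤y-x a≤t) (1≤x⇒x⁻¹≤1 1≤t)))
    rearrange : ((t - a) + s) + a ≈ t + s
    rearrange =
      trans (+-assoc (t - a) s a)
        (trans (+-congˡ (+-comm s a))
          (trans (sym (+-assoc (t - a) a s))
            (+-congʳ (trans (+-assoc t (- a) a)
              (trans (+-congˡ (-‿inverseˡ a))
                (trans (+-comm t 0#) (+-identityˡ t)))))))

  -- log x = ∫₁ˣ dt / t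
  log : (x : ℝ) → 1# ≤ x → ℝ
  log x 1≤x = sup (LowerDarbouxSum 1# x)
                  (trivialPartition 1≤x)
                  (x - 1# , bound)
    where
    bound : UpperBound (LowerDarbouxSum 1# x) (x - 1#)
    bound s p = ≤-respˡ-≈
      (trans (+-congʳ (+-comm 1# s))
        (trans (+-assoc s 1# (- 1#))
          (trans (+-congˡ (-‿inverseʳ 1#))
            (trans (+-comm s 0#) (+-identityˡ s)))))
      (+-monoˡ-≤ (- 1#) (darboux-bounded (≤-refl {1#}) p))

  sizeBound : ℕ → (ε : ℝ) → 0# < ε → ε < 1# → ℝ
  sizeBound C ε 0<ε ε<1 =
    fromℕ C * (√ ε (proj₁ 0<ε)) ⁻¹ * (1# + log (ε ⁻¹) (1≤ε⁻¹ 0<ε ε<1)) ^ C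

-- A finite set of n reals is an injective vector of length n.

module Coresets (𝓡 : RealNumbers) where
  open RealNumbers 𝓡

  IsFiniteSet : ∀ {n} → Vector ℝ n → Set
  IsFiniteSet P = Injective _≡_ _≈_ P

  weightedCost : ∀ {m} → Vector ℝ m → Vector ℝ m → ℝ → ℝ
  weightedCost S w c = sum (λ j → w j * ∣ S j - c ∣)

  cost : ∀ {n} → Vector ℝ n → ℝ → ℝ
  cost P c = sum (λ i → ∣ P i - c ∣)

  record IsCoreset {n m} (ε : ℝ) (P : Vector ℝ n) (S w : Vector ℝ m) : Set where
    field
      isFiniteSet : IsFiniteSet S
      subset      : ∀ j → ∃[ i ] S j ≈ P i
      nonneg      : ∀ j → 0# ≤ w j
      lower       : ∀ c → (1# - ε) * cost P c ≤ weightedCost S w c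
      upper       : ∀ c → weightedCost S w c ≤ (1# + ε) * cost P c

-- Real RAM programs.  Memory consists of arrays of natural numbers (used for
-- counting and indexing, with indirect addressing) and arrays of reals.  The
-- name of an array is a literal in the program text, so a program uses
-- finitely many of them.  There is no conversion from reals to naturals (no
-- floor) and no multiplication of naturals, as unit-cost versions of these
-- could exceed polynomial time.  Syntax does not mention the reals: the only
-- real constants are 0 and 1.

data NatExpr : Set where
  lit   : ℕ → NatExpr
  natAt : (array : ℕ) (index : NatExpr) → NatExpr
  _⊕_   : NatExpr → NatExpr → NatExpr
  _⊖_   : NatExpr → NatExpr → NatExpr

data RealExpr : Set where
  zeroR  : RealExpr
  oneR   : RealExpr
  realAt : (array : ℕ) (index : NatExpr) → RealExpr
  addR   : RealExpr → RealExpr → RealExpr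
  mulR   : RealExpr → RealExpr → RealExpr
  negR   : RealExpr → RealExpr
  invR   : RealExpr → RealExpr

data Test : Set where
  natLeq  : NatExpr → NatExpr → Test
  realLeq : RealExpr → RealExpr → Test

data Program : Set where
  skip    : Program
  setNat  : (array : ℕ) (index : NatExpr) → NatExpr → Program
  setReal : (array : ℕ) (index : NatExpr) → RealExpr → Program
  _⨾_     : Program → Program → Program
  ifte    : Test → Program → Program → Program
  while   : Test → Program → Program

infixl 6 _⊕_ _⊖_
infixr 4 _⨾_

module Semantics (𝓡 : RealNumbers) where
  open RealNumbers 𝓡

  record State : Set where
    constructor state
    field
      nats  : ℕ → ℕ → ℕ
      reals : ℕ → ℕ → ℝ

  open State public

  update : {A : Set} → (ℕ → ℕ → A) → ℕ → ℕ → A → (ℕ → ℕ → A)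
  update f a i x b j = if does (a ℕ.≟ b) ∧ does (i ℕ.≟ j) then x else f b j

  ⟦_⟧ⁿ : NatExpr → State → ℕ
  ⟦ lit k ⟧ⁿ     σ = k
  ⟦ natAt a i ⟧ⁿ σ = nats σ a (⟦ i ⟧ⁿ σ)
  ⟦ e ⊕ f ⟧ⁿ     σ = ⟦ e ⟧ⁿ σ ℕ.+ ⟦ f ⟧ⁿ σ
  ⟦ e ⊖ f ⟧ⁿ     σ = ⟦ e ⟧ⁿ σ ℕ.∸ ⟦ f ⟧ⁿ σ

  ⟦_⟧ʳ : RealExpr → State → ℝ
  ⟦ zeroR ⟧ʳ      σ = 0#
  ⟦ oneR ⟧ʳ       σ = 1#
  ⟦ realAt a i ⟧ʳ σ = reals σ a (⟦ i ⟧ⁿ σ)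
  ⟦ addR e f ⟧ʳ   σ = ⟦ e ⟧ʳ σ + ⟦ f ⟧ʳ σ
  ⟦ mulR e f ⟧ʳ   σ = ⟦ e ⟧ʳ σ * ⟦ f ⟧ʳ σ
  ⟦ negR e ⟧ʳ     σ = - ⟦ e ⟧ʳ σ
  ⟦ invR e ⟧ʳ     σ = (⟦ e ⟧ʳ σ) ⁻¹

  ⟦_⟧ᵗ : Test → State → Bool
  ⟦ natLeq e f ⟧ᵗ  σ = does (⟦ e ⟧ⁿ σ ℕ.≤? ⟦ f ⟧ⁿ σ)
  ⟦ realLeq e f ⟧ᵗ σ = does (⟦ e ⟧ʳ σ ≤? ⟦ f ⟧ʳ σ)

  -- ⟨ p , σ ⟩⇓[ t ] τ: p started in σ halts in τ after t steps, one for each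
  -- assignment, skip or test executed.  The expressions of a fixed program
  -- have bounded size, so counting every arithmetic operation would change t
  -- by a constant factor only.
  infix 3 ⟨_,_⟩⇓[_]_
  data ⟨_,_⟩⇓[_]_ : Program → State → ℕ → State → Set where
    skip⇓ : ∀ {σ} → ⟨ skip , σ ⟩⇓[ 1 ] σ
    setNat⇓ : ∀ {σ a i e} →
      ⟨ setNat a i e , σ ⟩⇓[ 1 ]
        state (update (nats σ) a (⟦ i ⟧ⁿ σ) (⟦ e ⟧ⁿ σ)) (reals σ)
    setReal⇓ : ∀ {σ a i e} →
      ⟨ setReal a i e , σ ⟩⇓[ 1 ]
        state (nats σ) (update (reals σ) a (⟦ i ⟧ⁿ σ) (⟦ e ⟧ʳ σ))
    seq⇓ : ∀ {σ τ υ p q s t} →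
      ⟨ p , σ ⟩⇓[ s ] τ → ⟨ q , τ ⟩⇓[ t ] υ → ⟨ p ⨾ q , σ ⟩⇓[ s ℕ.+ t ] υ
    ifTrue⇓ : ∀ {σ τ b p q t} → ⟦ b ⟧ᵗ σ ≡ true →
      ⟨ p , σ ⟩⇓[ t ] τ → ⟨ ifte b p q , σ ⟩⇓[ ℕ.suc t ] τ
    ifFalse⇓ : ∀ {σ τ b p q t} → ⟦ b ⟧ᵗ σ ≡ false →
      ⟨ q , σ ⟩⇓[ t ] τ → ⟨ ifte b p q , σ ⟩⇓[ ℕ.suc t ] τ
    whileTrue⇓ : ∀ {σ τ υ b p s t} → ⟦ b ⟧ᵗ σ ≡ true →
      ⟨ p , σ ⟩⇓[ s ] τ → ⟨ while b p , τ ⟩⇓[ t ] υ →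
      ⟨ while b p , σ ⟩⇓[ ℕ.suc (s ℕ.+ t) ] υ
    whileFalse⇓ : ∀ {σ b p} → ⟦ b ⟧ᵗ σ ≡ false →
      ⟨ while b p , σ ⟩⇓[ 1 ] σ

  load : ∀ {n} → Vector ℝ n → ℕ → ℝ
  load {n} P i with i ℕ.<? n
  ... | yes i<n = P (fromℕ< i<n)
  ... | no  _   = 0#

  -- Input: the number of points is in cell 0 of natural array 0, the points
  -- are in real array 0, and ε is in cell 0 of real array 1.
  input : ∀ {n} → Vector ℝ n → ℝ → State
  input {n} P ε = state ns rs
    where
    ns : ℕ → ℕ → ℕ
    ns 0 0 = n
    ns _ _ = 0
    rs : ℕ → ℕ → ℝ
    rs 0 i = load P i
    rs 1 0 = ε
    rs _ _ = 0#

  -- Output: the size is in cell 0 of natural array 0, the points are in real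
  -- array 2 and their weights in real array 3.
  outSize : State → ℕ
  outSize σ = nats σ 0 0

  outPoints : (σ : State) → Vector ℝ (outSize σ)
  outPoints σ j = reals σ 2 (toℕ j)

  outWeights : (σ : State) → Vector ℝ (outSize σ)
  outWeights σ j = reals σ 3 (toℕ j)

module Theory (𝓡 : RealNumbers) where
  open RealNumbers 𝓡 public
  open RealFunctions 𝓡 public
  open Coresets 𝓡 public
  open Semantics 𝓡 public

module Submission where

-- A point x between neighbouring knots a and b is split between them in
-- proportion 1 - θ : θ with x = a + θ (b - a).  By convexity the weighted cost
-- is never below the cost, both agree at every centre outside (a , b), and
-- inside they differ by at most the sum of the 2 θ (b - x).  The knots are
-- chosen greedily from the left: the next knot is the farthest point b for
-- which this sum is at most ε times the sum of the distances of all points to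
-- [a , b], which bounds the cost at every centre in [a , b] from below.
--
-- For the size, normalise the data so that 0 is a 1-median of cost n.  The
-- union of two consecutive intervals is always rejected by the greedy rule.
-- There are bounded monotone functions g and h with
-- (g b - g a) (h b - h a) ≥ ε n for every rejected [a , b]: near 0, length and
-- number of points; to the right of 3, the logarithm and the total of the p - 1
-- over the points p up to x; beyond 1 + 2 / ε nothing is rejected; the left
-- side is symmetric, and unit steps take care of intervals that cross a
-- boundary.  The ranges of g and h are O(1 + log (1 / ε)) and O(n), so by
-- Cauchy–Schwarz J rejected intervals satisfy J² ε n = O(n (1 + log (1 / ε))).

-- Splitting keeps the total weight and the first moment of a segment, so a segment is exact for
-- every centre outside its interior. A centre therefore feels the error of a single segment, which
-- is why every segment may spend the whole of ε. A single accepted interval carries no lower bound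
-- on its error, so nothing can be counted on it. The right end of the following interval, however,
-- is a point that the farthest-point rule had refused; hence the count runs over double steps. The
-- program uses field operations and comparisons only: median, normalisation, logarithm and square
-- root occur in the analysis alone. There the median is the cheapest data point m, of cost A, and
-- the data are translated by m and scaled by n / A. If A = 0, all points coincide and there is one
-- knot. The logarithm is in 1 / ε, not in n or in the spread of the data, because an interval at
-- distance about 2 / ε from the median has a cost so large that the error of all points together is
-- affordable.

open import Defs
open import Algebra.Bundles using (CommutativeRing)
import Algebra.Construct.NaturalChoice.Max as Max
import Algebra.Construct.NaturalChoice.Min as Min
import Algebra.Properties.CommutativeMonoid.Sum as Sum
import Algebra.Properties.Ring as RingProperties
import Algebra.Properties.Semiring.Mult.TCOptimised as SemiringMult
import Algebra.Solver.Ring as RingSolver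
open import Algebra.Solver.Ring.AlmostCommutativeRing
  using (AlmostCommutativeRing; fromCommutativeRing; _-Raw-AlmostCommutative⟶_)
open import Data.Bool using (true; false; if_then_else_)
open import Data.Fin as Fin using (toℕ)
open import Data.Fin.Properties
  using (pigeonhole; toℕ-fromℕ<; toℕ≤pred[n]; toℕ<n; fromℕ<-toℕ; toℕ-injective; fromℕ<-injective)
open import Data.Integer as ℤ using (ℤ; +_; -[1+_])
import Data.Integer.Properties as ℤₚ
open import Data.Maybe using (just; nothing)
open import Data.Nat as ℕ using (ℕ; zero; suc)
import Data.Nat.Properties as ℕₚ
open import Data.Product using (_×_; _,_; ∃-syntax; Σ-syntax; proj₁; proj₂)
import Data.Sign as Sign
open import Data.Sum using (_⊎_; inj₁; inj₂; [_,_]′)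
open import Data.Vec.Functional using (Vector)
open import Function using (_∘_)
open import Relation.Binary using (DecTotalOrder; WeaklyDecidable; tri<; tri≈; tri>)
import Relation.Binary.Construct.NonStrictToStrict as NonStrictToStrict
open import Relation.Binary.PropositionalEquality as ≡ using (_≡_)
import Relation.Binary.Reasoning.Setoid as SetoidReasoning
open import Relation.Nullary using (¬_; Dec; yes; no; contradiction; does)
open import Relation.Nullary.Decidable using (toSum; dec-true; dec-false)

-- The coefficients are integers because equality of reals, though decidable,
-- does not compute.
module ℤSolver (𝓡 : RealNumbers) where
  open RealNumbers 𝓡
  open CommutativeRing commutativeRing hiding (_-_; _+_; _*_; -_; _≈_; 0#; 1#)
  open SemiringMult semiring using (×-homo-+; ×1-homo-*; 1+×; ×ᵤ≈×) renaming (_×_ to _×′_)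
  open RingProperties ring using (-‿+-comm; -0#≈0#; -‿involutive; -‿distribˡ-*; -‿distribʳ-*)
  open SetoidReasoning setoid

  ⟦_⟧ : ℤ → ℝ
  ⟦ + n ⟧      = n ×′ 1#
  ⟦ -[1+ n ] ⟧ = - (suc n ×′ 1#)

  ⟦⟧-neg : ∀ n → ⟦ ℤ.- (+ n) ⟧ ≈ - (n ×′ 1#)
  ⟦⟧-neg zero    = sym -0#≈0#
  ⟦⟧-neg (suc n) = refl

  ⟦⟧-⊖ : ∀ m n → ⟦ m ℤ.⊖ n ⟧ ≈ (m ×′ 1#) + - (n ×′ 1#)
  ⟦⟧-⊖ m zero = begin
    m ×′ 1#          ≈⟨ +-identityʳ _ ⟨
    m ×′ 1# + 0#     ≈⟨ +-congˡ -0#≈0# ⟨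
    m ×′ 1# + - 0#   ∎
  ⟦⟧-⊖ zero (suc n) = sym (+-identityˡ _)
  ⟦⟧-⊖ (suc m) (suc n) = begin
    ⟦ suc m ℤ.⊖ suc n ⟧            ≡⟨ ≡.cong ⟦_⟧ (ℤₚ.[1+m]⊖[1+n]≡m⊖n m n) ⟩
    ⟦ m ℤ.⊖ n ⟧                    ≈⟨ ⟦⟧-⊖ m n ⟩
    a + - b                        ≈⟨ +-congʳ (+-identityʳ a) ⟨
    a + 0# + - b                   ≈⟨ +-congʳ (+-congˡ (-‿inverseʳ 1#)) ⟨
    a + (1# + - 1#) + - b          ≈⟨ +-congʳ (+-assoc a 1# (- 1#)) ⟨
    a + 1# + - 1# + - b            ≈⟨ +-congʳ (+-congʳ (+-comm a 1#)) ⟩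
    1# + a + - 1# + - b            ≈⟨ +-assoc (1# + a) (- 1#) (- b) ⟩
    1# + a + (- 1# + - b)          ≈⟨ +-congˡ (-‿+-comm 1# b) ⟩
    1# + a + - (1# + b)            ≈⟨ +-cong (1+× m 1#) (-‿cong (1+× n 1#)) ⟨
    suc m ×′ 1# + - (suc n ×′ 1#)  ∎
    where
    a = m ×′ 1#
    b = n ×′ 1#

  ⟦⟧-homo-neg : ∀ i → ⟦ ℤ.- i ⟧ ≈ - ⟦ i ⟧
  ⟦⟧-homo-neg (+ n)      = ⟦⟧-neg n
  ⟦⟧-homo-neg -[1+ n ]   = sym (-‿involutive _)

  ⟦⟧-homo-+ : ∀ i j → ⟦ i ℤ.+ j ⟧ ≈ ⟦ i ⟧ + ⟦ j ⟧
  ⟦⟧-homo-+ (+ m)      (+ n)      = ×-homo-+ 1# m n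
  ⟦⟧-homo-+ (+ m)      -[1+ n ]   = ⟦⟧-⊖ m (suc n)
  ⟦⟧-homo-+ -[1+ m ]   (+ n)      = trans (⟦⟧-⊖ n (suc m)) (+-comm _ _)
  ⟦⟧-homo-+ -[1+ m ]   -[1+ n ]   = begin
    - (suc (suc (m ℕ.+ n)) ×′ 1#)        ≡⟨ ≡.cong (λ k → - (suc k ×′ 1#)) (≡.sym (ℕₚ.+-suc m n)) ⟩
    - ((suc m ℕ.+ suc n) ×′ 1#)          ≈⟨ -‿cong (×-homo-+ 1# (suc m) (suc n)) ⟩
    - (suc m ×′ 1# + suc n ×′ 1#)        ≈⟨ -‿+-comm _ _ ⟨
    - (suc m ×′ 1#) + - (suc n ×′ 1#)    ∎

  ⟦⟧-pos-* : ∀ m j → ⟦ + m ℤ.* j ⟧ ≈ m ×′ 1# * ⟦ j ⟧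
  ⟦⟧-pos-* m (+ n) = trans (reflexive (≡.cong ⟦_⟧ (ℤₚ.+◃n≡+n (m ℕ.* n)))) (×1-homo-* m n)
  ⟦⟧-pos-* m -[1+ n ] = begin
    ⟦ Sign.- ℤ.◃ (m ℕ.* suc n) ⟧         ≡⟨ ≡.cong ⟦_⟧ (ℤₚ.-◃n≡-n (m ℕ.* suc n)) ⟩
    ⟦ ℤ.- (+ (m ℕ.* suc n)) ⟧            ≈⟨ ⟦⟧-neg (m ℕ.* suc n) ⟩
    - ((m ℕ.* suc n) ×′ 1#)              ≈⟨ -‿cong (×1-homo-* m (suc n)) ⟩
    - (m ×′ 1# * suc n ×′ 1#)            ≈⟨ -‿distribʳ-* _ _ ⟩
    m ×′ 1# * - (suc n ×′ 1#)            ∎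

  ⟦⟧-homo-* : ∀ i j → ⟦ i ℤ.* j ⟧ ≈ ⟦ i ⟧ * ⟦ j ⟧
  ⟦⟧-homo-* (+ m)    j = ⟦⟧-pos-* m j
  ⟦⟧-homo-* -[1+ m ] j = begin
    ⟦ -[1+ m ] ℤ.* j ⟧          ≡⟨ ≡.cong ⟦_⟧ (≡.sym (ℤₚ.neg-distribˡ-* (+ suc m) j)) ⟩
    ⟦ ℤ.- (+ suc m ℤ.* j) ⟧     ≈⟨ ⟦⟧-homo-neg (+ suc m ℤ.* j) ⟩
    - ⟦ + suc m ℤ.* j ⟧         ≈⟨ -‿cong (⟦⟧-pos-* (suc m) j) ⟩
    - (suc m ×′ 1# * ⟦ j ⟧)     ≈⟨ -‿distribˡ-* _ _ ⟩
    - (suc m ×′ 1#) * ⟦ j ⟧     ∎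

  almostCommutativeRing : AlmostCommutativeRing _ _
  almostCommutativeRing = fromCommutativeRing commutativeRing

  ⟦⟧-morphism : ℤ.+-*-rawRing -Raw-AlmostCommutative⟶ almostCommutativeRing
  ⟦⟧-morphism = record
    { ⟦_⟧    = ⟦_⟧
    ; +-homo = ⟦⟧-homo-+
    ; *-homo = ⟦⟧-homo-*
    ; -‿homo = ⟦⟧-homo-neg
    ; 0-homo = refl
    ; 1-homo = refl
    }

  _coeff≟_ : WeaklyDecidable (λ i j → ⟦ i ⟧ ≈ ⟦ j ⟧)
  i coeff≟ j with i ℤ.≟ j
  ... | yes ≡.refl = just refl
  ... | no _       = nothing

  open RingSolver ℤ.+-*-rawRing almostCommutativeRing ⟦⟧-morphism _coeff≟_ public
    using (solve; _:+_; _:*_; _:-_; :-_; _:=_; con)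

  numeral : ℕ → ℝ
  numeral n = n ×′ 1#

  fromℕ≈numeral : ∀ n → fromℕ n ≈ numeral n
  fromℕ≈numeral n = ×ᵤ≈× n 1#

-- Ordered-field arithmetic, absolute values and finite sums.

module OrderedField (𝓡 : RealNumbers) where
  open RealNumbers 𝓡 public
  open ℤSolver 𝓡 public
  open OrderLemmas 𝓡 public using (x≤y⇒0≤y-x; 0≤y-x⇒x≤y; 0≤1; *-monoˡ-≤)
  open CommutativeRing commutativeRing public
    using (refl; sym; trans; reflexive; setoid; +-cong; +-congˡ; +-congʳ; *-cong; *-congˡ; *-congʳ; -‿cong
          ; +-identityˡ; +-identityʳ; *-identityˡ; *-identityʳ; +-comm; +-assoc; *-comm; *-assoc; -‿inverseʳ; zeroˡ; zeroʳ)
  open DecTotalOrder decTotalOrder public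
    using (total; antisym; ≤-respˡ-≈; ≤-respʳ-≈)
    renaming (trans to ≤-trans; refl to ≤-refl; reflexive to ≤-reflexive)
  open Max (DecTotalOrder.totalOrder decTotalOrder)
    using (x≤x⊔y; x≤y⊔x; ⊔-lub)

  ≤-resp : ∀ {x x′ y y′} → x ≈ x′ → y ≈ y′ → x ≤ y → x′ ≤ y′
  ≤-resp p q r = ≤-respʳ-≈ q (≤-respˡ-≈ p r)

  ≰⇒≥ : ∀ {x y} → ¬ (x ≤ y) → y ≤ x
  ≰⇒≥ {x} {y} x≰y with total x y
  ... | inj₁ x≤y = contradiction x≤y x≰y
  ... | inj₂ y≤x = y≤x

  ≰⇒> : ∀ {x y} → ¬ (x ≤ y) → y < x
  ≰⇒> = NonStrictToStrict.≰⇒> _≈_ _≤_ sym ≤-reflexive total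

  <⇒≱ : ∀ {x y} → x < y → ¬ (y ≤ x)
  <⇒≱ = NonStrictToStrict.<⇒≱ _≈_ _≤_ antisym

  -- The standard pattern for inequalities below: the difference of the two sides is written as a
  -- visibly nonnegative expression, and the ring solver checks the identity.
  ≤-by : ∀ {x y e} → 0# ≤ e → y - x ≈ e → x ≤ y
  ≤-by 0≤e y-x≈e = 0≤y-x⇒x≤y (≤-respʳ-≈ (sym y-x≈e) 0≤e)

  infixl 6 _⊕≤_
  infixl 7 _⊗≤_

  _⊕≤_ : ∀ {x y} → 0# ≤ x → 0# ≤ y → 0# ≤ x + y
  _⊕≤_ {x} {y} 0≤x 0≤y = ≤-trans 0≤y (≤-respˡ-≈ (+-identityˡ y) (+-monoˡ-≤ y 0≤x))

  _⊗≤_ : ∀ {x y} → 0# ≤ x → 0# ≤ y → 0# ≤ x * y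
  _⊗≤_ = *-nonneg

  Δ : ∀ {x y} → x ≤ y → 0# ≤ y - x
  Δ = x≤y⇒0≤y-x

  +-mono-≤ : ∀ {x y u v} → x ≤ y → u ≤ v → x + u ≤ y + v
  +-mono-≤ x≤y u≤v = ≤-by (Δ x≤y ⊕≤ Δ u≤v)
    (solve 4 (λ x y u v → (y :+ v) :- (x :+ u) := (y :- x) :+ (v :- u)) refl _ _ _ _)

  *-monoʳ-≤ : ∀ {x y z} → 0# ≤ z → x ≤ y → z * x ≤ z * y
  *-monoʳ-≤ 0≤z x≤y = ≤-resp (*-comm _ _) (*-comm _ _) (*-monoˡ-≤ 0≤z x≤y)

  neg-mono-≤ : ∀ {x y} → x ≤ y → - y ≤ - x
  neg-mono-≤ x≤y = ≤-by (Δ x≤y) (solve 2 (λ x y → (:- x) :- (:- y) := y :- x) refl _ _)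

  0≤x² : ∀ x → 0# ≤ x * x
  0≤x² x with total 0# x
  ... | inj₁ 0≤x = 0≤x ⊗≤ 0≤x
  ... | inj₂ x≤0 = ≤-respʳ-≈ (solve 1 (λ x → (con (+ 0) :- x) :* (con (+ 0) :- x) := x :* x) refl x) (Δ x≤0 ⊗≤ Δ x≤0)

  x≤1+x : ∀ x → x ≤ 1# + x
  x≤1+x x = ≤-by 0≤1 (solve 1 (λ x → (con (+ 1) :+ x) :- x := con (+ 1)) refl x)

  1≰0 : ¬ (1# ≤ 0#)
  1≰0 1≤0 = 0≉1 (antisym 0≤1 1≤0)

  ⁻¹-inverse : ∀ {x} → ¬ (x ≤ 0#) → x * x ⁻¹ ≈ 1#
  ⁻¹-inverse x≰0 = *-inverseʳ (λ x≈0 → x≰0 (≤-reflexive x≈0))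

  ⁻¹-nonneg : ∀ {x} → ¬ (x ≤ 0#) → 0# ≤ x ⁻¹
  ⁻¹-nonneg {x} x≰0 with total 0# (x ⁻¹)
  ... | inj₁ 0≤x⁻¹ = 0≤x⁻¹
  ... | inj₂ x⁻¹≤0 = contradiction
    (≤-resp (⁻¹-inverse x≰0) (zeroʳ x) (*-monoʳ-≤ (≰⇒≥ x≰0) x⁻¹≤0)) 1≰0

  *-cancelˡ-≤ : ∀ {x y z} → ¬ (z ≤ 0#) → z * x ≤ z * y → x ≤ y
  *-cancelˡ-≤ {x} {y} {z} z≰0 zx≤zy = ≤-resp (unscale x) (unscale y) (*-monoʳ-≤ (⁻¹-nonneg z≰0) zx≤zy)
    where
    unscale : ∀ u → z ⁻¹ * (z * u) ≈ u
    unscale u = trans (solve 3 (λ i z u → i :* (z :* u) := z :* i :* u) refl _ _ _)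
      (trans (*-congʳ (⁻¹-inverse z≰0)) (*-identityˡ u))

  square-cancel-≤ : ∀ {x y} → 0# ≤ y → x * x ≤ y * y → x ≤ y
  square-cancel-≤ {x} {y} 0≤y x²≤y² with x ≤? y
  ... | yes x≤y = x≤y
  ... | no x≰y = *-cancelˡ-≤ x+y≰0
    (≤-by (Δ x²≤y²) (solve 2 (λ x y → (x :+ y) :* y :- (x :+ y) :* x := y :* y :- x :* x) refl x y))
    where
    x+y≰0 : ¬ (x + y ≤ 0#)
    x+y≰0 p = x≰y (≤-trans (≤-by (Δ p ⊕≤ 0≤y) (solve 2 (λ x y → con (+ 0) :- x := (con (+ 0) :- (x :+ y)) :+ y) refl x y)) 0≤y)

  x≤∣x∣ : ∀ x → x ≤ ∣ x ∣
  x≤∣x∣ x = x≤x⊔y x (- x)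

  -x≤∣x∣ : ∀ x → - x ≤ ∣ x ∣
  -x≤∣x∣ x = x≤y⊔x x (- x)

  ∣x∣≤ : ∀ {x y} → x ≤ y → - x ≤ y → ∣ x ∣ ≤ y
  ∣x∣≤ = ⊔-lub

  0≤∣x∣ : ∀ x → 0# ≤ ∣ x ∣
  0≤∣x∣ x with total 0# x
  ... | inj₁ 0≤x = ≤-trans 0≤x (x≤∣x∣ x)
  ... | inj₂ x≤0 = ≤-trans (≤-by (Δ x≤0) (solve 1 (λ x → (:- x) :- con (+ 0) := con (+ 0) :- x) refl x)) (-x≤∣x∣ x)

  ∣x-y∣≈x-y : ∀ {x y} → y ≤ x → ∣ x - y ∣ ≈ x - y
  ∣x-y∣≈x-y {x} {y} y≤x = antisym
    (∣x∣≤ ≤-refl (≤-by (Δ y≤x ⊕≤ Δ y≤x) (solve 2 (λ x y → (x :- y) :- (:- (x :- y)) := (x :- y) :+ (x :- y)) refl x y)))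
    (x≤∣x∣ _)

  ∣x-y∣≈y-x : ∀ {x y} → x ≤ y → ∣ x - y ∣ ≈ y - x
  ∣x-y∣≈y-x {x} {y} x≤y = antisym
    (∣x∣≤ (≤-by (Δ x≤y ⊕≤ Δ x≤y) (solve 2 (λ x y → (y :- x) :- (x :- y) := (y :- x) :+ (y :- x)) refl x y))
          (≤-reflexive -[x-y]≈y-x))
    (≤-respˡ-≈ -[x-y]≈y-x (-x≤∣x∣ _))
    where
    -[x-y]≈y-x : - (x - y) ≈ y - x
    -[x-y]≈y-x = solve 2 (λ x y → :- (x :- y) := y :- x) refl x y

  -- Recursion at the upper end matches the order in which a loop accumulates, so that the contents
  -- of an accumulator are propositionally equal to `Σ`.
  Σ : ℕ → (ℕ → ℝ) → ℝ
  Σ zero    f = 0#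
  Σ (suc n) f = Σ n f + f n

  Σ-mono : ∀ n {f g : ℕ → ℝ} → (∀ i → i ℕ.< n → f i ≤ g i) → Σ n f ≤ Σ n g
  Σ-mono zero    f≤g = ≤-refl
  Σ-mono (suc n) f≤g = +-mono-≤ (Σ-mono n (λ i i<n → f≤g i (ℕₚ.m<n⇒m<1+n i<n))) (f≤g n (ℕₚ.n<1+n n))

  Σ-cong : ∀ n {f g : ℕ → ℝ} → (∀ i → i ℕ.< n → f i ≈ g i) → Σ n f ≈ Σ n g
  Σ-cong zero    f≈g = refl
  Σ-cong (suc n) f≈g = +-cong (Σ-cong n (λ i i<n → f≈g i (ℕₚ.m<n⇒m<1+n i<n))) (f≈g n (ℕₚ.n<1+n n))

  Σ-+ : ∀ n (f g : ℕ → ℝ) → Σ n (λ i → f i + g i) ≈ Σ n f + Σ n g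
  Σ-+ zero    f g = sym (+-identityˡ 0#)
  Σ-+ (suc n) f g = trans (+-congʳ (Σ-+ n f g))
    (solve 4 (λ a b c d → (a :+ b) :+ (c :+ d) := (a :+ c) :+ (b :+ d)) refl _ _ _ _)

  Σ-* : ∀ n k (f : ℕ → ℝ) → Σ n (λ i → k * f i) ≈ k * Σ n f
  Σ-* zero    k f = sym (zeroʳ k)
  Σ-* (suc n) k f = trans (+-congʳ (Σ-* n k f))
    (solve 3 (λ k a b → k :* a :+ k :* b := k :* (a :+ b)) refl _ _ _)

  Σ-const : ∀ n c → Σ n (λ _ → c) ≈ fromℕ n * c
  Σ-const zero    c = sym (zeroˡ c)
  Σ-const (suc n) c = trans (+-congʳ (Σ-const n c))
    (solve 2 (λ n c → n :* c :+ c := (con (+ 1) :+ n) :* c) refl _ _)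

  Σ-nonneg : ∀ n {f : ℕ → ℝ} → (∀ i → i ℕ.< n → 0# ≤ f i) → 0# ≤ Σ n f
  Σ-nonneg zero    0≤f = ≤-refl
  Σ-nonneg (suc n) 0≤f = Σ-nonneg n (λ i i<n → 0≤f i (ℕₚ.m<n⇒m<1+n i<n)) ⊕≤ 0≤f n (ℕₚ.n<1+n n)

  0≤fromℕ : ∀ n → 0# ≤ fromℕ n
  0≤fromℕ n = ≤-respʳ-≈ (trans (Σ-const n 1#) (*-identityʳ _)) (Σ-nonneg n (λ _ _ → 0≤1))

  0≤numeral : ∀ n → 0# ≤ numeral n
  0≤numeral n = ≤-respʳ-≈ (fromℕ≈numeral n) (0≤fromℕ n)

  term≤Σ : ∀ n {f : ℕ → ℝ} → (∀ i → i ℕ.< n → 0# ≤ f i) → ∀ i → i ℕ.< n → f i ≤ Σ n f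
  term≤Σ (suc n) {f} 0≤f i i<1+n with ℕₚ.m≤n⇒m<n∨m≡n (ℕₚ.≤-pred i<1+n)
  ... | inj₁ i<n = ≤-trans (term≤Σ n (λ i i<n → 0≤f i (ℕₚ.m<n⇒m<1+n i<n)) i i<n)
    (≤-by (0≤f n (ℕₚ.n<1+n n)) (solve 2 (λ a b → (a :+ b) :- a := b) refl _ _))
  ... | inj₂ ≡.refl = ≤-by (Σ-nonneg n (λ i i<n → 0≤f i (ℕₚ.m<n⇒m<1+n i<n)))
    (solve 2 (λ a b → (a :+ b) :- b := a) refl _ _)

  Σ-suc : ∀ n (f : ℕ → ℝ) → Σ (suc n) f ≈ f 0 + Σ n (f ∘ suc)
  Σ-suc zero    f = +-comm 0# (f 0)
  Σ-suc (suc n) f = trans (+-congʳ (Σ-suc n f)) (+-assoc _ _ _)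

  sum≈Σ : ∀ n (f : ℕ → ℝ) → sum {n} (λ j → f (toℕ j)) ≈ Σ n f
  sum≈Σ zero    f = refl
  sum≈Σ (suc n) f = trans (+-congˡ (sum≈Σ n (f ∘ suc))) (sym (Σ-suc n f))

  -- One cut-off for two uses: the potentials count or weigh the points up to x, and the greedy
  -- invariant speaks of the cost of the points up to the last knot.
  upTo : ℝ → ℝ → ℝ → ℝ
  upTo x p μ = if does (p ≤? x) then μ else 0#

  upTo-≤ : ∀ {x p} μ → p ≤ x → upTo x p μ ≡ μ
  upTo-≤ {x} {p} μ p≤x with p ≤? x
  ... | yes _  = ≡.refl
  ... | no p≰x = contradiction p≤x p≰x

  upTo-≰ : ∀ {x p} μ → ¬ (p ≤ x) → upTo x p μ ≡ 0#
  upTo-≰ {x} {p} μ p≰x with p ≤? x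
  ... | yes p≤x = contradiction p≤x p≰x
  ... | no _    = ≡.refl

  upTo-nonneg : ∀ x p {μ} → 0# ≤ μ → 0# ≤ upTo x p μ
  upTo-nonneg x p 0≤μ with p ≤? x
  ... | yes _ = 0≤μ
  ... | no _  = ≤-refl

  upTo-≤μ : ∀ x p {μ} → 0# ≤ μ → upTo x p μ ≤ μ
  upTo-≤μ x p 0≤μ with p ≤? x
  ... | yes _ = ≤-refl
  ... | no _  = 0≤μ

  upTo-mono : ∀ {x y} p {μ} → 0# ≤ μ → x ≤ y → upTo x p μ ≤ upTo y p μ
  upTo-mono {x} {y} p {μ} 0≤μ x≤y with p ≤? x
  ... | yes p≤x = ≤-reflexive (reflexive (≡.sym (upTo-≤ μ (≤-trans p≤x x≤y))))
  ... | no _    = upTo-nonneg y p 0≤μ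

-- Logarithm and square root from their suprema.

module LogSqrt (𝓡 : RealNumbers) where
  open OrderedField 𝓡
  open RealFunctions 𝓡
  open OrderLemmas 𝓡 using (1≤ε⁻¹)

  log-lub : ∀ {x} (1≤x : 1# ≤ x) → LeastUpperBound (LowerDarbouxSum 1# x) (log x 1≤x)
  log-lub 1≤x = proj₂ (complete _ _ _)

  1≤x⇒x≰0 : ∀ {x} → 1# ≤ x → ¬ (x ≤ 0#)
  1≤x⇒x≰0 1≤x x≤0 = 1≰0 (≤-trans 1≤x x≤0)

  extend : ∀ {a b t s} → LowerDarbouxSum a b s → b ≤ t →
           ∃[ s′ ] (LowerDarbouxSum a t s′ × s′ ≈ s + (t - b) * t ⁻¹)
  extend stop b≤t = _ , step b≤t stop , +-comm _ _
  extend (step a≤u p) b≤t with extend p b≤t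
  ... | _ , q , eq = _ , step a≤u q , trans (+-congˡ eq) (sym (+-assoc _ _ _))

  -- Every lower sum up to a becomes one up to b by appending the single interval [a , b], whose
  -- term is (b - a) / b. Hence `log b` minus this term is an upper bound of the lower sums for a.
  log-step : ∀ {a b} (1≤a : 1# ≤ a) (1≤b : 1# ≤ b) → a ≤ b →
             (b - a) * b ⁻¹ ≤ log b 1≤b - log a 1≤a
  log-step {a} {b} 1≤a 1≤b a≤b =
    ≤-by (Δ log-a≤) (solve 3 (λ la lb q → (lb :- la) :- q := (lb :- q) :- la) refl _ _ _)
    where
    log-a≤ : log a 1≤a ≤ log b 1≤b - (b - a) * b ⁻¹
    log-a≤ = proj₂ (log-lub 1≤a) _ λ s p → let s′ , p′ , eq = extend p a≤b in
      ≤-by (Δ (≤-respˡ-≈ eq (proj₁ (log-lub 1≤b) s′ p′)))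
        (solve 3 (λ lb q s → (lb :- q) :- s := lb :- (s :+ q)) refl _ _ _)

  log-mono : ∀ {a b} (1≤a : 1# ≤ a) (1≤b : 1# ≤ b) → a ≤ b → log a 1≤a ≤ log b 1≤b
  log-mono 1≤a 1≤b a≤b = 0≤y-x⇒x≤y
    (≤-trans (Δ a≤b ⊗≤ ⁻¹-nonneg (1≤x⇒x≰0 1≤b)) (log-step 1≤a 1≤b a≤b))

  0≤log : ∀ {x} (1≤x : 1# ≤ x) → 0# ≤ log x 1≤x
  0≤log 1≤x = ≤-trans ((Δ 1≤x ⊗≤ ⁻¹-nonneg (1≤x⇒x≰0 1≤x)) ⊕≤ ≤-refl)
    (proj₁ (log-lub 1≤x) _ (step 1≤x stop))

  √-lub : ∀ {x} (0≤x : 0# ≤ x) → LeastUpperBound (λ y → y * y ≤ x) (√ x 0≤x)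
  √-lub 0≤x = proj₂ (complete _ _ _)

  -- For x ≤ 1 the number x itself satisfies x² ≤ x and lies below the supremum.
  √≰0 : ∀ {x} (0≤x : 0# ≤ x) → x ≤ 1# → ¬ (x ≤ 0#) → ¬ (√ x 0≤x ≤ 0#)
  √≰0 {x} 0≤x x≤1 x≰0 √≤0 = x≰0 (≤-trans
    (proj₁ (√-lub 0≤x) x (≤-respʳ-≈ (*-identityˡ x) (*-monoˡ-≤ 0≤x x≤1))) √≤0)

  √≤1 : ∀ {x} (0≤x : 0# ≤ x) → x ≤ 1# → √ x 0≤x ≤ 1#
  √≤1 0≤x x≤1 = proj₂ (√-lub 0≤x) 1# λ y y²≤x →
    square-cancel-≤ 0≤1 (≤-respʳ-≈ (sym (*-identityˡ 1#)) (≤-trans y²≤x x≤1))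

  -- Every y with y² ≤ x satisfies (j y)² ≤ k², which bounds √ x by k / j.
  ≤k/√x : ∀ {x j k} (0≤x : 0# ≤ x) → x ≤ 1# → ¬ (x ≤ 0#) → 0# ≤ k →
          j * j * x ≤ k * k → j ≤ k * √ x 0≤x ⁻¹
  ≤k/√x {x} {j} {k} 0≤x x≤1 x≰0 0≤k j²x≤k² with j ≤? 0#
  ... | yes j≤0 = ≤-trans j≤0 (0≤k ⊗≤ ⁻¹-nonneg (√≰0 0≤x x≤1 x≰0))
  ... | no j≰0 = ≤-respˡ-≈ (trans (*-assoc j r (r ⁻¹)) (trans (*-congˡ (⁻¹-inverse r≰0)) (*-identityʳ j)))
                   (*-monoˡ-≤ (⁻¹-nonneg r≰0) jr≤k)
    where
    r : ℝ
    r = √ x 0≤x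
    r≰0 : ¬ (r ≤ 0#)
    r≰0 = √≰0 0≤x x≤1 x≰0
    j*[k/j] : j * (k * j ⁻¹) ≈ k
    j*[k/j] = trans (solve 3 (λ j k i → j :* (k :* i) := k :* (j :* i)) refl _ _ _)
      (trans (*-congˡ (⁻¹-inverse j≰0)) (*-identityʳ k))
    r≤k/j : r ≤ k * j ⁻¹
    r≤k/j = proj₂ (√-lub 0≤x) _ λ y y²≤x → *-cancelˡ-≤ j≰0 (≤-respʳ-≈ (sym j*[k/j])
      (square-cancel-≤ 0≤k (≤-trans
        (≤-respˡ-≈ (solve 2 (λ j y → (j :* j) :* (y :* y) := (j :* y) :* (j :* y)) refl j y)
          (*-monoʳ-≤ (0≤x² j) y²≤x)) j²x≤k²)))
    jr≤k : j * r ≤ k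
    jr≤k = ≤-respʳ-≈ j*[k/j] (*-monoʳ-≤ (≰⇒≥ j≰0) r≤k/j)

-- Counting by monotone potentials.

module Potentials (𝓡 : RealNumbers) where
  open OrderedField 𝓡

  -- Cauchy–Schwarz for the square roots of the x j and y j.
  Σ*Σ : ∀ J {τ} (x y : ℕ → ℝ) → 0# ≤ τ →
        (∀ j → j ℕ.< J → 0# ≤ x j) → (∀ j → j ℕ.< J → 0# ≤ y j) →
        (∀ j → j ℕ.< J → τ ≤ x j * y j) →
        fromℕ J * fromℕ J * τ ≤ Σ J x * Σ J y
  Σ*Σ zero {τ} x y 0≤τ 0≤x 0≤y τ≤xy = ≤-reflexive
    (solve 1 (λ t → con (+ 0) :* con (+ 0) :* t := con (+ 0) :* con (+ 0)) refl τ)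
  Σ*Σ (suc J) {τ} x y 0≤τ 0≤x 0≤y τ≤xy =
    ≤-by (Δ IH ⊕≤ Δ 2kτ≤ ⊕≤ Δ τ≤uv)
      (solve 6 (λ k t X Y u v → (X :+ u) :* (Y :+ v) :- (con (+ 1) :+ k) :* (con (+ 1) :+ k) :* t
                  := (X :* Y :- k :* k :* t) :+ ((X :* v :+ u :* Y) :- con (+ 2) :* k :* t) :+ (u :* v :- t))
             refl k τ X Y u v)
    where
    k = fromℕ J
    X = Σ J x
    Y = Σ J y
    u = x J
    v = y J
    below : ∀ {P : ℕ → Set} → (∀ j → j ℕ.< suc J → P j) → ∀ j → j ℕ.< J → P j
    below f j j<J = f j (ℕₚ.m<n⇒m<1+n j<J)
    IH : k * k * τ ≤ X * Y
    IH = Σ*Σ J x y 0≤τ (below 0≤x) (below 0≤y) (below τ≤xy)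
    τ≤uv : τ ≤ u * v
    τ≤uv = τ≤xy J (ℕₚ.n<1+n J)
    0≤uv : 0# ≤ u * v
    0≤uv = ≤-trans 0≤τ τ≤uv
    -- The cross terms by AM-GM: (X v + u Y)² ≥ 4 (X Y) (u v) ≥ 4 (k² τ) τ.
    2kτ≤ : (1# + 1#) * k * τ ≤ X * v + u * Y
    2kτ≤ = square-cancel-≤
      (Σ-nonneg J (below 0≤x) ⊗≤ 0≤y J (ℕₚ.n<1+n J) ⊕≤ 0≤x J (ℕₚ.n<1+n J) ⊗≤ Σ-nonneg J (below 0≤y))
      (≤-by (0≤x² (X * v - u * Y) ⊕≤ 0≤4 ⊗≤ (Δ IH ⊗≤ 0≤uv ⊕≤ 0≤x² k ⊗≤ 0≤τ ⊗≤ Δ τ≤uv))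
        (solve 6 (λ k t X Y u v →
            (X :* v :+ u :* Y) :* (X :* v :+ u :* Y) :- (con (+ 2) :* k :* t) :* (con (+ 2) :* k :* t)
            := (X :* v :- u :* Y) :* (X :* v :- u :* Y)
               :+ con (+ 4) :* ((X :* Y :- k :* k :* t) :* (u :* v) :+ k :* k :* t :* (u :* v :- t)))
          refl k τ X Y u v))
      where
      0≤4 : 0# ≤ 1# + 1# + 1# + 1#
      0≤4 = 0≤1 ⊕≤ 0≤1 ⊕≤ 0≤1 ⊕≤ 0≤1

  record Potential : Set where
    field
      g h    : ℝ → ℝ
      G H    : ℝ
      g-mono : ∀ {x y} → x ≤ y → g x ≤ g y
      h-mono : ∀ {x y} → x ≤ y → h x ≤ h y
      0≤g    : ∀ x → 0# ≤ g x
      g≤G    : ∀ x → g x ≤ G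
      0≤h    : ∀ x → 0# ≤ h x
      h≤H    : ∀ x → h x ≤ H

  open Potential

  gain : Potential → ℝ → ℝ → ℝ
  gain φ a b = (g φ b - g φ a) * (h φ b - h φ a)

  infixl 6 _⊞_

  -- A single potential has to serve all rejected intervals, wherever they lie, so the potentials of
  -- the regions are added. Monotonicity makes all cross terms of the product nonnegative, and
  -- `gain` of the sum dominates `gain` of each summand.
  _⊞_ : Potential → Potential → Potential
  φ ⊞ ψ = record
    { g      = λ x → g φ x + g ψ x
    ; h      = λ x → h φ x + h ψ x
    ; G      = G φ + G ψ
    ; H      = H φ + H ψ
    ; g-mono = λ x≤y → +-mono-≤ (g-mono φ x≤y) (g-mono ψ x≤y)
    ; h-mono = λ x≤y → +-mono-≤ (h-mono φ x≤y) (h-mono ψ x≤y)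
    ; 0≤g    = λ x → 0≤g φ x ⊕≤ 0≤g ψ x
    ; g≤G    = λ x → +-mono-≤ (g≤G φ x) (g≤G ψ x)
    ; 0≤h    = λ x → 0≤h φ x ⊕≤ 0≤h ψ x
    ; h≤H    = λ x → +-mono-≤ (h≤H φ x) (h≤H ψ x)
    }

  gain-⊞ˡ : ∀ φ ψ {a b} → a ≤ b → gain φ a b ≤ gain (φ ⊞ ψ) a b
  gain-⊞ˡ φ ψ a≤b = ≤-by (p ⊗≤ q′ ⊕≤ p′ ⊗≤ (q ⊕≤ q′))
    (solve 8 (λ ga ga′ gb gb′ ha ha′ hb hb′ →
        (gb :+ gb′ :- (ga :+ ga′)) :* (hb :+ hb′ :- (ha :+ ha′)) :- (gb :- ga) :* (hb :- ha)
        := (gb :- ga) :* (hb′ :- ha′) :+ (gb′ :- ga′) :* ((hb :- ha) :+ (hb′ :- ha′)))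
      refl _ _ _ _ _ _ _ _)
    where
    p  = Δ (g-mono φ a≤b)
    p′ = Δ (g-mono ψ a≤b)
    q  = Δ (h-mono φ a≤b)
    q′ = Δ (h-mono ψ a≤b)

  gain-⊞ʳ : ∀ φ ψ {a b} → a ≤ b → gain ψ a b ≤ gain (φ ⊞ ψ) a b
  gain-⊞ʳ φ ψ a≤b = ≤-by (p′ ⊗≤ q ⊕≤ p ⊗≤ (q ⊕≤ q′))
    (solve 8 (λ ga ga′ gb gb′ ha ha′ hb hb′ →
        (gb :+ gb′ :- (ga :+ ga′)) :* (hb :+ hb′ :- (ha :+ ha′)) :- (gb′ :- ga′) :* (hb′ :- ha′)
        := (gb′ :- ga′) :* (hb :- ha) :+ (gb :- ga) :* ((hb :- ha) :+ (hb′ :- ha′)))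
      refl _ _ _ _ _ _ _ _)
    where
    p  = Δ (g-mono φ a≤b)
    p′ = Δ (g-mono ψ a≤b)
    q  = Δ (h-mono φ a≤b)
    q′ = Δ (h-mono ψ a≤b)

  -- Transports a potential along x ↦ - x; subtracting from the upper bound restores monotonicity
  -- and nonnegativity.
  reflect : Potential → Potential
  reflect φ = record
    { g      = λ x → G φ - g φ (- x)
    ; h      = λ x → H φ - h φ (- x)
    ; G      = G φ
    ; H      = H φ
    ; g-mono = λ x≤y → ≤-by (Δ (g-mono φ (neg-mono-≤ x≤y))) (flip _ _ _)
    ; h-mono = λ x≤y → ≤-by (Δ (h-mono φ (neg-mono-≤ x≤y))) (flip _ _ _)
    ; 0≤g    = λ x → Δ (g≤G φ (- x))
    ; g≤G    = λ x → ≤-by (0≤g φ (- x)) (drop _ _)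
    ; 0≤h    = λ x → Δ (h≤H φ (- x))
    ; h≤H    = λ x → ≤-by (0≤h φ (- x)) (drop _ _)
    }
    where
    flip : ∀ R u v → (R - v) - (R - u) ≈ u - v
    flip = solve 3 (λ R u v → (R :- v) :- (R :- u) := u :- v) refl
    drop : ∀ R u → R - (R - u) ≈ u
    drop = solve 2 (λ R u → R :- (R :- u) := u) refl

  gain-reflect : ∀ φ a b → gain φ (- b) (- a) ≈ gain (reflect φ) a b
  gain-reflect φ a b = solve 6 (λ G H u v u′ v′ →
    (u :- v) :* (u′ :- v′) := ((G :- v) :- (G :- u)) :* ((H :- v′) :- (H :- u′)))
    refl (G φ) (H φ) _ _ _ _

  Σ-telescope : ∀ J (f : ℕ → ℝ) → Σ J (λ j → f (2 ℕ.+ j) - f j) ≈ f (suc J) + f J - (f 1 + f 0)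
  Σ-telescope zero    f = sym (-‿inverseʳ (f 1 + f 0))
  Σ-telescope (suc J) f = trans (+-congʳ (Σ-telescope J f))
    (solve 5 (λ a b c d e → (b :+ c :- (d :+ e)) :+ (a :- c) := (a :+ b) :- (d :+ e)) refl _ _ _ _ _)

  -- Since consecutive double steps overlap in one step only, the total gain is
  -- at most twice the range.
  double-steps : ∀ φ (s : ℕ → ℝ) J {τ} → 0# ≤ τ → (∀ j → j ℕ.< suc J → s j ≤ s (suc j)) →
                 (∀ j → j ℕ.< J → τ ≤ gain φ (s j) (s (2 ℕ.+ j))) →
                 fromℕ J * fromℕ J * τ ≤ (G φ + G φ) * (H φ + H φ)
  double-steps φ s J 0≤τ s↑ τ≤gain = ≤-trans
    (Σ*Σ J _ _ 0≤τ
      (λ j j<J → Δ (g-mono φ (s↑↑ j j<J))) (λ j j<J → Δ (h-mono φ (s↑↑ j j<J))) τ≤gain)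
    (≤-trans
      (*-monoˡ-≤ (Σ-nonneg J (λ j j<J → Δ (h-mono φ (s↑↑ j j<J)))) (total≤ (g φ) (0≤g φ) (g≤G φ)))
      (*-monoʳ-≤ (≤-trans (0≤g φ 0#) (g≤G φ 0#) ⊕≤ ≤-trans (0≤g φ 0#) (g≤G φ 0#)) (total≤ (h φ) (0≤h φ) (h≤H φ))))
    where
    s↑↑ : ∀ j → j ℕ.< J → s j ≤ s (2 ℕ.+ j)
    s↑↑ j j<J = ≤-trans (s↑ j (ℕₚ.m<n⇒m<1+n j<J)) (s↑ (suc j) (ℕ.s≤s j<J))
    total≤ : ∀ (f : ℝ → ℝ) {R} → (∀ x → 0# ≤ f x) → (∀ x → f x ≤ R) →
             Σ J (λ j → f (s (2 ℕ.+ j)) - f (s j)) ≤ R + R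
    total≤ f 0≤f f≤R = ≤-respˡ-≈ (sym (Σ-telescope J (f ∘ s)))
      (≤-by (Δ (f≤R (s (suc J))) ⊕≤ Δ (f≤R (s J)) ⊕≤ 0≤f (s 1) ⊕≤ 0≤f (s 0))
        (solve 5 (λ R a b c d → (R :+ R) :- (a :+ b :- (c :+ d)) := (R :- a) :+ (R :- b) :+ c :+ d)
          refl _ _ _ _ _))

-- Every rejected interval gains at least ε n.

module BadIntervals (𝓡 : RealNumbers) where
  open OrderedField 𝓡
  open LogSqrt 𝓡
  open Potentials 𝓡
  open RealFunctions 𝓡
  open OrderLemmas 𝓡 using (1≤ε⁻¹)
  open Max (DecTotalOrder.totalOrder decTotalOrder) using (x≤x⊔y; x≤y⊔x; ⊔-lub; ⊔-mono-≤; x≤y⇒x⊔y≈y)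
  open Min (DecTotalOrder.totalOrder decTotalOrder) using (_⊓_; x⊓y≤y; ⊓-mono-≤; x≤y⇒x⊓y≈x)

  -- What the counting argument uses about an interval [a , b] that the greedy
  -- rule rejects, for data normalised to have a 1-median at 0 with cost n.
  -- Up to a factor 2, τ i bounds the error that the point p i causes when it is
  -- split between a and b, and β bounds the cost on [a , b] from below.
  record Bad (n : ℕ) (ε : ℝ) (p : ℕ → ℝ) (a b : ℝ) : Set where
    field
      τ       : ℕ → ℝ
      β       : ℝ
      p≤a     : ∀ i → p i ≤ a → τ i ≤ 0#
      b≤p     : ∀ i → b ≤ p i → τ i ≤ 0#
      a≤p     : ∀ i → a ≤ p i → τ i ≤ p i - a
      p≤b     : ∀ i → p i ≤ b → τ i ≤ b - p i
      β-right : fromℕ n * (a - 1#) ≤ β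
      β-left  : fromℕ n * (- b - 1#) ≤ β
      β-mid   : fromℕ n * (1# - (b - a)) ≤ β
      bad     : ¬ (Σ n τ + Σ n τ ≤ ε * β)

  open Bad

  neg-swapˡ : ∀ {x y} → - x ≤ y → - y ≤ x
  neg-swapˡ p = ≤-by (Δ p) (solve 2 (λ x y → x :- (:- y) := y :- (:- x)) refl _ _)

  neg-swapʳ : ∀ {x y} → x ≤ - y → y ≤ - x
  neg-swapʳ p = ≤-by (Δ p) (solve 2 (λ x y → (:- x) :- y := (:- y) :- x) refl _ _)

  neg-cancel : ∀ {x y} → - x ≤ - y → y ≤ x
  neg-cancel p = ≤-by (Δ p) (solve 2 (λ x y → x :- y := (:- y) :- (:- x)) refl _ _)

  reflect-bad : ∀ {n ε p a b} → Bad n ε p a b → Bad n ε (λ i → - p i) (- b) (- a)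
  reflect-bad {n} B = record
    { τ       = τ B
    ; β       = β B
    ; p≤a     = λ i q → b≤p B i (neg-cancel q)
    ; b≤p     = λ i q → p≤a B i (neg-cancel q)
    ; a≤p     = λ i q → ≤-respʳ-≈ (solve 2 (λ b p → b :- p := (:- p) :- (:- b)) refl _ _) (p≤b B i (neg-cancel q))
    ; p≤b     = λ i q → ≤-respʳ-≈ (solve 2 (λ a p → p :- a := (:- a) :- (:- p)) refl _ _) (a≤p B i (neg-cancel q))
    ; β-right = β-left B
    ; β-left  = ≤-respˡ-≈ (solve 2 (λ n a → n :* (a :- con (+ 1)) := n :* (:- (:- a) :- con (+ 1))) refl _ _) (β-right B)
    ; β-mid   = ≤-respˡ-≈ (solve 3 (λ n a b → n :* (con (+ 1) :- (b :- a))
                                             := n :* (con (+ 1) :- ((:- a) :- (:- b)))) refl _ _ _) (β-mid B)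
    ; bad     = bad B
    }

  two three four ½ : ℝ
  two   = 1# + 1#
  three = 1# + 1# + 1#
  four  = 1# + 1# + 1# + 1#
  ½     = two ⁻¹

  two≰0 : ¬ (two ≤ 0#)
  two≰0 2≤0 = 1≰0 (≤-trans (x≤1+x 1#) 2≤0)

  halve : ℝ → ℝ
  halve x = ½ * (x - 1#)

  halve-spec : ∀ x → x ≈ halve x + halve x + 1#
  halve-spec x = begin
    x                          ≈⟨ solve 1 (λ x → x := con (+ 1) :* (x :- con (+ 1)) :+ con (+ 1)) refl x ⟩
    1# * (x - 1#) + 1#         ≈⟨ +-congʳ (*-congʳ (⁻¹-inverse two≰0)) ⟨
    two * ½ * (x - 1#) + 1#    ≈⟨ solve 2 (λ h x → con (+ 2) :* h :* (x :- con (+ 1)) :+ con (+ 1)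
                                     := h :* (x :- con (+ 1)) :+ h :* (x :- con (+ 1)) :+ con (+ 1)) refl ½ x ⟩
    halve x + halve x + 1#     ∎
    where open SetoidReasoning setoid

  halve-mono : ∀ {x y} → x ≤ y → halve x ≤ halve y
  halve-mono x≤y = *-monoʳ-≤ (⁻¹-nonneg two≰0) (+-monoˡ-≤ (- 1#) x≤y)

  double-≤ : ∀ {x y} → x + x ≤ y + y → x ≤ y
  double-≤ p = *-cancelˡ-≤ two≰0 (≤-resp double double p)
    where
    double : ∀ {x} → x + x ≈ two * x
    double = solve 1 (λ x → x :+ x := con (+ 2) :* x) refl _

  clamp : ℝ → ℝ → ℝ → ℝ
  clamp lo hi x = lo ⊔ (x ⊓ hi)

  lo≤clamp : ∀ lo hi x → lo ≤ clamp lo hi x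
  lo≤clamp lo hi x = x≤x⊔y lo (x ⊓ hi)

  clamp≤hi : ∀ {lo hi} → lo ≤ hi → ∀ x → clamp lo hi x ≤ hi
  clamp≤hi {lo} {hi} lo≤hi x = ⊔-lub lo≤hi (x⊓y≤y x hi)

  clamp-mono : ∀ lo hi {x y} → x ≤ y → clamp lo hi x ≤ clamp lo hi y
  clamp-mono lo hi x≤y = ⊔-mono-≤ ≤-refl (⊓-mono-≤ x≤y ≤-refl)

  clamp-id : ∀ {lo hi x} → lo ≤ x → x ≤ hi → clamp lo hi x ≈ x
  clamp-id {lo} {hi} {x} lo≤x x≤hi = trans (x≤y⇒x⊔y≈y (≤-respʳ-≈ (sym x⊓hi≈x) lo≤x)) x⊓hi≈x
    where
    x⊓hi≈x : x ⊓ hi ≈ x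
    x⊓hi≈x = x≤y⇒x⊓y≈x x≤hi

  module _ (n : ℕ) (ε : ℝ) (0<ε : 0# < ε) (ε<1 : ε < 1#) where

    N T Λ : ℝ
    N = fromℕ n
    T = 1# + (ε ⁻¹ + ε ⁻¹)
    Λ = log (ε ⁻¹) (1≤ε⁻¹ 0<ε ε<1)

    0≤N : 0# ≤ N
    0≤N = 0≤fromℕ n

    ε≰0 : ¬ (ε ≤ 0#)
    ε≰0 = <⇒≱ 0<ε

    0≤ε : 0# ≤ ε
    0≤ε = proj₁ 0<ε

    mass : (p μ : ℕ → ℝ) → ℝ → ℝ
    mass p μ x = Σ n (λ i → upTo x (p i) (μ i))

    mass-mono : ∀ p μ → (∀ i → 0# ≤ μ i) → ∀ {x y} → x ≤ y → mass p μ x ≤ mass p μ y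
    mass-mono p μ 0≤μ x≤y = Σ-mono n (λ i _ → upTo-mono (p i) (0≤μ i) x≤y)

    -- The increase of `mass` counts exactly the points in (a , b]; all others have nonpositive
    -- error. This turns a pointwise bound on the error into a product of two increments.
    Στ≤mass : ∀ {p a b} (B : Bad n ε p a b) {k} {μ : ℕ → ℝ} → a ≤ b → 0# ≤ k → (∀ i → 0# ≤ μ i) →
              (∀ i → a ≤ p i → p i ≤ b → τ B i ≤ k * μ i) →
              Σ n (τ B) ≤ k * (mass p μ b - mass p μ a)
    Στ≤mass {p} {a} {b} B {k} {μ} a≤b 0≤k 0≤μ τ≤kμ = ≤-respʳ-≈ split (Σ-mono n τ≤)
      where
      split : Σ n (λ i → k * (upTo b (p i) (μ i) + (- 1#) * upTo a (p i) (μ i)))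
              ≈ k * (mass p μ b - mass p μ a)
      split = trans (Σ-* n k _) (*-congˡ (trans (Σ-+ n _ _) (+-congˡ (trans (Σ-* n (- 1#) _)
        (solve 1 (λ x → con (ℤ.- + 1) :* x := :- x) refl _)))))
      τ≤ : ∀ i → i ℕ.< n → τ B i ≤ k * (upTo b (p i) (μ i) + (- 1#) * upTo a (p i) (μ i))
      τ≤ i _ with p i ≤? a
      ... | yes p≤a′ = ≤-trans (p≤a B i p≤a′) (0≤k ⊗≤
        (≤-by (Δ (≤-respˡ-≈ (reflexive (upTo-≤ (μ i) p≤a′)) (upTo-mono (p i) (0≤μ i) a≤b)))
          (solve 2 (λ u v → (u :+ con (ℤ.- + 1) :* v) :- con (+ 0) := u :- v) refl _ _)))
      ... | no p≰a with p i ≤? b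
      ...   | yes p≤b′ = ≤-respʳ-≈ (solve 2 (λ k u → k :* u := k :* (u :+ con (ℤ.- + 1) :* con (+ 0))) refl _ _)
                           (τ≤kμ i (≰⇒≥ p≰a) p≤b′)
      ...   | no p≰b = ≤-respʳ-≈ (solve 1 (λ k → con (+ 0) := k :* (con (+ 0) :+ con (ℤ.- + 1) :* con (+ 0))) refl k)
                           (b≤p B i (≰⇒≥ p≰b))

    stepAt : ℝ → Potential
    stepAt t = record
      { g      = λ x → upTo x t 1#
      ; h      = λ x → upTo x t N
      ; G      = 1#
      ; H      = N
      ; g-mono = upTo-mono t 0≤1
      ; h-mono = upTo-mono t 0≤N
      ; 0≤g    = λ x → upTo-nonneg x t 0≤1
      ; g≤G    = λ x → upTo-≤μ x t 0≤1
      ; 0≤h    = λ x → upTo-nonneg x t 0≤N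
      ; h≤H    = λ x → upTo-≤μ x t 0≤N
      }

    Nε≤N : N * ε ≤ N
    Nε≤N = ≤-respʳ-≈ (*-identityʳ N) (*-monoʳ-≤ 0≤N (proj₁ ε<1))

    -- The jumps at t are 1 in g and N in h, so that crossing t gains N, and ε < 1.
    gain-stepAt : ∀ {t a b} → ¬ (t ≤ a) → t ≤ b → N * ε ≤ gain (stepAt t) a b
    gain-stepAt {t} {a} {b} t≰a t≤b
      rewrite upTo-≤ 1# t≤b | upTo-≤ N t≤b | upTo-≰ 1# t≰a | upTo-≰ N t≰a =
      ≤-respʳ-≈ (solve 1 (λ N → N := (con (+ 1) :- con (+ 0)) :* (N :- con (+ 0))) refl N) Nε≤N

    -3≤3 : - three ≤ three
    -3≤3 = ≤-by (0≤3 ⊕≤ 0≤3) (solve 1 (λ x → x :- (:- x) := x :+ x) refl three)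
      where
      0≤3 : 0# ≤ three
      0≤3 = 0≤1 ⊕≤ 0≤1 ⊕≤ 0≤1

    0≤four : 0# ≤ four
    0≤four = 0≤1 ⊕≤ 0≤1 ⊕≤ 0≤1 ⊕≤ 0≤1

    offset : ℝ → ℝ
    offset x = clamp (- three) three x - (- three)

    offset-mono : ∀ {x y} → x ≤ y → offset x ≤ offset y
    offset-mono x≤y = +-monoˡ-≤ _ (clamp-mono (- three) three x≤y)

    0≤offset : ∀ x → 0# ≤ offset x
    0≤offset x = Δ (lo≤clamp (- three) three x)

    offset≤6 : ∀ x → offset x ≤ three - (- three)
    offset≤6 x = +-monoˡ-≤ _ (clamp≤hi -3≤3 x)

    -- `β-mid` says something only about intervals shorter than 1. The summand N times the length in
    -- h pays for the long ones, and the factor 4 leaves room to use the rejection inequality twice.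
    centre : (ℕ → ℝ) → Potential
    centre p = record
      { g      = λ x → four * offset x
      ; h      = λ x → mass p (λ _ → 1#) x + N * offset x
      ; G      = four * (three - (- three))
      ; H      = N + N * (three - (- three))
      ; g-mono = λ x≤y → *-monoʳ-≤ 0≤four (offset-mono x≤y)
      ; h-mono = λ x≤y → +-mono-≤ (mass-mono p _ (λ _ → 0≤1) x≤y) (*-monoʳ-≤ 0≤N (offset-mono x≤y))
      ; 0≤g    = λ x → 0≤four ⊗≤ 0≤offset x
      ; g≤G    = λ x → *-monoʳ-≤ 0≤four (offset≤6 x)
      ; 0≤h    = λ x → Σ-nonneg n (λ i _ → upTo-nonneg x (p i) 0≤1) ⊕≤ 0≤N ⊗≤ 0≤offset x
      ; h≤H    = λ x → +-mono-≤
          (≤-respʳ-≈ (trans (Σ-const n 1#) (*-identityʳ N)) (Σ-mono n (λ i _ → upTo-≤μ x (p i) 0≤1)))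
          (*-monoʳ-≤ 0≤N (offset≤6 x))
      }

    -- With ℓ the length and c the number of points, rejection and `β-mid` give 2 ℓ c ≥ ε N (1 - ℓ).
    -- Twice this yields 4 ℓ c ≥ 2 ε N - 2 ε N ℓ, and completing the square in 4 N ℓ² - 2 ε N ℓ
    -- loses at most ε² N ≤ ε N.
    gain-centre : ∀ {p a b} → Bad n ε p a b → a ≤ b → - three ≤ a → b ≤ three →
                  N * ε ≤ gain (centre p) a b
    gain-centre {p} {a} {b} B a≤b -3≤a b≤3 =
      ≤-by (Δ excess≤ ⊕≤ Δ excess≤ ⊕≤ 0≤N ⊗≤ (0≤three ⊗≤ 0≤x² ℓ ⊕≤ 0≤x² (ℓ - ε) ⊕≤ 0≤ε ⊗≤ Δ (proj₁ ε<1)))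
        (solve 6 (λ N ε oa ob ma mb →
          let ℓ = ob :- oa ; c = mb :- ma in
          (con (+ 4) :* ob :- con (+ 4) :* oa) :* (mb :+ N :* ob :- (ma :+ N :* oa)) :- N :* ε
          := (ℓ :* c :+ ℓ :* c :- ε :* (N :* (con (+ 1) :- ℓ)))
             :+ (ℓ :* c :+ ℓ :* c :- ε :* (N :* (con (+ 1) :- ℓ)))
             :+ N :* (con (+ 3) :* (ℓ :* ℓ) :+ (ℓ :- ε) :* (ℓ :- ε) :+ ε :* (con (+ 1) :- ε)))
          refl N ε _ _ _ _)
      where
      0≤three : 0# ≤ three
      0≤three = 0≤1 ⊕≤ 0≤1 ⊕≤ 0≤1
      ℓ c : ℝ
      ℓ = offset b - offset a
      c = mass p (λ _ → 1#) b - mass p (λ _ → 1#) a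
      ℓ≈b-a : ℓ ≈ b - a
      ℓ≈b-a = trans
        (+-cong (+-congʳ (clamp-id (≤-trans -3≤a a≤b) b≤3)) (-‿cong (+-congʳ (clamp-id -3≤a (≤-trans a≤b b≤3)))))
        (solve 2 (λ a b → (b :- (:- con (+ 3))) :- (a :- (:- con (+ 3))) := b :- a) refl a b)
      Στ≤ℓc : Σ n (τ B) ≤ ℓ * c
      Στ≤ℓc = Στ≤mass B a≤b (Δ (offset-mono a≤b)) (λ _ → 0≤1) λ i a≤p′ p≤b′ →
        ≤-trans (a≤p B i a≤p′) (≤-trans (+-monoˡ-≤ (- a) p≤b′)
          (≤-reflexive (trans (sym ℓ≈b-a) (sym (*-identityʳ ℓ)))))
      excess≤ : ε * (N * (1# - ℓ)) ≤ ℓ * c + ℓ * c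
      excess≤ = ≤-trans (*-monoʳ-≤ 0≤ε (≤-trans (≤-reflexive (*-congˡ (+-congˡ (-‿cong ℓ≈b-a)))) (β-mid B)))
        (≤-trans (≰⇒≥ (bad B)) (+-mono-≤ Στ≤ℓc Στ≤ℓc))

    module _ (p : ℕ → ℝ) (norm : Σ n (λ i → ∣ p i ∣) ≤ N) where

      beyond : ℝ → ℝ
      beyond x = (x - 1#) ⊔ 0#

      0≤beyond : ∀ x → 0# ≤ beyond x
      0≤beyond x = x≤y⊔x (x - 1#) 0#

      beyond≤∣∣ : ∀ x → beyond x ≤ ∣ x ∣
      beyond≤∣∣ x = ⊔-lub
        (≤-trans (≤-by 0≤1 (solve 1 (λ x → x :- (x :- con (+ 1)) := con (+ 1)) refl x)) (x≤∣x∣ x)) (0≤∣x∣ x)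

      1≤ε⁻¹′ : 1# ≤ ε ⁻¹
      1≤ε⁻¹′ = 1≤ε⁻¹ 0<ε ε<1

      -- The affine map x ↦ (x - 1) / 2 sends [3 , T] onto [1 , 1 / ε]. Hence the logarithm is
      -- defined after clamping and has range at most Λ, while ratios of distances to 1 are
      -- preserved.
      scale : ℝ → ℝ
      scale x = clamp 1# (ε ⁻¹) (halve x)

      1≤scale : ∀ x → 1# ≤ scale x
      1≤scale x = lo≤clamp 1# (ε ⁻¹) (halve x)

      scale-mono : ∀ {x y} → x ≤ y → scale x ≤ scale y
      scale-mono x≤y = clamp-mono 1# (ε ⁻¹) (halve-mono x≤y)

      right : Potential
      right = record
        { g      = λ x → log (scale x) (1≤scale x)
        ; h      = mass p (beyond ∘ p)
        ; G      = Λ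
        ; H      = N
        ; g-mono = λ x≤y → log-mono _ _ (scale-mono x≤y)
        ; h-mono = mass-mono p _ (0≤beyond ∘ p)
        ; 0≤g    = λ x → 0≤log _
        ; g≤G    = λ x → log-mono _ _ (clamp≤hi 1≤ε⁻¹′ (halve x))
        ; 0≤h    = λ x → Σ-nonneg n (λ i _ → upTo-nonneg x (p i) (0≤beyond (p i)))
        ; h≤H    = λ x → ≤-trans
            (Σ-mono n (λ i _ → ≤-trans (upTo-≤μ x (p i) (0≤beyond (p i))) (beyond≤∣∣ (p i)))) norm
        }

      3≤a⇒2N≤β : ∀ {a b} (B : Bad n ε p a b) → three ≤ a → N + N ≤ β B
      3≤a⇒2N≤β B 3≤a = ≤-trans
        (≤-by (0≤N ⊗≤ Δ 3≤a) (solve 2 (λ N a → N :* (a :- con (+ 1)) :- (N :+ N) := N :* (a :- con (+ 3))) refl N _))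
        (β-right B)

      -- From a ≥ 3 the cost on the interval is at least 2 N, so rejection forces a total error of
      -- at least N ε. Each error is at most p - a, which is at most (p - 1) times the increase of
      -- the logarithm.
      gain-right : ∀ {a b} → Bad n ε p a b → a ≤ b → three ≤ a → b ≤ T → N * ε ≤ gain right a b
      gain-right {a} {b} B a≤b 3≤a b≤T = double-≤ (≤-trans
        (≤-respˡ-≈ (solve 2 (λ N ε → ε :* (N :+ N) := N :* ε :+ N :* ε) refl N ε) (*-monoʳ-≤ 0≤ε (3≤a⇒2N≤β B 3≤a)))
        (≤-trans (≰⇒≥ (bad B)) (+-mono-≤ Στ≤gain Στ≤gain)))
        where
        1≤halve : 1# ≤ halve a
        1≤halve = double-≤ (≤-by (Δ 3≤a) (trans (solve 1 (λ h → (h :+ h) :- con (+ 2) := (h :+ h :+ con (+ 1)) :- con (+ 3)) refl _)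
          (+-congʳ (sym (halve-spec a)))))
        halve≤ : halve b ≤ ε ⁻¹
        halve≤ = double-≤ (≤-by (Δ b≤T) (trans (solve 2 (λ h e → (e :+ e) :- (h :+ h) := (con (+ 1) :+ (e :+ e)) :- (h :+ h :+ con (+ 1))) refl _ _)
          (+-congˡ (-‿cong (sym (halve-spec b))))))
        ca cb k : ℝ
        ca = scale a
        cb = scale b
        k  = log cb (1≤scale b) - log ca (1≤scale a)
        ca≈ : ca ≈ halve a
        ca≈ = clamp-id 1≤halve (≤-trans (halve-mono a≤b) halve≤)
        cb≈ : cb ≈ halve b
        cb≈ = clamp-id (≤-trans 1≤halve (halve-mono a≤b)) halve≤
        a≈ : a ≈ ca + ca + 1#
        a≈ = trans (halve-spec a) (+-congʳ (+-cong (sym ca≈) (sym ca≈)))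
        b≈ : b ≈ cb + cb + 1#
        b≈ = trans (halve-spec b) (+-congʳ (+-cong (sym cb≈) (sym cb≈)))
        cb≰0 : ¬ (cb ≤ 0#)
        cb≰0 = 1≤x⇒x≰0 (1≤scale b)
        q≤k : (cb - ca) * cb ⁻¹ ≤ k
        q≤k = log-step (1≤scale a) (1≤scale b) (scale-mono a≤b)
        -- (x - a) / (x - 1) increases with x, so its value at b is the worst; there it equals (cb -
        -- ca) / cb because a = 2 ca + 1 and b = 2 cb + 1.
        p-a≤ : ∀ x → x ≤ b → x - a ≤ (cb - ca) * cb ⁻¹ * (x - 1#)
        p-a≤ x x≤b = *-cancelˡ-≤ cb≰0 (≤-resp
          (*-congˡ (+-congˡ (-‿cong (sym a≈))))
          (sym (trans (solve 4 (λ c d i x → c :* (d :* i :* x) := c :* i :* (d :* x)) refl _ _ _ _)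
            (trans (*-congʳ (⁻¹-inverse cb≰0)) (*-identityˡ _))))
          (≤-by (≤-trans 0≤1 (1≤scale a) ⊗≤ Δ (≤-respʳ-≈ b≈ x≤b))
            (solve 3 (λ u v x → (v :- u) :* (x :- con (+ 1)) :- v :* (x :- (u :+ u :+ con (+ 1)))
                        := u :* ((v :+ v :+ con (+ 1)) :- x)) refl ca cb x)))
        Στ≤gain : Σ n (τ B) ≤ gain right a b
        Στ≤gain = Στ≤mass B a≤b (Δ (Potential.g-mono right a≤b)) (0≤beyond ∘ p) λ i a≤p′ p≤b′ →
          ≤-trans (a≤p B i a≤p′) (≤-trans (p-a≤ (p i) p≤b′) (≤-trans
            (*-monoʳ-≤ (Δ (scale-mono a≤b) ⊗≤ ⁻¹-nonneg cb≰0) (x≤x⊔y (p i - 1#) 0#))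
            (*-monoˡ-≤ (0≤beyond (p i)) q≤k)))

      -- For a ≥ T = 1 + 2 / ε the allowance ε β is at least ε N (a - 1) ≥ 2 N. On the other side
      -- each error is at most the distance of its point to 0, and these distances add up to at most
      -- N.
      bad⇒T≰a : ∀ {a b} → Bad n ε p a b → ¬ (T ≤ a)
      bad⇒T≰a {a} B T≤a = bad B (≤-trans (+-mono-≤ Στ≤N Στ≤N) (≤-trans
          (≤-reflexive 2N≈) (*-monoʳ-≤ 0≤ε (≤-trans (*-monoʳ-≤ 0≤N (+-monoˡ-≤ (- 1#) T≤a)) (β-right B)))))
        where
        2N≈ : N + N ≈ ε * (N * (T - 1#))
        2N≈ = trans (solve 1 (λ N → N :+ N := con (+ 1) :* (N :+ N)) refl N)
          (trans (*-congʳ (sym (⁻¹-inverse ε≰0)))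
            (solve 3 (λ N e i → e :* i :* (N :+ N) := e :* (N :* (con (+ 1) :+ (i :+ i) :- con (+ 1)))) refl N ε (ε ⁻¹)))
        0≤a : 0# ≤ a
        0≤a = ≤-trans (0≤1 ⊕≤ (⁻¹-nonneg ε≰0 ⊕≤ ⁻¹-nonneg ε≰0)) T≤a
        Στ≤N : Σ n (τ B) ≤ N
        Στ≤N = ≤-trans (Σ-mono n τ≤∣p∣) norm
          where
          τ≤∣p∣ : ∀ i → i ℕ.< n → τ B i ≤ ∣ p i ∣
          τ≤∣p∣ i _ with total (p i) a
          ... | inj₁ p≤a′ = ≤-trans (p≤a B i p≤a′) (0≤∣x∣ (p i))
          ... | inj₂ a≤p′ = ≤-trans (a≤p B i a≤p′) (≤-trans
            (≤-by 0≤a (solve 2 (λ x a → x :- (x :- a) := a) refl _ _)) (x≤∣x∣ (p i)))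

    module _ (p : ℕ → ℝ) (norm : Σ n (λ i → ∣ p i ∣) ≤ N) where

      norm⁻ : Σ n (λ i → ∣ - p i ∣) ≤ N
      norm⁻ = ≤-trans (Σ-mono n (λ i _ → ∣x∣≤ (-x≤∣x∣ (p i))
        (≤-trans (≤-reflexive (solve 1 (λ x → :- (:- x) := x) refl (p i))) (x≤∣x∣ (p i))))) norm

      steps leftRight potential : Potential
      steps     = stepAt T ⊞ stepAt three ⊞ stepAt (- three) ⊞ stepAt (- T)
      leftRight = reflect (right (λ i → - p i) norm⁻) ⊞ right p norm
      potential = steps ⊞ centre p ⊞ leftRight

      -- The thresholds T, 3, -3, -T are met from right to left. An interval either crosses one of
      -- them, and a step pays, or lies within one of the five regions; the outer two contain no
      -- rejected interval.
      gain-bad : ∀ {a b} → a ≤ b → Bad n ε p a b → N * ε ≤ gain potential a b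
      gain-bad {a} {b} a≤b B = cases
        where
        via-steps : N * ε ≤ gain steps a b → N * ε ≤ gain potential a b
        via-steps q = ≤-trans q (≤-trans (gain-⊞ˡ steps (centre p) a≤b) (gain-⊞ˡ (steps ⊞ centre p) leftRight a≤b))
        via-leftRight : N * ε ≤ gain leftRight a b → N * ε ≤ gain potential a b
        via-leftRight q = ≤-trans q (gain-⊞ʳ (steps ⊞ centre p) leftRight a≤b)
        B⁻ : Bad n ε (λ i → - p i) (- b) (- a)
        B⁻ = reflect-bad B
        split : ∀ {P : Set} → Dec P → (P → N * ε ≤ gain potential a b) →
                (¬ P → N * ε ≤ gain potential a b) → N * ε ≤ gain potential a b
        split d yes′ no′ = [ yes′ , no′ ]′ (toSum d)
        cases : N * ε ≤ gain potential a b
        cases =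
          split (T ≤? a) (λ T≤a → contradiction T≤a (bad⇒T≰a p norm B)) λ T≰a →
          split (T ≤? b) (λ T≤b → via-steps (≤-trans (gain-stepAt T≰a T≤b)
                (≤-trans (gain-⊞ˡ (stepAt T) (stepAt three) a≤b)
                (≤-trans (gain-⊞ˡ (stepAt T ⊞ stepAt three) (stepAt (- three)) a≤b)
                         (gain-⊞ˡ (stepAt T ⊞ stepAt three ⊞ stepAt (- three)) (stepAt (- T)) a≤b))))) λ T≰b →
          split (three ≤? a) (λ 3≤a → via-leftRight (≤-trans (gain-right p norm B a≤b 3≤a (≰⇒≥ T≰b))
                (gain-⊞ʳ (reflect (right (λ i → - p i) norm⁻)) (right p norm) a≤b))) λ 3≰a →
          split (three ≤? b) (λ 3≤b → via-steps (≤-trans (gain-stepAt 3≰a 3≤b)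
                (≤-trans (gain-⊞ʳ (stepAt T) (stepAt three) a≤b)
                (≤-trans (gain-⊞ˡ (stepAt T ⊞ stepAt three) (stepAt (- three)) a≤b)
                         (gain-⊞ˡ (stepAt T ⊞ stepAt three ⊞ stepAt (- three)) (stepAt (- T)) a≤b))))) λ 3≰b →
          split (- three ≤? a) (λ -3≤a → ≤-trans (gain-centre B a≤b -3≤a (≰⇒≥ 3≰b))
                (≤-trans (gain-⊞ʳ steps (centre p) a≤b) (gain-⊞ˡ (steps ⊞ centre p) leftRight a≤b))) λ -3≰a →
          split (- three ≤? b) (λ -3≤b → via-steps (≤-trans (gain-stepAt -3≰a -3≤b)
                (≤-trans (gain-⊞ʳ (stepAt T ⊞ stepAt three) (stepAt (- three)) a≤b)
                         (gain-⊞ˡ (stepAt T ⊞ stepAt three ⊞ stepAt (- three)) (stepAt (- T)) a≤b)))) λ -3≰b →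
          split (- T ≤? a) (λ -T≤a → via-leftRight (≤-trans
                (≤-respʳ-≈ (gain-reflect (right (λ i → - p i) norm⁻) a b)
                  (gain-right (λ i → - p i) norm⁻ B⁻ (neg-mono-≤ a≤b) (neg-swapʳ (≰⇒≥ -3≰b)) (neg-swapˡ -T≤a)))
                (gain-⊞ˡ (reflect (right (λ i → - p i) norm⁻)) (right p norm) a≤b))) λ -T≰a →
          split (- T ≤? b) (λ -T≤b → via-steps (≤-trans (gain-stepAt -T≰a -T≤b)
                (gain-⊞ʳ (stepAt T ⊞ stepAt three ⊞ stepAt (- three)) (stepAt (- T)) a≤b))) λ -T≰b →
          contradiction (neg-swapʳ (≰⇒≥ -T≰b)) (bad⇒T≰a (λ i → - p i) norm⁻ B⁻)

      -- The ranges of the potential are 28 + 2 Λ and 13 N, and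
      -- 2 (28 + 2 Λ) · 26 ≤ 39² (1 + Λ)².
      count-bad : ∀ (s : ℕ → ℝ) J → ¬ (N ≤ 0#) → (∀ j → j ℕ.< suc J → s j ≤ s (suc j)) →
                  (∀ j → j ℕ.< J → Bad n ε p (s j) (s (2 ℕ.+ j))) →
                  fromℕ J * fromℕ J * ε ≤ (fromℕ 39 * (1# + Λ)) * (fromℕ 39 * (1# + Λ))
      count-bad s J N≰0 s↑ bads = *-cancelˡ-≤ N≰0 (≤-trans
        (≤-respˡ-≈ (solve 3 (λ j N e → j :* j :* (N :* e) := N :* (j :* j :* e)) refl (fromℕ J) N ε)
          (double-steps potential s J (0≤N ⊗≤ 0≤ε) s↑
            (λ j j<J → gain-bad (≤-trans (s↑ j (ℕₚ.m<n⇒m<1+n j<J)) (s↑ (suc j) (ℕ.s≤s j<J))) (bads j j<J))))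
        arith)
        where
        0≤Λ : 0# ≤ Λ
        0≤Λ = 0≤log _
        arith : (Potential.G potential + Potential.G potential) * (Potential.H potential + Potential.H potential)
                ≤ N * ((fromℕ 39 * (1# + Λ)) * (fromℕ 39 * (1# + Λ)))
        arith = ≤-by (0≤N ⊗≤ (0≤numeral 65 ⊕≤ 0≤numeral 2938 ⊗≤ 0≤Λ ⊕≤ 0≤numeral 1521 ⊗≤ 0≤x² Λ))
          (trans (+-congʳ (*-congˡ (*-cong (*-congʳ (fromℕ≈numeral 39)) (*-congʳ (fromℕ≈numeral 39)))))
            (solve 2 (λ N Λ →
              let six = con (+ 3) :- (:- con (+ 3))
                  G = con (+ 1) :+ con (+ 1) :+ con (+ 1) :+ con (+ 1) :+ con (+ 4) :* six :+ (Λ :+ Λ)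
                  H = N :+ N :+ N :+ N :+ (N :+ N :* six) :+ (N :+ N)
                  K = con (+ 39) :* (con (+ 1) :+ Λ) in
              N :* (K :* K) :- (G :+ G) :* (H :+ H)
              := N :* (con (+ 65) :+ con (+ 2938) :* Λ :+ con (+ 1521) :* (Λ :* Λ))) refl N Λ))

-- Splitting a point between two knots.

module Greedy (𝓡 : RealNumbers) where
  open OrderedField 𝓡

  share : ℝ → ℝ → ℝ → ℝ
  share a b x = (x - a) * (b - a) ⁻¹

  -- A segment distributes the points of the half-open (a , b]. Points up to a belong to earlier
  -- segments, so the common knot of two segments is counted once.
  toLeft toRight excess dist : ℝ → ℝ → ℝ → ℝ
  toLeft  a b x = if does (x ≤? a) then 0# else if does (x ≤? b) then 1# - share a b x else 0#
  toRight a b x = if does (x ≤? a) then 0# else if does (x ≤? b) then share a b x else 0#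
  excess  a b x = if does (x ≤? a) then 0# else if does (b ≤? x) then 0# else share a b x * (b - x)
  dist    a b x = if does (x ≤? a) then a - x else if does (b ≤? x) then x - b else 0#

  -- Twice `excess` minus ε times `dist`, with the three cases merged, so that the program decides
  -- acceptance from the sign of one running sum.
  slack : ℝ → ℝ → ℝ → ℝ → ℝ
  slack ε a b x =
    if does (x ≤? a) then - (ε * (a - x)) else
    if does (b ≤? x) then - (ε * (x - b)) else
    share a b x * (b - x) + share a b x * (b - x)

  slack≈ : ∀ ε a b x → slack ε a b x ≈ (excess a b x + excess a b x) + (- ε) * dist a b x
  slack≈ ε a b x with x ≤? a
  ... | yes _ = solve 2 (λ ε y → :- (ε :* y) := (con (+ 0) :+ con (+ 0)) :+ (:- ε) :* y) refl ε _
  ... | no _ with b ≤? x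
  ...   | yes _ = solve 2 (λ ε y → :- (ε :* y) := (con (+ 0) :+ con (+ 0)) :+ (:- ε) :* y) refl ε _
  ...   | no _ = solve 2 (λ ε y → y :+ y := (y :+ y) :+ (:- ε) :* con (+ 0)) refl ε _

  module _ {a b : ℝ} (b≰a : ¬ (b ≤ a)) where

    private
      d : ℝ
      d = b - a

      0≤d : 0# ≤ d
      0≤d = Δ (≰⇒≥ b≰a)

      d≰0 : ¬ (d ≤ 0#)
      d≰0 d≤0 = b≰a (≤-by (Δ d≤0) (solve 2 (λ a b → a :- b := con (+ 0) :- (b :- a)) refl a b))

    module _ {x : ℝ} (a≤x : a ≤ x) (x≤b : x ≤ b) where

      private
        θ : ℝ
        θ = share a b x

      0≤share : 0# ≤ θ
      0≤share = Δ a≤x ⊗≤ ⁻¹-nonneg d≰0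

      share≤1 : θ ≤ 1#
      share≤1 = ≤-respʳ-≈ (⁻¹-inverse d≰0) (*-monoˡ-≤ (⁻¹-nonneg d≰0) (+-monoˡ-≤ (- a) x≤b))

      x≈convex : x ≈ a + θ * d
      x≈convex = trans (solve 2 (λ a x → x := a :+ (x :- a) :* con (+ 1)) refl a x)
        (+-congˡ (trans (*-congˡ (sym (⁻¹-inverse d≰0)))
          (solve 3 (λ u d i → u :* (d :* i) := u :* i :* d) refl _ _ _)))

      -- Convexity: both x - c and its negative are the same convex combination of the corresponding
      -- values at a and b.
      convex-lower : ∀ c → ∣ x - c ∣ ≤ (1# - θ) * ∣ a - c ∣ + θ * ∣ b - c ∣
      convex-lower c = ∣x∣≤
        (≤-respˡ-≈ (trans (solve 4 (λ a b c t → (con (+ 1) :- t) :* (a :- c) :+ t :* (b :- c)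
                                       := (a :+ t :* (b :- a)) :- c) refl a b c θ) (+-congʳ (sym x≈convex)))
          (+-mono-≤ (*-monoʳ-≤ (Δ share≤1) (x≤∣x∣ _)) (*-monoʳ-≤ 0≤share (x≤∣x∣ _))))
        (≤-respˡ-≈ (trans (solve 4 (λ a b c t → (con (+ 1) :- t) :* (:- (a :- c)) :+ t :* (:- (b :- c))
                                       := :- ((a :+ t :* (b :- a)) :- c)) refl a b c θ)
                     (-‿cong (+-congʳ (sym x≈convex))))
          (+-mono-≤ (*-monoʳ-≤ (Δ share≤1) (-x≤∣x∣ _)) (*-monoʳ-≤ 0≤share (-x≤∣x∣ _))))

      -- With the centre on one side of [a , b] the distance is affine on the interval, and affine
      -- functions commute with the splitting.
      convex-right : ∀ {c} → b ≤ c → (1# - θ) * ∣ a - c ∣ + θ * ∣ b - c ∣ ≈ ∣ x - c ∣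
      convex-right {c} b≤c = trans
        (+-cong (*-congˡ (∣x-y∣≈y-x (≤-trans (≰⇒≥ b≰a) b≤c))) (*-congˡ (∣x-y∣≈y-x b≤c)))
        (trans (solve 4 (λ a b c t → (con (+ 1) :- t) :* (c :- a) :+ t :* (c :- b)
                            := c :- (a :+ t :* (b :- a))) refl a b c θ)
          (trans (+-congˡ (-‿cong (sym x≈convex))) (sym (∣x-y∣≈y-x (≤-trans x≤b b≤c)))))

      convex-left : ∀ {c} → c ≤ a → (1# - θ) * ∣ a - c ∣ + θ * ∣ b - c ∣ ≈ ∣ x - c ∣
      convex-left {c} c≤a = trans
        (+-cong (*-congˡ (∣x-y∣≈x-y c≤a)) (*-congˡ (∣x-y∣≈x-y (≤-trans c≤a (≰⇒≥ b≰a)))))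
        (trans (solve 4 (λ a b c t → (con (+ 1) :- t) :* (a :- c) :+ t :* (b :- c)
                            := (a :+ t :* (b :- a)) :- c) refl a b c θ)
          (trans (+-congʳ (sym x≈convex)) (sym (∣x-y∣≈x-y (≤-trans c≤a a≤x)))))

      -- As a function of c the error is largest at c = x.
      convex-upper : ∀ {c} → a ≤ c → c ≤ b →
                     (1# - θ) * ∣ a - c ∣ + θ * ∣ b - c ∣ ≤ ∣ x - c ∣ + (θ * (b - x) + θ * (b - x))
      convex-upper {c} a≤c c≤b = ≤-respˡ-≈
        (sym (+-cong (*-congˡ (∣x-y∣≈y-x a≤c)) (*-congˡ (∣x-y∣≈x-y c≤b)))) bound
        where
        error≈ : θ * (b - (a + θ * d)) ≈ θ * (b - x)
        error≈ = *-congˡ (+-congˡ (-‿cong (sym x≈convex)))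
        bound : (1# - θ) * (c - a) + θ * (b - c) ≤ ∣ x - c ∣ + (θ * (b - x) + θ * (b - x))
        bound with total x c
        ... | inj₁ x≤c = ≤-respʳ-≈
          (+-cong (trans (+-congˡ (-‿cong (sym x≈convex))) (sym (∣x-y∣≈y-x x≤c))) (+-cong error≈ error≈))
          (≤-by (0≤share ⊗≤ Δ (≤-respˡ-≈ x≈convex x≤c) ⊕≤ 0≤share ⊗≤ Δ (≤-respˡ-≈ x≈convex x≤c))
            (solve 4 (λ a b c t → let x = a :+ t :* (b :- a) in
              ((c :- x) :+ (t :* (b :- x) :+ t :* (b :- x))) :- ((con (+ 1) :- t) :* (c :- a) :+ t :* (b :- c))
              := t :* (c :- x) :+ t :* (c :- x)) refl a b c θ))
        ... | inj₂ c≤x = ≤-respʳ-≈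
          (+-cong (trans (+-congʳ (sym x≈convex)) (sym (∣x-y∣≈x-y c≤x))) (+-cong error≈ error≈))
          (≤-by (Δ share≤1 ⊗≤ Δ (≤-respʳ-≈ x≈convex c≤x) ⊕≤ Δ share≤1 ⊗≤ Δ (≤-respʳ-≈ x≈convex c≤x))
            (solve 4 (λ a b c t → let x = a :+ t :* (b :- a) in
              ((x :- c) :+ (t :* (b :- x) :+ t :* (b :- x))) :- ((con (+ 1) :- t) :* (c :- a) :+ t :* (b :- c))
              := (con (+ 1) :- t) :* (x :- c) :+ (con (+ 1) :- t) :* (x :- c)) refl a b c θ))

      -- Here x - a = θ d and b - x = (1 - θ) d, so the left side is θ (1 - θ) d.
      share-error≤x-a : θ * (b - x) ≤ x - a
      share-error≤x-a = ≤-resp (*-congˡ (+-congˡ (-‿cong (sym x≈convex)))) (+-congʳ (sym x≈convex))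
        (≤-by (0≤share ⊗≤ 0≤share ⊗≤ 0≤d)
          (solve 3 (λ a b t → ((a :+ t :* (b :- a)) :- a) :- t :* (b :- (a :+ t :* (b :- a))) := t :* t :* (b :- a)) refl a b θ))

      share-error≤b-x : θ * (b - x) ≤ b - x
      share-error≤b-x = ≤-respʳ-≈ (*-identityˡ _) (*-monoˡ-≤ (Δ x≤b) share≤1)

    excess-left : ∀ {x} → x ≤ a → excess a b x ≤ 0#
    excess-left {x} x≤a with x ≤? a
    ... | yes _  = ≤-refl
    ... | no x≰a = contradiction x≤a x≰a

    excess-right : ∀ {x} → b ≤ x → excess a b x ≤ 0#
    excess-right {x} b≤x with x ≤? a
    ... | yes _ = ≤-refl
    ... | no _ with b ≤? x
    ...   | yes _  = ≤-refl
    ...   | no b≰x = contradiction b≤x b≰x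

    excess≤x-a : ∀ {x} → a ≤ x → excess a b x ≤ x - a
    excess≤x-a {x} a≤x with x ≤? a
    ... | yes _ = Δ a≤x
    ... | no x≰a with b ≤? x
    ...   | yes _  = Δ a≤x
    ...   | no b≰x = share-error≤x-a a≤x (≰⇒≥ b≰x)

    excess≤b-x : ∀ {x} → x ≤ b → excess a b x ≤ b - x
    excess≤b-x {x} x≤b with x ≤? a
    ... | yes _ = Δ x≤b
    ... | no x≰a with b ≤? x
    ...   | yes _ = Δ x≤b
    ...   | no _  = share-error≤b-x (≰⇒≥ x≰a) x≤b

    dist≤ : ∀ x {c} → a ≤ c → c ≤ b → dist a b x ≤ ∣ x - c ∣
    dist≤ x {c} a≤c c≤b with x ≤? a
    ... | yes x≤a = ≤-respʳ-≈ (sym (∣x-y∣≈y-x (≤-trans x≤a a≤c))) (+-monoˡ-≤ (- x) a≤c)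
    ... | no _ with b ≤? x
    ...   | yes b≤x = ≤-respʳ-≈ (sym (∣x-y∣≈x-y (≤-trans c≤b b≤x)))
                        (≤-by (Δ c≤b) (solve 3 (λ x c b → (x :- c) :- (x :- b) := b :- c) refl _ _ _))
    ...   | no _ = 0≤∣x∣ _

    a-x≤dist : ∀ x → a - x ≤ dist a b x
    a-x≤dist x with x ≤? a
    ... | yes _ = ≤-refl
    ... | no x≰a with b ≤? x
    ...   | yes b≤x = ≤-by (Δ b≤x ⊕≤ Δ (≰⇒≥ x≰a))
                        (solve 3 (λ x a b → (x :- b) :- (a :- x) := (x :- b) :+ (x :- a)) refl _ _ _)
    ...   | no _ = ≤-by (Δ (≰⇒≥ x≰a)) (solve 2 (λ x a → con (+ 0) :- (a :- x) := x :- a) refl _ _)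

    x-b≤dist : ∀ x → x - b ≤ dist a b x
    x-b≤dist x with x ≤? a
    ... | yes x≤a = ≤-by (Δ x≤a ⊕≤ Δ (≤-trans x≤a (≰⇒≥ b≰a)))
                      (solve 3 (λ x a b → (a :- x) :- (x :- b) := (a :- x) :+ (b :- x)) refl _ _ _)
    ... | no _ with b ≤? x
    ...   | yes _  = ≤-refl
    ...   | no b≰x = ≤-by (Δ (≰⇒≥ b≰x)) (solve 2 (λ x b → con (+ 0) :- (x :- b) := b :- x) refl _ _)

    ∣x-a∣≤dist : ∀ x → ∣ x - a ∣ ≤ dist a b x + d
    ∣x-a∣≤dist x = ∣x∣≤
      (≤-by (Δ (x-b≤dist x)) (solve 4 (λ x a b D → (D :+ (b :- a)) :- (x :- a) := D :- (x :- b)) refl _ _ _ _))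
      (≤-by (Δ (a-x≤dist x) ⊕≤ 0≤d) (solve 4 (λ x a b D → (D :+ (b :- a)) :- (:- (x :- a)) := (D :- (a :- x)) :+ (b :- a)) refl _ _ _ _))

    0≤toLeft : ∀ x → 0# ≤ toLeft a b x
    0≤toLeft x with x ≤? a
    ... | yes _ = ≤-refl
    ... | no x≰a with x ≤? b
    ...   | yes x≤b = Δ (share≤1 (≰⇒≥ x≰a) x≤b)
    ...   | no _    = ≤-refl

    0≤toRight : ∀ x → 0# ≤ toRight a b x
    0≤toRight x with x ≤? a
    ... | yes _ = ≤-refl
    ... | no x≰a with x ≤? b
    ...   | yes x≤b = 0≤share (≰⇒≥ x≰a) x≤b
    ...   | no _    = ≤-refl

    segment : ℝ → ℝ → ℝ
    segment x c = toLeft a b x * ∣ a - c ∣ + toRight a b x * ∣ b - c ∣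

    private
      outside : ∀ c → 0# * ∣ a - c ∣ + 0# * ∣ b - c ∣ ≈ 0#
      outside c = solve 2 (λ u v → con (+ 0) :* u :+ con (+ 0) :* v := con (+ 0)) refl _ _

    segment-lower : ∀ x c → upTo b x (∣ x - c ∣) ≤ upTo a x (∣ x - c ∣) + segment x c
    segment-lower x c with x ≤? a
    ... | yes x≤a = ≤-reflexive (trans (reflexive (upTo-≤ _ (≤-trans x≤a (≰⇒≥ b≰a))))
                      (trans (sym (+-identityʳ _)) (+-congˡ (sym (outside c)))))
    ... | no x≰a with x ≤? b
    ...   | yes x≤b = ≤-respʳ-≈ (sym (+-identityˡ _)) (convex-lower (≰⇒≥ x≰a) x≤b c)
    ...   | no _ = ≤-reflexive (trans (sym (+-identityʳ _)) (+-congˡ (sym (outside c))))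

    segment-exact : ∀ x {c} → c ≤ a ⊎ b ≤ c → upTo a x (∣ x - c ∣) + segment x c ≈ upTo b x (∣ x - c ∣)
    segment-exact x {c} side with x ≤? a
    ... | yes x≤a = trans (+-congˡ (outside c)) (trans (+-identityʳ _)
                      (reflexive (≡.sym (upTo-≤ _ (≤-trans x≤a (≰⇒≥ b≰a))))))
    ... | no x≰a with x ≤? b
    ...   | yes x≤b = trans (+-identityˡ _)
                        ([ convex-left (≰⇒≥ x≰a) x≤b , convex-right (≰⇒≥ x≰a) x≤b ]′ side)
    ...   | no _ = trans (+-congˡ (outside c)) (+-identityˡ _)

    segment-upper : ∀ x {c} → a ≤ c → c ≤ b →
      upTo a x (∣ x - c ∣) + segment x c ≤ upTo b x (∣ x - c ∣) + (excess a b x + excess a b x)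
    segment-upper x {c} a≤c c≤b with x ≤? a
    ... | yes x≤a = ≤-reflexive (trans (+-congˡ (outside c))
                      (+-cong (reflexive (≡.sym (upTo-≤ _ (≤-trans x≤a (≰⇒≥ b≰a))))) (sym (+-identityˡ 0#))))
    ... | no x≰a with x ≤? b | b ≤? x
    ...   | yes x≤b | no _ = ≤-respˡ-≈ (sym (+-identityˡ _)) (convex-upper (≰⇒≥ x≰a) x≤b a≤c c≤b)
    -- At x = b the shares still treat x as inside, whereas `excess` is already 0; the two agree
    -- because θ (b - x) vanishes.
    ...   | yes x≤b | yes b≤x = ≤-respˡ-≈ (sym (+-identityˡ _))
                (≤-trans (convex-upper (≰⇒≥ x≰a) x≤b a≤c c≤b) (≤-reflexive (+-congˡ
                  (+-cong vanish vanish))))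
          where
          vanish : share a b x * (b - x) ≈ 0#
          vanish = trans (*-congˡ (trans (+-congˡ (-‿cong (antisym x≤b b≤x))) (-‿inverseʳ b))) (zeroʳ _)
    ...   | no x≰b | no b≰x = contradiction (≰⇒≥ x≰b) b≰x
    ...   | no _ | yes _ = ≤-reflexive (trans (+-congˡ (outside c)) (+-congˡ (sym (+-identityˡ 0#))))

  Σ-single : ∀ n (f : ℕ → ℝ) k → k ℕ.< n → (∀ i → i ℕ.< n → ¬ (i ≡ k) → f i ≈ 0#) → Σ n f ≈ f k
  Σ-single (suc n) f k k<1+n f≈0 with ℕₚ.m≤n⇒m<n∨m≡n (ℕₚ.≤-pred k<1+n)
  ... | inj₁ k<n = trans (+-cong (Σ-single n f k k<n (λ i i<n → f≈0 i (ℕₚ.m<n⇒m<1+n i<n)))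
                                 (f≈0 n (ℕₚ.n<1+n n) (λ n≡k → ℕₚ.<⇒≢ k<n (≡.sym n≡k))))
                     (+-identityʳ _)
  ... | inj₂ ≡.refl = trans (+-congʳ (trans (Σ-cong n (λ i i<n → f≈0 i (ℕₚ.m<n⇒m<1+n i<n) (ℕₚ.<⇒≢ i<n)))
                                            (trans (Σ-const n 0#) (zeroʳ _))))
                        (+-identityˡ _)

  argmin : ∀ {n i₀} → i₀ ℕ.< n → (f : ℕ → ℝ) → ∃[ i ] (i ℕ.< n × (∀ j → j ℕ.< n → f i ≤ f j))
  argmin {suc n} _ f = go n
    where
    go : ∀ n → ∃[ i ] (i ℕ.< suc n × (∀ j → j ℕ.< suc n → f i ≤ f j))
    go zero    = 0 , ℕₚ.n<1+n 0 , λ { zero _ → ≤-refl ; (suc j) (ℕ.s≤s ()) }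
    go (suc n) with go n
    ... | i , i<n , min with total (f i) (f (suc n))
    ...   | inj₁ q = i , ℕₚ.m<n⇒m<1+n i<n , λ j j<2+n →
              [ (λ j<1+n → min j j<1+n) , (λ { ≡.refl → q }) ]′ (ℕₚ.m≤n⇒m<n∨m≡n (ℕₚ.≤-pred j<2+n))
    ...   | inj₂ q = suc n , ℕₚ.n<1+n (suc n) , λ j j<2+n →
              [ (λ j<1+n → ≤-trans q (min j j<1+n)) , (λ { ≡.refl → ≤-refl }) ]′ (ℕₚ.m≤n⇒m<n∨m≡n (ℕₚ.≤-pred j<2+n))

-- The chain of knots: its error and its length.

module GreedyChain (𝓡 : RealNumbers) where
  open OrderedField 𝓡
  open Greedy 𝓡
  open BadIntervals 𝓡 using (Bad; Λ; count-bad)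
  open LogSqrt 𝓡
  open RealFunctions 𝓡 using (√; log; sizeBound)
  open OrderLemmas 𝓡 using (1≤ε⁻¹)

  module _ (n : ℕ) (p : ℕ → ℝ) (ε : ℝ) (0<ε : 0# < ε) (ε<1 : ε < 1#) where

    private
      N : ℝ
      N = fromℕ n

      0≤ε : 0# ≤ ε
      0≤ε = proj₁ 0<ε

    costAt : ℝ → ℝ
    costAt c = Σ n (λ i → ∣ p i - c ∣)

    costUpTo : ℝ → ℝ → ℝ
    costUpTo x c = Σ n (λ i → upTo x (p i) (∣ p i - c ∣))

    chainCost : ℕ → (s w : ℕ → ℝ) → ℝ → ℝ
    chainCost k s w c = Σ (suc k) (λ j → w j * ∣ s j - c ∣)

    Good : ℝ → ℝ → Set
    Good a b = Σ n (λ i → slack ε a b (p i)) ≤ 0#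

    IsPoint : ℝ → Set
    IsPoint x = ∃[ i ] (i ℕ.< n × x ≡ p i)

    -- The invariant for knots s 0 , ... , s k. `upper` carries one term ε times the cost, however
    -- many segments there are: `exact` says that a centre not left of s k has met no error so far,
    -- and a centre left of s k meets none in later segments.
    record Chain (k : ℕ) (s w : ℕ → ℝ) : Set where
      field
        points     : ∀ j → j ℕ.≤ k → IsPoint (s j)
        increasing : ∀ j → j ℕ.< k → ¬ (s (suc j) ≤ s j)
        rejected   : ∀ j → j ℕ.< k → ∀ i → i ℕ.< n → ¬ (p i ≤ s (suc j)) → ¬ Good (s j) (p i)
        nonneg     : ∀ j → j ℕ.≤ k → 0# ≤ w j
        lower      : ∀ c → costUpTo (s k) c ≤ chainCost k s w c
        exact      : ∀ c → s k ≤ c → chainCost k s w c ≈ costUpTo (s k) c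
        upper      : ∀ c → chainCost k s w c ≤ costUpTo (s k) c + ε * costAt c

    open Chain

    0≤costAt : ∀ c → 0# ≤ costAt c
    0≤costAt c = Σ-nonneg n (λ i _ → 0≤∣x∣ _)

    Σslack≈ : ∀ a b → Σ n (λ i → slack ε a b (p i)) ≈
      (Σ n (λ i → excess a b (p i)) + Σ n (λ i → excess a b (p i))) - ε * Σ n (λ i → dist a b (p i))
    Σslack≈ a b = trans (Σ-cong n (λ i _ → slack≈ ε a b (p i)))
      (trans (Σ-+ n _ _) (trans (+-cong (Σ-+ n _ _) (Σ-* n (- ε) _))
        (solve 3 (λ u e v → (u :+ u) :+ (:- e) :* v := (u :+ u) :- e :* v) refl _ _ _)))

    good⇒ : ∀ {a b} → Good a b →
      Σ n (λ i → excess a b (p i)) + Σ n (λ i → excess a b (p i)) ≤ ε * Σ n (λ i → dist a b (p i))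
    good⇒ {a} {b} good = ≤-by (Δ (≤-respˡ-≈ (Σslack≈ a b) good))
      (solve 2 (λ u v → v :- u := con (+ 0) :- (u :- v)) refl _ _)

    ⇒good : ∀ {a b} →
      Σ n (λ i → excess a b (p i)) + Σ n (λ i → excess a b (p i)) ≤ ε * Σ n (λ i → dist a b (p i)) → Good a b
    ⇒good {a} {b} q = ≤-respˡ-≈ (sym (Σslack≈ a b))
      (≤-by (Δ q) (solve 2 (λ u v → con (+ 0) :- (u :- v) := v :- u) refl _ _))

    -- Distinctness makes the minimum the only point up to s 0, so weight 1 represents it exactly.
    start : ∀ {s w} → (∀ i j → i ℕ.< n → j ℕ.< n → p i ≈ p j → i ≡ j) →
            IsPoint (s 0) → (∀ i → i ℕ.< n → s 0 ≤ p i) → w 0 ≡ 1# → Chain 0 s w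
    start {s} {w} distinct (i₀ , i₀<n , s0≡) min w0≡1 = record
      { points     = λ { zero _ → i₀ , i₀<n , s0≡ }
      ; increasing = λ _ ()
      ; rejected   = λ _ ()
      ; nonneg     = λ { zero _ → ≤-respʳ-≈ (reflexive (≡.sym w0≡1)) 0≤1 }
      ; lower      = λ c → ≤-reflexive (sym (cost≈ c))
      ; exact      = λ c _ → cost≈ c
      ; upper      = λ c → ≤-trans (≤-reflexive (cost≈ c))
          (≤-by (0≤ε ⊗≤ 0≤costAt c) (solve 2 (λ u v → (u :+ v) :- u := v) refl _ _))
      }
      where
      others : ∀ c i → i ℕ.< n → ¬ (i ≡ i₀) → upTo (s 0) (p i) (∣ p i - c ∣) ≈ 0#
      others c i i<n i≢i₀ = reflexive (upTo-≰ _ λ pi≤s0 → i≢i₀ (distinct i i₀ i<n i₀<n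
        (trans (antisym pi≤s0 (min i i<n)) (reflexive s0≡))))
      cost≈ : ∀ c → chainCost 0 s w c ≈ costUpTo (s 0) c
      cost≈ c = begin
        0# + w 0 * ∣ s 0 - c ∣                ≈⟨ +-identityˡ _ ⟩
        w 0 * ∣ s 0 - c ∣                     ≡⟨ ≡.cong₂ (λ u v → u * ∣ v - c ∣) w0≡1 s0≡ ⟩
        1# * ∣ p i₀ - c ∣                     ≈⟨ *-identityˡ _ ⟩
        ∣ p i₀ - c ∣                          ≡⟨ upTo-≤ _ (≤-reflexive (reflexive (≡.sym s0≡))) ⟨
        upTo (s 0) (p i₀) (∣ p i₀ - c ∣)      ≈⟨ Σ-single n _ i₀ i₀<n (others c) ⟨
        costUpTo (s 0) c                      ∎
        where open SetoidReasoning setoid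

    -- A relation between old and new sequences, not a construction, so that the memory arrays after
    -- an update can be shown to satisfy it cell by cell.
    record Extends (k : ℕ) (s w s′ w′ : ℕ → ℝ) : Set where
      field
        s-old  : ∀ j → j ℕ.≤ k → s′ j ≡ s j
        w-old  : ∀ j → j ℕ.< k → w′ j ≡ w j
        w-last : w′ k ≡ w k + Σ n (λ i → toLeft (s k) (s′ (suc k)) (p i))
        w-new  : w′ (suc k) ≡ Σ n (λ i → toRight (s k) (s′ (suc k)) (p i))

    extend-chain : ∀ {k s w s′ w′} → Chain k s w → Extends k s w s′ w′ →
      IsPoint (s′ (suc k)) → ¬ (s′ (suc k) ≤ s k) → Good (s k) (s′ (suc k)) →
      (∀ i → i ℕ.< n → ¬ (p i ≤ s′ (suc k)) → ¬ Good (s k) (p i)) →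
      Chain (suc k) s′ w′
    extend-chain {k} {s} {w} {s′} {w′} ch ext point b≰a good maximal = record
      { points     = λ j j≤1+k → [ (λ j<1+k → let i , i<n , eq = points ch j (ℕₚ.≤-pred j<1+k) in
                        i , i<n , ≡.trans (s-old j (ℕₚ.≤-pred j<1+k)) eq) , (λ { ≡.refl → point }) ]′
                        (ℕₚ.m≤n⇒m<n∨m≡n j≤1+k)
      ; increasing = λ j j<1+k → [ (λ j<k → ≡.subst₂ (λ u v → ¬ (u ≤ v))
                        (≡.sym (s-old (suc j) j<k)) (≡.sym (s-old j (ℕₚ.<⇒≤ j<k))) (increasing ch j j<k))
                        , (λ { ≡.refl → ≡.subst (λ v → ¬ (b ≤ v)) (≡.sym (s-old k ℕₚ.≤-refl)) b≰a }) ]′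
                        (ℕₚ.m≤n⇒m<n∨m≡n (ℕₚ.≤-pred j<1+k))
      ; rejected   = λ j j<1+k → [ (λ j<k → ≡.subst₂ (λ u v → ∀ i → i ℕ.< n → ¬ (p i ≤ u) → ¬ Good v (p i))
                        (≡.sym (s-old (suc j) j<k)) (≡.sym (s-old j (ℕₚ.<⇒≤ j<k))) (rejected ch j j<k))
                        , (λ { ≡.refl → ≡.subst (λ v → ∀ i → i ℕ.< n → ¬ (p i ≤ b) → ¬ Good v (p i))
                                          (≡.sym (s-old k ℕₚ.≤-refl)) maximal }) ]′
                        (ℕₚ.m≤n⇒m<n∨m≡n (ℕₚ.≤-pred j<1+k))
      ; nonneg     = nonneg′
      ; lower      = λ c → ≤-respʳ-≈ (sym (cost≈ c)) (≤-trans
                        (≤-respʳ-≈ (Σ-+ n _ _) (Σ-mono n (λ i _ → segment-lower b≰a (p i) c)))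
                        (+-monoˡ-≤ _ (lower ch c)))
      ; exact      = λ c b≤c → trans (cost≈ c) (trans (+-congʳ (exact ch c (≤-trans a≤b b≤c))) (segments≈ (inj₂ b≤c)))
      ; upper      = upper′
      }
      where
      open Extends ext
      a b : ℝ
      a = s k
      b = s′ (suc k)
      a≤b : a ≤ b
      a≤b = ≰⇒≥ b≰a
      L R : ℝ
      L = Σ n (λ i → toLeft a b (p i))
      R = Σ n (λ i → toRight a b (p i))
      segments : ℝ → ℝ
      segments c = Σ n (λ i → segment b≰a (p i) c)
      nonneg′ : ∀ j → j ℕ.≤ suc k → 0# ≤ w′ j
      nonneg′ j j≤1+k with ℕₚ.m≤n⇒m<n∨m≡n j≤1+k
      ... | inj₂ ≡.refl rewrite w-new = Σ-nonneg n (λ i _ → 0≤toRight b≰a (p i))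
      ... | inj₁ j<1+k with ℕₚ.m≤n⇒m<n∨m≡n (ℕₚ.≤-pred j<1+k)
      ...   | inj₁ j<k rewrite w-old j j<k = nonneg ch j (ℕₚ.<⇒≤ j<k)
      ...   | inj₂ ≡.refl rewrite w-last = nonneg ch k ℕₚ.≤-refl ⊕≤ Σ-nonneg n (λ i _ → 0≤toLeft b≰a (p i))
      segments-split : ∀ c → segments c ≈ L * ∣ a - c ∣ + R * ∣ b - c ∣
      segments-split c = trans (Σ-+ n _ _) (+-cong (pull _ _) (pull _ _))
        where
        pull : ∀ (f : ℕ → ℝ) y → Σ n (λ i → f i * y) ≈ Σ n f * y
        pull f y = trans (Σ-cong n (λ i _ → *-comm (f i) y)) (trans (Σ-* n y f) (*-comm y _))
      cost≈ : ∀ c → chainCost (suc k) s′ w′ c ≈ chainCost k s w c + segments c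
      cost≈ c = begin
        Σ k (λ j → w′ j * ∣ s′ j - c ∣) + w′ k * ∣ s′ k - c ∣ + w′ (suc k) * ∣ b - c ∣
          ≈⟨ +-cong (+-cong
               (Σ-cong k (λ j j<k → reflexive (≡.cong₂ (λ u v → u * ∣ v - c ∣) (w-old j j<k) (s-old j (ℕₚ.<⇒≤ j<k)))))
               (reflexive (≡.cong₂ (λ u v → u * ∣ v - c ∣) w-last (s-old k ℕₚ.≤-refl))))
               (reflexive (≡.cong (λ u → u * ∣ b - c ∣) w-new)) ⟩
        Σ k (λ j → w j * ∣ s j - c ∣) + (w k + L) * ∣ a - c ∣ + R * ∣ b - c ∣
          ≈⟨ solve 6 (λ S wk L R u v → S :+ (wk :+ L) :* u :+ R :* v := S :+ wk :* u :+ (L :* u :+ R :* v)) refl _ _ _ _ _ _ ⟩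
        chainCost k s w c + (L * ∣ a - c ∣ + R * ∣ b - c ∣)
          ≈⟨ +-congˡ (segments-split c) ⟨
        chainCost k s w c + segments c ∎
        where open SetoidReasoning setoid
      segments≈ : ∀ {c} → c ≤ a ⊎ b ≤ c → costUpTo a c + segments c ≈ costUpTo b c
      segments≈ side = trans (sym (Σ-+ n _ _)) (Σ-cong n (λ i _ → segment-exact b≰a (p i) side))
      -- For c ≤ a the new segment is exact and the old error term is kept; for b ≤ c everything is
      -- exact. Only between a and b does the new segment err, and there the old chain is exact, so
      -- the error term is spent once.
      upper′ : ∀ c → chainCost (suc k) s′ w′ c ≤ costUpTo b c + ε * costAt c
      upper′ c with total c a | total c b
      ... | inj₁ c≤a | _ = ≤-respˡ-≈ (sym (cost≈ c)) (≤-trans (+-monoˡ-≤ _ (upper ch c))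
        (≤-reflexive (trans (solve 3 (λ u v w → u :+ v :+ w := u :+ w :+ v) refl _ _ _) (+-congʳ (segments≈ (inj₁ c≤a))))))
      ... | inj₂ a≤c | inj₂ b≤c = ≤-respˡ-≈ (sym (trans (cost≈ c) (trans (+-congʳ (exact ch c a≤c)) (segments≈ (inj₂ b≤c)))))
        (≤-by (0≤ε ⊗≤ 0≤costAt c) (solve 2 (λ u v → (u :+ v) :- u := v) refl _ _))
      ... | inj₂ a≤c | inj₁ c≤b = ≤-respˡ-≈ (sym (trans (cost≈ c) (+-congʳ (exact ch c a≤c)))) (≤-trans
        (≤-resp (Σ-+ n _ _) (trans (Σ-+ n _ _) (+-congˡ (Σ-+ n _ _)))
          (Σ-mono n (λ i _ → segment-upper b≰a (p i) a≤c c≤b)))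
        (+-mono-≤ ≤-refl (≤-trans (good⇒ good)
          (*-monoʳ-≤ 0≤ε (Σ-mono n (λ i _ → dist≤ b≰a (p i) a≤c c≤b))))))

    increasing⇒≰ : ∀ {k s w} → Chain k s w → ∀ i j → i ℕ.< j → j ℕ.≤ k → ¬ (s j ≤ s i)
    increasing⇒≰ ch i (suc j) i<1+j 1+j≤k sj≤si with ℕₚ.m≤n⇒m<n∨m≡n (ℕₚ.≤-pred i<1+j)
    ... | inj₂ ≡.refl = increasing ch j 1+j≤k sj≤si
    ... | inj₁ i<j = increasing⇒≰ ch i j i<j (ℕₚ.<⇒≤ 1+j≤k) (≤-trans (≰⇒≥ (increasing ch j 1+j≤k)) sj≤si)

    injective : ∀ {k s w} → Chain k s w → ∀ i j → i ℕ.≤ k → j ℕ.≤ k → s i ≈ s j → i ≡ j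
    injective ch i j i≤k j≤k si≈sj with ℕₚ.<-cmp i j
    ... | tri< i<j _ _ = contradiction (≤-reflexive (sym si≈sj)) (increasing⇒≰ ch i j i<j j≤k)
    ... | tri≈ _ i≡j _ = i≡j
    ... | tri> _ _ j<i = contradiction (≤-reflexive si≈sj) (increasing⇒≰ ch j i j<i i≤k)

    full-costUpTo : ∀ {x} → (∀ i → i ℕ.< n → p i ≤ x) → ∀ c → costUpTo x c ≈ costAt c
    full-costUpTo p≤x c = Σ-cong n (λ i i<n → reflexive (upTo-≤ _ (p≤x i i<n)))

    coreset-lower : ∀ {k s w} → Chain k s w → (∀ i → i ℕ.< n → p i ≤ s k) →
                    ∀ c → (1# - ε) * costAt c ≤ chainCost k s w c
    coreset-lower ch p≤s c = ≤-trans
      (≤-by (0≤ε ⊗≤ 0≤costAt c) (solve 2 (λ e x → x :- (con (+ 1) :- e) :* x := e :* x) refl _ _))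
      (≤-respˡ-≈ (full-costUpTo p≤s c) (lower ch c))

    coreset-upper : ∀ {k s w} → Chain k s w → (∀ i → i ℕ.< n → p i ≤ s k) →
                    ∀ c → chainCost k s w c ≤ (1# + ε) * costAt c
    coreset-upper ch p≤s c = ≤-respʳ-≈
      (trans (+-congʳ (full-costUpTo p≤s c)) (solve 2 (λ e x → x :+ e :* x := (con (+ 1) :+ e) :* x) refl _ _))
      (upper ch c)

    1≤^ : ∀ {x} → 1# ≤ x → ∀ j → 1# ≤ x ^ j
    1≤^ 1≤x zero    = ≤-refl
    1≤^ {x} 1≤x (suc j) = ≤-trans 1≤x (≤-respˡ-≈ (*-identityʳ x)
      (*-monoʳ-≤ (≤-trans 0≤1 1≤x) (1≤^ 1≤x j)))

    -- Distinct knots have distinct indices among the n points. This is what ends the algorithm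
    -- after n rounds.
    chain-bound : ∀ {k s w} → Chain k s w → k ℕ.< n
    chain-bound {k} {s} ch = ℕₚ.≰⇒> λ n≤k →
      let i , j , i<j , eq = pigeonhole (ℕ.s≤s n≤k) index
      in ℕₚ.<⇒≢ i<j (injective ch (toℕ i) (toℕ j) (toℕ≤pred[n] i) (toℕ≤pred[n] j) (reflexive (same i j eq)))
      where
      point : ∀ (j : Fin.Fin (suc k)) → IsPoint (s (toℕ j))
      point j = points ch (toℕ j) (toℕ≤pred[n] j)
      index : Fin.Fin (suc k) → Fin.Fin n
      index j = Fin.fromℕ< (proj₁ (proj₂ (point j)))
      same : ∀ i j → index i ≡ index j → s (toℕ i) ≡ s (toℕ j)
      same i j eq = ≡.trans (proj₂ (proj₂ (point i))) (≡.trans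
        (≡.cong p (≡.trans (≡.sym (toℕ-fromℕ< _)) (≡.trans (≡.cong toℕ eq) (toℕ-fromℕ< _))))
        (≡.sym (proj₂ (proj₂ (point j)))))

    successor : ∀ a m → (∀ i → i ℕ.< m → p i ≤ a) ⊎
      ∃[ j ] (j ℕ.< m × ¬ (p j ≤ a) × (∀ i → i ℕ.< m → ¬ (p i ≤ a) → p j ≤ p i))
    successor a zero = inj₁ λ _ ()
    successor a (suc m) with successor a m | p m ≤? a
    ... | inj₁ none | yes pm≤a = inj₁ λ i i<1+m →
            [ none i , (λ { ≡.refl → pm≤a }) ]′ (ℕₚ.m≤n⇒m<n∨m≡n (ℕₚ.≤-pred i<1+m))
    ... | inj₁ none | no pm≰a = inj₂ (m , ℕₚ.n<1+n m , pm≰a , λ i i<1+m pi≰a →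
            [ (λ i<m → contradiction (none i i<m) pi≰a) , (λ { ≡.refl → ≤-refl }) ]′ (ℕₚ.m≤n⇒m<n∨m≡n (ℕₚ.≤-pred i<1+m)))
    ... | inj₂ (j , j<m , pj≰a , least) | yes pm≤a = inj₂ (j , ℕₚ.m<n⇒m<1+n j<m , pj≰a , λ i i<1+m pi≰a →
            [ (λ i<m → least i i<m pi≰a) , (λ { ≡.refl → contradiction pm≤a pi≰a }) ]′ (ℕₚ.m≤n⇒m<n∨m≡n (ℕₚ.≤-pred i<1+m)))
    ... | inj₂ (j , j<m , pj≰a , least) | no pm≰a with total (p j) (p m)
    ...   | inj₁ pj≤pm = inj₂ (j , ℕₚ.m<n⇒m<1+n j<m , pj≰a , λ i i<1+m pi≰a →
            [ (λ i<m → least i i<m pi≰a) , (λ { ≡.refl → pj≤pm }) ]′ (ℕₚ.m≤n⇒m<n∨m≡n (ℕₚ.≤-pred i<1+m)))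
    ...   | inj₂ pm≤pj = inj₂ (m , ℕₚ.n<1+n m , pm≰a , λ i i<1+m pi≰a →
            [ (λ i<m → ≤-trans pm≤pj (least i i<m pi≰a)) , (λ { ≡.refl → ≤-refl }) ]′ (ℕₚ.m≤n⇒m<n∨m≡n (ℕₚ.≤-pred i<1+m)))

    -- No point lies strictly between neighbours, so no point contributes an error.
    successor-good : ∀ {a b} → (∀ i → i ℕ.< n → ¬ (p i ≤ a) → b ≤ p i) → Good a b
    successor-good {a} {b} least = ≤-respʳ-≈ (trans (Σ-const n 0#) (zeroʳ N)) (Σ-mono n slack≤0)
      where
      -ε*≤0 : ∀ {x} → 0# ≤ x → - (ε * x) ≤ 0#
      -ε*≤0 0≤x = ≤-by (0≤ε ⊗≤ 0≤x) (solve 2 (λ e x → con (+ 0) :- (:- (e :* x)) := e :* x) refl _ _)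
      slack≤0 : ∀ i → i ℕ.< n → slack ε a b (p i) ≤ 0#
      slack≤0 i i<n with p i ≤? a
      ... | yes pi≤a = -ε*≤0 (Δ pi≤a)
      ... | no pi≰a with b ≤? p i
      ...   | yes b≤pi = -ε*≤0 (Δ b≤pi)
      ...   | no b≰pi = contradiction (least i i<n pi≰a) b≰pi

    -- The search cannot get stuck: as long as a point lies to the right, the nearest one is
    -- accepted.
    none-good⇒last : ∀ {a} → (∀ i → i ℕ.< n → ¬ (p i ≤ a) → ¬ Good a (p i)) → ∀ i → i ℕ.< n → p i ≤ a
    none-good⇒last {a} none with successor a n
    ... | inj₁ last = last
    ... | inj₂ (j , j<n , pj≰a , least) = contradiction (successor-good least) (none j j<n pj≰a)

    0≤sizeBound : ∀ C → 0# ≤ sizeBound C ε 0<ε ε<1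
    0≤sizeBound C = 0≤fromℕ C ⊗≤ ⁻¹-nonneg (√≰0 0≤ε (proj₁ ε<1) (<⇒≱ 0<ε)) ⊗≤
      ≤-trans 0≤1 (1≤^ (≤-by (0≤log (1≤ε⁻¹ 0<ε ε<1)) (solve 1 (λ u → (con (+ 1) :+ u) :- con (+ 1) := u) refl _)) C)

    -- Optimality of m is asked for among the data points; it is applied at left ends of intervals,
    -- which are knots and hence data points.
    module _ (m A : ℝ) (A≈ : costAt m ≈ A) (A≰0 : ¬ (A ≤ 0#)) (N≰0 : ¬ (N ≤ 0#))
             (min : ∀ i → i ℕ.< n → A ≤ costAt (p i)) where

      private
        ℓ : ℝ
        ℓ = N * A ⁻¹

        0≤ℓ : 0# ≤ ℓ
        0≤ℓ = ≰⇒≥ N≰0 ⊗≤ ⁻¹-nonneg A≰0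

        Aℓ≈N : A * ℓ ≈ N
        Aℓ≈N = trans (solve 3 (λ A N i → A :* (N :* i) := A :* i :* N) refl A N (A ⁻¹))
          (trans (*-congʳ (⁻¹-inverse A≰0)) (*-identityˡ N))

        ℓ≰0 : ¬ (ℓ ≤ 0#)
        ℓ≰0 ℓ≤0 = N≰0 (≤-resp Aℓ≈N (zeroʳ A) (*-monoʳ-≤ (≰⇒≥ A≰0) ℓ≤0))

        cancel : ∀ {x y} → x * ℓ ≤ y * ℓ → x ≤ y
        cancel q = *-cancelˡ-≤ ℓ≰0 (≤-resp (*-comm _ _) (*-comm _ _) q)

        norm : ℝ → ℝ
        norm x = (x - m) * ℓ

        norm-≤⁻¹ : ∀ {x y} → norm x ≤ norm y → x ≤ y
        norm-≤⁻¹ q = ≤-by (Δ (cancel q)) (solve 3 (λ x y m → y :- x := (y :- m) :- (x :- m)) refl _ _ _)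

        norm-≤ : ∀ {x y} → x ≤ y → norm x ≤ norm y
        norm-≤ q = *-monoˡ-≤ 0≤ℓ (+-monoˡ-≤ (- m) q)

        norm-diff : ∀ x y → (x - y) * ℓ ≈ norm x - norm y
        norm-diff x y = solve 4 (λ x y m l → (x :- y) :* l := (x :- m) :* l :- (y :- m) :* l) refl x y m ℓ

        Σ-norm : ∀ (f : ℕ → ℝ) → Σ n (λ i → f i * ℓ) ≈ Σ n f * ℓ
        Σ-norm f = trans (Σ-cong n (λ i _ → *-comm (f i) ℓ)) (trans (Σ-* n ℓ f) (*-comm ℓ _))

      normalised : Σ n (λ i → ∣ norm (p i) ∣) ≤ N
      normalised = ≤-trans
        (Σ-mono n (λ i _ → ∣x∣≤ (*-monoˡ-≤ 0≤ℓ (x≤∣x∣ (p i - m)))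
          (≤-respˡ-≈ (solve 2 (λ x l → (:- x) :* l := :- (x :* l)) refl _ _) (*-monoˡ-≤ 0≤ℓ (-x≤∣x∣ (p i - m))))))
        (≤-reflexive (trans (Σ-norm _) (trans (*-congʳ A≈) Aℓ≈N)))

      rejected⇒bad : ∀ {a b} → IsPoint a → ¬ (b ≤ a) → ¬ Good a b → Bad n ε (norm ∘ p) (norm a) (norm b)
      rejected⇒bad {a} {b} (i₀ , i₀<n , ≡.refl) b≰a ¬good = record
        { τ       = λ i → excess a b (p i) * ℓ
        ; β       = D * ℓ
        ; p≤a     = λ i q → scale≤0 (excess-left b≰a (norm-≤⁻¹ q))
        ; b≤p     = λ i q → scale≤0 (excess-right b≰a (norm-≤⁻¹ q))
        ; a≤p     = λ i q → ≤-respʳ-≈ (norm-diff (p i) a) (*-monoˡ-≤ 0≤ℓ (excess≤x-a b≰a (norm-≤⁻¹ q)))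
        ; p≤b     = λ i q → ≤-respʳ-≈ (norm-diff b (p i)) (*-monoˡ-≤ 0≤ℓ (excess≤b-x b≰a (norm-≤⁻¹ q)))
        ; β-right = ≤-respˡ-≈ (trans
            (solve 5 (λ N a m A l → (N :* (a :- m) :- A) :* l := N :* ((a :- m) :* l) :- A :* l) refl N a m A ℓ)
            (trans (+-congˡ (-‿cong Aℓ≈N)) (solve 2 (λ N u → N :* u :- N := N :* (u :- con (+ 1))) refl _ _)))
            (*-monoˡ-≤ 0≤ℓ D-right)
        ; β-left  = ≤-respˡ-≈ (trans
            (solve 5 (λ N b m A l → (N :* (m :- b) :- A) :* l := N :* (:- ((b :- m) :* l)) :- A :* l) refl N b m A ℓ)
            (trans (+-congˡ (-‿cong Aℓ≈N)) (solve 2 (λ N u → N :* u :- N := N :* (u :- con (+ 1))) refl _ _)))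
            (*-monoˡ-≤ 0≤ℓ D-left)
        ; β-mid   = ≤-respˡ-≈ (trans
            (solve 6 (λ N a b m A l → (A :- N :* (b :- a)) :* l := A :* l :- N :* ((b :- m) :* l :- (a :- m) :* l)) refl N a b m A ℓ)
            (trans (+-congʳ Aℓ≈N) (solve 2 (λ N u → N :- N :* u := N :* (con (+ 1) :- u)) refl _ _)))
            (*-monoˡ-≤ 0≤ℓ D-mid)
        ; bad     = λ q → ¬good (⇒good (cancel (≤-resp
            (trans (+-cong (Σ-norm _) (Σ-norm _)) (solve 2 (λ u l → u :* l :+ u :* l := (u :+ u) :* l) refl _ _))
            (solve 3 (λ e D l → e :* (D :* l) := e :* D :* l) refl _ _ _) q)))
        }
        where
        D : ℝ
        D = Σ n (λ i → dist a b (p i))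
        scale≤0 : ∀ {x} → x ≤ 0# → x * ℓ ≤ 0#
        scale≤0 q = ≤-respʳ-≈ (zeroˡ ℓ) (*-monoˡ-≤ 0≤ℓ q)
        split : ∀ y → Σ n (λ i → y + (- 1#) * ∣ p i - m ∣) ≈ N * y - A
        split y = trans (Σ-+ n _ _) (+-cong (Σ-const n y) (trans (Σ-* n (- 1#) _)
          (trans (*-congˡ A≈) (solve 1 (λ A → con (ℤ.- + 1) :* A := :- A) refl A))))
        -- Triangle inequality at m: a point is at distance at least (a - m) minus its distance to m
        -- from [a , b].
        D-right : N * (a - m) - A ≤ D
        D-right = ≤-respˡ-≈ (split (a - m)) (Σ-mono n (λ i _ → ≤-trans
          (≤-by (Δ (x≤∣x∣ (p i - m))) (solve 4 (λ a x m v → (a :- x) :- ((a :- m) :+ con (ℤ.- + 1) :* v) := v :- (x :- m)) refl _ _ _ _))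
          (a-x≤dist b≰a (p i))))
        D-left : N * (m - b) - A ≤ D
        D-left = ≤-respˡ-≈ (split (m - b)) (Σ-mono n (λ i _ → ≤-trans
          (≤-by (Δ (-x≤∣x∣ (p i - m))) (solve 4 (λ b x m v → (x :- b) :- ((m :- b) :+ con (ℤ.- + 1) :* v) := v :- (:- (x :- m))) refl _ _ _ _))
          (x-b≤dist b≰a (p i))))
        -- Optimality of m enters here: the cost at the data point a is at least A, and it exceeds
        -- the total distance to [a , b] by at most b - a per point.
        D-mid : A - N * (b - a) ≤ D
        D-mid = ≤-by (Δ (≤-trans (min i₀ i₀<n) (≤-respʳ-≈ (trans (Σ-+ n _ _) (+-congˡ (Σ-const n (b - a))))
          (Σ-mono n (λ i _ → ∣x-a∣≤dist b≰a (p i))))))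
          (solve 3 (λ A D u → D :- (A :- u) := (D :+ u) :- A) refl _ _ _)

      -- The J + 2 knots span J double steps. The end s (j + 2) lies beyond s (j + 1), the farthest
      -- point accepted from s j, and is therefore rejected from s j.
      chain-length : ∀ {s w} J → Chain (suc J) s w →
        fromℕ J * fromℕ J * ε ≤ (fromℕ 39 * (1# + Λ n ε 0<ε ε<1)) * (fromℕ 39 * (1# + Λ n ε 0<ε ε<1))
      chain-length {s} J ch = count-bad n ε 0<ε ε<1 (norm ∘ p) normalised (norm ∘ s) J N≰0
        (λ j j≤J → norm-≤ (≰⇒≥ (increasing ch j j≤J)))
        bads
        where
        bads : ∀ j → j ℕ.< J → Bad n ε (norm ∘ p) (norm (s j)) (norm (s (2 ℕ.+ j)))
        bads j j<J with points ch (2 ℕ.+ j) (ℕ.s≤s j<J)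
        ... | i , i<n , eq rewrite eq = rejected⇒bad (points ch j (ℕₚ.m≤n⇒m≤1+n (ℕₚ.<⇒≤ j<J)))
          (≡.subst (λ u → ¬ (u ≤ s j)) eq (increasing⇒≰ ch j (2 ℕ.+ j) (ℕₚ.m<n⇒m<1+n (ℕₚ.n<1+n j)) (ℕ.s≤s j<J)))
          (rejected ch j (ℕₚ.m<n⇒m<1+n j<J) i i<n
            (≡.subst (λ u → ¬ (u ≤ s (suc j))) eq (increasing ch (suc j) (ℕ.s≤s j<J))))

    -- The constant is 39 for the J double steps plus 2, since J + 2 knots are counted and X / √ε is
    -- at least 1.
    chain-size : ∀ {k s w} → Chain k s w → fromℕ (suc k) ≤ sizeBound 41 ε 0<ε ε<1
    chain-size {k} {s} {w} ch = ≤-trans size≤ power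
      where
      Λ′ X r⁻¹ : ℝ
      Λ′ = log (ε ⁻¹) (1≤ε⁻¹ 0<ε ε<1)
      X  = 1# + Λ′
      r⁻¹ = √ ε (proj₁ 0<ε) ⁻¹
      1≤X : 1# ≤ X
      1≤X = ≤-by (0≤log (1≤ε⁻¹ 0<ε ε<1)) (solve 1 (λ u → (con (+ 1) :+ u) :- con (+ 1) := u) refl Λ′)
      0≤X : 0# ≤ X
      0≤X = ≤-trans 0≤1 1≤X
      r≰0 : ¬ (√ ε (proj₁ 0<ε) ≤ 0#)
      r≰0 = √≰0 0≤ε (proj₁ ε<1) (<⇒≱ 0<ε)
      0≤r⁻¹ : 0# ≤ r⁻¹
      0≤r⁻¹ = ⁻¹-nonneg r≰0
      1≤r⁻¹ : 1# ≤ r⁻¹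
      1≤r⁻¹ = ≤-resp (⁻¹-inverse r≰0) (*-identityˡ r⁻¹) (*-monoˡ-≤ 0≤r⁻¹ (√≤1 0≤ε (proj₁ ε<1)))
      N≰0 : ¬ (N ≤ 0#)
      N≰0 N≤0 with points ch 0 ℕ.z≤n
      ... | i , i<n , _ = contradiction N≤0 (λ q → 1≰0 (≤-trans
        (≤-respʳ-≈ (trans (Σ-const n 1#) (*-identityʳ N)) (term≤Σ n (λ _ _ → 0≤1) i i<n)) q))
      J²ε≤ : ∀ J → k ≡ suc J → fromℕ J * fromℕ J * ε ≤ (fromℕ 39 * X) * (fromℕ 39 * X)
      J²ε≤ J ≡.refl with points ch 0 ℕ.z≤n
      ... | i , i<n , s0≡ with argmin i<n (costAt ∘ p)
      ...   | j , j<n , min with costAt (p j) ≤? 0#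
      ...     | no A≰0 = chain-length (p j) (costAt (p j)) refl A≰0 N≰0 min J ch
      -- Cost 0 cannot be normalised, but then all points equal p j, and a second knot beyond the
      -- first is impossible.
      ...     | yes A≤0 with points ch 1 (ℕ.s≤s ℕ.z≤n)
      ...       | i′ , i′<n , s1≡ = contradiction
                  (≤-reflexive (trans (reflexive s1≡) (trans (collapse i′ i′<n)
                    (trans (sym (collapse i i<n)) (reflexive (≡.sym s0≡))))))
                  (increasing ch 0 (ℕ.s≤s ℕ.z≤n))
          where
          ∣p-m∣≤0 : ∀ i → i ℕ.< n → ∣ p i - p j ∣ ≤ 0#
          ∣p-m∣≤0 i i<n = ≤-trans (term≤Σ n (λ i _ → 0≤∣x∣ (p i - p j)) i i<n) A≤0
          collapse : ∀ i → i ℕ.< n → p i ≈ p j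
          collapse i i<n = antisym
            (≤-by (Δ (≤-trans (x≤∣x∣ _) (∣p-m∣≤0 i i<n))) (solve 2 (λ x y → y :- x := con (+ 0) :- (x :- y)) refl _ _))
            (≤-by (Δ (≤-trans (-x≤∣x∣ _) (∣p-m∣≤0 i i<n))) (solve 2 (λ x y → x :- y := con (+ 0) :- (:- (x :- y))) refl _ _))
      J≤ : ∀ J → k ≡ suc J → fromℕ J ≤ fromℕ 39 * X * r⁻¹
      J≤ J eq = ≤k/√x 0≤ε (proj₁ ε<1) (<⇒≱ 0<ε) (0≤fromℕ 39 ⊗≤ 0≤X) (J²ε≤ J eq)
      1≤Xr⁻¹ : 1# ≤ X * r⁻¹
      1≤Xr⁻¹ = ≤-trans 1≤X (≤-respˡ-≈ (*-identityʳ X) (*-monoʳ-≤ 0≤X 1≤r⁻¹))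
      size≤ : fromℕ (suc k) ≤ fromℕ 41 * r⁻¹ * X
      size≤ = bound k J≤
        where
        bound : ∀ k → (∀ J → k ≡ suc J → fromℕ J ≤ fromℕ 39 * X * r⁻¹) → fromℕ (suc k) ≤ fromℕ 41 * r⁻¹ * X
        bound zero    _   = ≤-by
              (Δ 1≤Xr⁻¹ ⊕≤ 0≤fromℕ 40 ⊗≤ (0≤X ⊗≤ 0≤r⁻¹))
              (solve 3 (λ f X r → (con (+ 1) :+ f) :* r :* X :- (con (+ 1) :+ con (+ 0))
                          := (X :* r :- con (+ 1)) :+ f :* (X :* r)) refl (fromℕ 40) X r⁻¹)
        bound (suc J) J≤′ = ≤-by (Δ (J≤′ J ≡.refl) ⊕≤ Δ 1≤Xr⁻¹ ⊕≤ Δ 1≤Xr⁻¹)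
              (solve 4 (λ f X r J → (con (+ 1) :+ (con (+ 1) :+ f)) :* r :* X :- (con (+ 1) :+ (con (+ 1) :+ J))
                          := (f :* X :* r :- J) :+ (X :* r :- con (+ 1)) :+ (X :* r :- con (+ 1)))
                refl (fromℕ 39) X r⁻¹ (fromℕ J))
      -- The analysis gives exponent 1; `sizeBound` uses the same constant as factor and as
      -- exponent, and X ≥ 1.
      power : fromℕ 41 * r⁻¹ * X ≤ fromℕ 41 * r⁻¹ * X ^ 41
      power = *-monoʳ-≤ (0≤fromℕ 41 ⊗≤ 0≤r⁻¹)
        (≤-respˡ-≈ (*-identityʳ X) (*-monoʳ-≤ 0≤X (1≤^ 1≤X 40)))

-- The counter is cell 0 of natural array ℓ, the bound cell 0 of natural array 0.
for : ℕ → Program → Program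
for ℓ p = setNat ℓ (lit 0) (lit 0) ⨾
          while (natLeq (lit 1 ⊕ natAt ℓ (lit 0)) (natAt 0 (lit 0)))
            (p ⨾ setNat ℓ (lit 0) (lit 1 ⊕ natAt ℓ (lit 0)))

-- Total correctness with time bounds for real RAM programs.

module TotalCorrectness (𝓡 : RealNumbers) where
  open RealNumbers 𝓡 using (ℝ)
  open Semantics 𝓡

  record Run (p : Program) (t : ℕ) (σ : State) (Q : State → Set) : Set where
    constructor run
    field
      {steps}    : ℕ
      {final}    : State
      execution  : ⟨ p , σ ⟩⇓[ steps ] final
      steps≤t    : steps ℕ.≤ t
      post       : Q final

  Run-≤ : ∀ {p s t σ Q} → s ℕ.≤ t → Run p s σ Q → Run p t σ Q
  Run-≤ s≤t (run e ≤s q) = run e (ℕₚ.≤-trans ≤s s≤t) q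

  Run-map : ∀ {p t σ} {Q R : State → Set} → (∀ {τ} → Q τ → R τ) → Run p t σ Q → Run p t σ R
  Run-map f (run e ≤t q) = run e ≤t (f q)

  Run-skip : ∀ {σ} {Q : State → Set} → Q σ → Run skip 1 σ Q
  Run-skip q = run skip⇓ ℕₚ.≤-refl q

  writeNat : ℕ → ℕ → ℕ → State → State
  writeNat a i x σ = state (update (nats σ) a i x) (reals σ)

  writeReal : ℕ → ℕ → ℝ → State → State
  writeReal a i x σ = state (nats σ) (update (reals σ) a i x)

  Run-setNat : ∀ {a i e σ} {Q : State → Set} → Q (writeNat a (⟦ i ⟧ⁿ σ) (⟦ e ⟧ⁿ σ) σ) → Run (setNat a i e) 1 σ Q
  Run-setNat q = run setNat⇓ ℕₚ.≤-refl q

  Run-setReal : ∀ {a i e σ} {Q : State → Set} → Q (writeReal a (⟦ i ⟧ⁿ σ) (⟦ e ⟧ʳ σ) σ) → Run (setReal a i e) 1 σ Q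
  Run-setReal q = run setReal⇓ ℕₚ.≤-refl q

  -- The postcondition of the first part is the run of the second, so proofs follow the program text
  -- and intermediate states stay implicit.
  Run-⨾ : ∀ {p q s t σ Q} → Run p s σ (λ τ → Run q t τ Q) → Run (p ⨾ q) (s ℕ.+ t) σ Q
  Run-⨾ (run e ≤s (run e′ ≤t q)) = run (seq⇓ e e′) (ℕₚ.+-mono-≤ ≤s ≤t) q

  Run-ifte : ∀ {b p q t σ Q} → (⟦ b ⟧ᵗ σ ≡ true → Run p t σ Q) → (⟦ b ⟧ᵗ σ ≡ false → Run q t σ Q) →
             Run (ifte b p q) (suc t) σ Q
  Run-ifte {b} {σ = σ} then else with ⟦ b ⟧ᵗ σ in eq
  ... | true  = let run e ≤t q = then ≡.refl in run (ifTrue⇓ eq e) (ℕ.s≤s ≤t) q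
  ... | false = let run e ≤t q = else ≡.refl in run (ifFalse⇓ eq e) (ℕ.s≤s ≤t) q

  update-same : ∀ {A : Set} (f : ℕ → ℕ → A) a i x → update f a i x a i ≡ x
  update-same f a i x rewrite dec-true (a ℕ.≟ a) ≡.refl | dec-true (i ℕ.≟ i) ≡.refl = ≡.refl

  update-index : ∀ {A : Set} (f : ℕ → ℕ → A) a {i j} x → ¬ (i ≡ j) → update f a i x a j ≡ f a j
  update-index f a {i} {j} x i≢j rewrite dec-true (a ℕ.≟ a) ≡.refl | dec-false (i ℕ.≟ j) i≢j = ≡.refl

  update-array : ∀ {A : Set} (f : ℕ → ℕ → A) {a b} i x j → ¬ (a ≡ b) → update f a i x b j ≡ f b j
  update-array f {a} {b} i x j a≢b rewrite dec-false (a ℕ.≟ b) a≢b = ≡.refl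

  -- Arrays are numbered by nesting depth: inner code writes only to higher numbers. A frame
  -- condition is then a single bound ℓ below which nothing has changed.
  record Agree (ℓ : ℕ) (σ τ : State) : Set where
    constructor agree
    field
      nat  : ∀ {a} i → a ℕ.< ℓ → nats τ a i ≡ nats σ a i
      real : ∀ {a} i → a ℕ.< ℓ → reals τ a i ≡ reals σ a i

  open Agree public

  Agree-refl : ∀ {ℓ σ} → Agree ℓ σ σ
  Agree-refl = agree (λ _ _ → ≡.refl) (λ _ _ → ≡.refl)

  Agree-trans : ∀ {ℓ σ τ υ} → Agree ℓ σ τ → Agree ℓ τ υ → Agree ℓ σ υ
  Agree-trans A B = agree (λ i a<ℓ → ≡.trans (nat B i a<ℓ) (nat A i a<ℓ))
                          (λ i a<ℓ → ≡.trans (real B i a<ℓ) (real A i a<ℓ))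

  Agree-weaken : ∀ {ℓ m σ τ} → m ℕ.≤ ℓ → Agree ℓ σ τ → Agree m σ τ
  Agree-weaken m≤ℓ A = agree (λ i a<m → nat A i (ℕₚ.≤-trans a<m m≤ℓ)) (λ i a<m → real A i (ℕₚ.≤-trans a<m m≤ℓ))

  Agree-writeNat : ∀ {ℓ a} i x σ → ℓ ℕ.≤ a → Agree ℓ σ (writeNat a i x σ)
  Agree-writeNat {a = a} i x σ ℓ≤a = agree
    (λ j b<ℓ → update-array (nats σ) {a} i x j (λ { ≡.refl → ℕₚ.<⇒≱ b<ℓ ℓ≤a })) (λ _ _ → ≡.refl)

  Agree-writeReal : ∀ {ℓ a} i x σ → ℓ ℕ.≤ a → Agree ℓ σ (writeReal a i x σ)
  Agree-writeReal {a = a} i x σ ℓ≤a = agree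
    (λ _ _ → ≡.refl) (λ j b<ℓ → update-array (reals σ) {a} i x j (λ { ≡.refl → ℕₚ.<⇒≱ b<ℓ ℓ≤a }))

  Agree-lookup : ∀ {ℓ σ τ a b} i → Agree ℓ σ τ → a ℕ.< ℓ → b ℕ.< ℓ →
                 reals τ a (nats τ b i) ≡ reals σ a (nats σ b i)
  Agree-lookup {σ = σ} {a = a} i A a<ℓ b<ℓ = ≡.trans (real A _ a<ℓ) (≡.cong (reals σ a) (nat A i b<ℓ))

  -- The outer 2 is the initial assignment and the last, failing test; the inner 2 is the test and
  -- the increment of each iteration.
  forTime : ℕ → ℕ → ℕ
  forTime n t = 2 ℕ.+ n ℕ.* (2 ℕ.+ t)

  -- The counter array is a successor so that it differs from array 0, which holds the bound. The
  -- body must preserve the counter as well, hence agreement one level higher than the conclusion;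
  -- `stable` lets the invariant survive the increment.
  module _ {ℓ-1 n t : ℕ} {p : Program} {σ : State} (Inv : ℕ → State → Set)
           (stable : ∀ {i x τ} → Inv i τ → Inv i (writeNat (suc ℓ-1) 0 x τ))
           (body : ∀ i τ → i ℕ.< n → Agree (suc ℓ-1) σ τ → nats τ (suc ℓ-1) 0 ≡ i → Inv i τ →
                   Run p t τ (λ υ → Agree (suc (suc ℓ-1)) τ υ × Inv (suc i) υ)) where

    private
      ℓ = suc ℓ-1

      test : Test
      test = natLeq (lit 1 ⊕ natAt ℓ (lit 0)) (natAt 0 (lit 0))

      step′ : Program
      step′ = p ⨾ setNat ℓ (lit 0) (lit 1 ⊕ natAt ℓ (lit 0))

      loop : ∀ r i τ → i ℕ.+ r ≡ n → nats σ 0 0 ≡ n → Agree ℓ σ τ → nats τ ℓ 0 ≡ i → Inv i τ →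
             Run (while test step′) (suc (r ℕ.* (2 ℕ.+ t))) τ (λ υ → Agree ℓ σ υ × Inv n υ)
      loop zero i τ i+0≡n size A ctr inv = run
        (whileFalse⇓ (≡.trans (≡.cong₂ (λ u v → does (suc u ℕ.≤? v)) ctr (≡.trans (nat A 0 (ℕ.s≤s ℕ.z≤n)) size))
                              (dec-false (_ ℕ.≤? _) (λ 1+i≤n → ℕₚ.<-irrefl (≡.trans (≡.sym (ℕₚ.+-identityʳ i)) i+0≡n) 1+i≤n))))
        ℕₚ.≤-refl
        (A , ≡.subst (λ j → Inv j τ) (≡.trans (≡.sym (ℕₚ.+-identityʳ i)) i+0≡n) inv)
      loop (suc r) i τ i+1+r≡n size A ctr inv with body i τ i<n A ctr inv
        where
        i<n : i ℕ.< n
        i<n = ≡.subst (suc i ℕ.≤_) (≡.trans (≡.sym (ℕₚ.+-suc i r)) i+1+r≡n) (ℕₚ.m≤m+n (suc i) r)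
      ... | run {final = υ} e ≤t (B , inv′)
        with loop r (suc i) (writeNat ℓ 0 (suc (nats υ ℓ 0)) υ)
               (≡.trans (≡.sym (ℕₚ.+-suc i r)) i+1+r≡n) size
               (Agree-trans A (Agree-trans (Agree-weaken (ℕₚ.n≤1+n ℓ) B) (Agree-writeNat 0 _ υ ℕₚ.≤-refl)))
               (≡.trans (update-same (nats υ) ℓ 0 _) (≡.cong suc (≡.trans (nat B 0 (ℕₚ.n<1+n ℓ)) ctr)))
               (stable inv′)
      ... | run e′ ≤t′ q = run
        (whileTrue⇓ (≡.trans (≡.cong₂ (λ u v → does (suc u ℕ.≤? v)) ctr (≡.trans (nat A 0 (ℕ.s≤s ℕ.z≤n)) size))
                             (dec-true (_ ℕ.≤? _) (≡.subst (suc i ℕ.≤_) (≡.trans (≡.sym (ℕₚ.+-suc i r)) i+1+r≡n) (ℕₚ.m≤m+n (suc i) r))))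
                    (seq⇓ e setNat⇓) e′)
        (ℕ.s≤s (ℕₚ.≤-trans (ℕₚ.+-mono-≤ (ℕₚ.+-monoˡ-≤ 1 ≤t) ≤t′) (ℕₚ.≤-reflexive time≡)))
        q
        where
        time≡ : t ℕ.+ 1 ℕ.+ suc (r ℕ.* (2 ℕ.+ t)) ≡ suc r ℕ.* (2 ℕ.+ t)
        time≡ = ≡.trans (ℕₚ.+-suc _ _) (≡.cong (λ u → suc (u ℕ.+ r ℕ.* (2 ℕ.+ t))) (ℕₚ.+-comm t 1))

    Run-for : nats σ 0 0 ≡ n → Inv 0 σ → Run (for ℓ p) (forTime n t) σ (λ τ → Agree ℓ σ τ × Inv n τ)
    Run-for size inv = Run-⨾ (Run-setNat (loop n 0 (writeNat ℓ 0 0 σ) ≡.refl size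
      (Agree-writeNat 0 0 σ ℕₚ.≤-refl) (update-same (nats σ) ℓ 0 0) (stable inv)))

-- The program.

natCell : ℕ → NatExpr
natCell a = natAt a (lit 0)

realCell : ℕ → RealExpr
realCell a = realAt a (lit 0)

point : ℕ → RealExpr
point a = realAt 0 (natCell a)

lastKnot : RealExpr
lastKnot = realAt 2 (natCell 2)

_⊝_ : RealExpr → RealExpr → RealExpr
e ⊝ f = addR e (negR f)

shareE : RealExpr → RealExpr → RealExpr → RealExpr
shareE a b x = mulR (x ⊝ a) (invR (b ⊝ a))

_+=_ : ℕ → RealExpr → Program
a += e = setReal a (lit 0) (addR (realCell a) e)

infixl 6 _⊝_
infix  5 _+=_

addSlack : Program
addSlack =
  ifte (realLeq x a) (7 += negR (mulR (realCell 1) (a ⊝ x)))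
    (ifte (realLeq b x) (7 += negR (mulR (realCell 1) (x ⊝ b)))
      (7 += addR (mulR (shareE a b x) (b ⊝ x)) (mulR (shareE a b x) (b ⊝ x))))
  where
  a = lastKnot
  b = point 4
  x = point 6

-- Array 5 starts at the last knot and only increases. All points are tried, and a refused one does
-- not end the search, so no monotonicity of the acceptance test is presupposed.
tryCandidate : Program
tryCandidate =
  ifte (realLeq (point 4) (realCell 5)) skip
    (setReal 7 (lit 0) zeroR ⨾ for 6 addSlack ⨾
     ifte (realLeq (realCell 7) zeroR) (setReal 5 (lit 0) (point 4)) skip)

addShares : Program
addShares =
  -- Zero is added explicitly because x + 0# is only ≈ to x; this keeps the accumulators
  -- propositionally equal to the sums of shares.
  ifte (realLeq x a) (7 += zeroR ⨾ 8 += zeroR)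
    (ifte (realLeq x b) (7 += (oneR ⊝ shareE a b x) ⨾ 8 += shareE a b x)
      (7 += zeroR ⨾ 8 += zeroR))
  where
  a = lastKnot
  b = realCell 5
  x = point 6

appendKnot : Program
appendKnot =
  setReal 7 (lit 0) zeroR ⨾ setReal 8 (lit 0) zeroR ⨾ for 6 addShares ⨾
  setReal 3 (natCell 2) (addR (realAt 3 (natCell 2)) (realCell 7)) ⨾
  setReal 3 (lit 1 ⊕ natCell 2) (realCell 8) ⨾
  setReal 2 (lit 1 ⊕ natCell 2) (realCell 5) ⨾
  setNat 2 (lit 0) (lit 1 ⊕ natCell 2)

greedyRound : Program
greedyRound =
  setReal 5 (lit 0) lastKnot ⨾ for 4 tryCandidate ⨾
  ifte (realLeq (realCell 5) lastKnot) skip appendKnot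

minimum : Program
minimum = ifte (realLeq (point 1) (realCell 2)) (setReal 2 (lit 0) (point 1)) skip

-- Natural arrays: 0 holds the number of points, 1, 4 and 6 the loop counters
-- and 2 the index of the last knot.  Real arrays: 0 holds the points, 1 the
-- accuracy ε, 2 the knots, 3 their weights, 5 the candidate for the next knot,
-- 7 and 8 sums.
coreset : Program
coreset =
  ifte (natLeq (natCell 0) (lit 0)) skip
    (setReal 2 (lit 0) (realCell 0) ⨾ for 1 minimum ⨾ setReal 3 (lit 0) oneR ⨾
     for 1 greedyRound ⨾ setNat 0 (lit 0) (lit 1 ⊕ natCell 2))

-- Verification of one greedy round.

module Verification (𝓡 : RealNumbers) where
  open OrderedField 𝓡
  open Greedy 𝓡
  open GreedyChain 𝓡
  open Semantics 𝓡
  open TotalCorrectness 𝓡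

  witness : ∀ {P : Set} (P? : Dec P) → does P? ≡ true → P
  witness (yes p) _ = p

  refutation : ∀ {P : Set} (P? : Dec P) → does P? ≡ false → ¬ P
  refutation (no ¬p) _ = ¬p

  knotAt : State → ℝ
  knotAt σ = reals σ 2 (nats σ 2 0)

  addSlack-run : ∀ σ → Run addSlack 3 σ (λ τ → Agree 7 σ τ ×
    reals τ 7 0 ≡ reals σ 7 0 + slack (reals σ 1 0) (knotAt σ) (reals σ 0 (nats σ 4 0)) (reals σ 0 (nats σ 6 0)))
  addSlack-run σ =
    Run-ifte
      (λ x≤a → Run-≤ (ℕ.s≤s ℕ.z≤n) (Run-setReal (frame , ≡.cong (λ u → acc + u) (≡.sym (below x≤a)))))
      (λ x≰a → Run-ifte
        (λ b≤x → Run-setReal (frame , ≡.cong (λ u → acc + u) (≡.sym (above x≰a b≤x))))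
        (λ b≰x → Run-setReal (frame , ≡.cong (λ u → acc + u) (≡.sym (inside x≰a b≰x)))))
    where
    acc = reals σ 7 0
    ε = reals σ 1 0
    a = knotAt σ
    b = reals σ 0 (nats σ 4 0)
    x = reals σ 0 (nats σ 6 0)
    frame : ∀ {v} → Agree 7 σ (writeReal 7 0 v σ)
    frame = Agree-writeReal 0 _ σ ℕₚ.≤-refl
    below : does (x ≤? a) ≡ true → slack ε a b x ≡ - (ε * (a - x))
    below h rewrite h = ≡.refl
    above : does (x ≤? a) ≡ false → does (b ≤? x) ≡ true → slack ε a b x ≡ - (ε * (x - b))
    above h h′ rewrite h | h′ = ≡.refl
    inside : does (x ≤? a) ≡ false → does (b ≤? x) ≡ false →
             slack ε a b x ≡ share a b x * (b - x) + share a b x * (b - x)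
    inside h h′ rewrite h | h′ = ≡.refl

  addShares-run : ∀ σ → Run addShares 4 σ (λ τ → Agree 7 σ τ ×
    reals τ 7 0 ≡ reals σ 7 0 + toLeft (knotAt σ) (reals σ 5 0) (reals σ 0 (nats σ 6 0)) ×
    reals τ 8 0 ≡ reals σ 8 0 + toRight (knotAt σ) (reals σ 5 0) (reals σ 0 (nats σ 6 0)))
  addShares-run σ =
    Run-ifte
      (λ x≤a → Run-≤ (ℕₚ.m≤m+n 2 1) (Run-⨾ (Run-setReal (Run-setReal (frame ,
        ≡.cong (λ u → reals σ 7 0 + u) (≡.sym (proj₁ (below x≤a))) , ≡.cong (λ u → reals σ 8 0 + u) (≡.sym (proj₂ (below x≤a))))))))
      (λ x≰a → Run-ifte
        (λ x≤b → Run-⨾ (Run-setReal (Run-setReal (frame ,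
          ≡.cong (λ u → reals σ 7 0 + u) (≡.sym (proj₁ (inside x≰a x≤b))) , ≡.cong (λ u → reals σ 8 0 + u) (≡.sym (proj₂ (inside x≰a x≤b)))))))
        (λ x≰b → Run-⨾ (Run-setReal (Run-setReal (frame ,
          ≡.cong (λ u → reals σ 7 0 + u) (≡.sym (proj₁ (above x≰a x≰b))) , ≡.cong (λ u → reals σ 8 0 + u) (≡.sym (proj₂ (above x≰a x≰b))))))))
    where
    a = knotAt σ
    b = reals σ 5 0
    x = reals σ 0 (nats σ 6 0)
    frame : ∀ {u v} → Agree 7 σ (writeReal 8 0 v (writeReal 7 0 u σ))
    frame {u} = Agree-trans (Agree-writeReal 0 _ σ ℕₚ.≤-refl) (Agree-writeReal 0 _ (writeReal 7 0 u σ) (ℕₚ.n≤1+n 7))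
    below : does (x ≤? a) ≡ true → toLeft a b x ≡ 0# × toRight a b x ≡ 0#
    below h rewrite h = ≡.refl , ≡.refl
    inside : does (x ≤? a) ≡ false → does (x ≤? b) ≡ true →
             toLeft a b x ≡ 1# - share a b x × toRight a b x ≡ share a b x
    inside h h′ rewrite h | h′ = ≡.refl , ≡.refl
    above : does (x ≤? a) ≡ false → does (x ≤? b) ≡ false → toLeft a b x ≡ 0# × toRight a b x ≡ 0#
    above h h′ rewrite h | h′ = ≡.refl , ≡.refl

  module _ (n : ℕ) (p : ℕ → ℝ) (ε : ℝ) (0<ε : 0# < ε) (ε<1 : ε < 1#) where

    private
      Chain′ : ℕ → (ℕ → ℝ) → (ℕ → ℝ) → Set
      Chain′ = Chain n p ε 0<ε ε<1

      Good′ : ℝ → ℝ → Set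
      Good′ = Good n p ε 0<ε ε<1

      IsPoint′ : ℝ → Set
      IsPoint′ = IsPoint n p ε 0<ε ε<1

    record Input (σ : State) : Set where
      field
        size     : nats σ 0 0 ≡ n
        contents : ∀ i → reals σ 0 i ≡ p i
        accuracy : reals σ 1 0 ≡ ε

    open Input

    Agree-Input : ∀ {σ τ} → Agree 2 σ τ → Input σ → Input τ
    Agree-Input A I = record
      { size     = ≡.trans (nat A 0 (ℕ.s≤s ℕ.z≤n)) (size I)
      ; contents = λ i → ≡.trans (Agree.real A i (ℕ.s≤s ℕ.z≤n)) (contents I i)
      ; accuracy = ≡.trans (Agree.real A 0 (ℕ.s≤s (ℕ.s≤s ℕ.z≤n))) (accuracy I)
      }

    slacks-run : ∀ {a b} σ → Input σ → knotAt σ ≡ a → reals σ 0 (nats σ 4 0) ≡ b → reals σ 7 0 ≡ 0# →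
      Run (for 6 addSlack) (forTime n 3) σ (λ τ → Agree 6 σ τ × reals τ 7 0 ≡ Σ n (λ i → slack ε a b (p i)))
    slacks-run {a} {b} σ I ≡a ≡b acc≡0 = Run-for
      (λ i τ → reals τ 7 0 ≡ Σ i (λ j → slack ε a b (p j)))
      (λ inv → inv)
      (λ i τ i<n A ctr inv → Run-map
        (λ { (B , eq) → B , ≡.trans eq (≡.cong₂ _+_ inv (slack≡ A ctr)) })
        (addSlack-run τ))
      (size I) acc≡0
      where
      slack≡ : ∀ {i τ} → Agree 6 σ τ → nats τ 6 0 ≡ i →
        slack (reals τ 1 0) (knotAt τ) (reals τ 0 (nats τ 4 0)) (reals τ 0 (nats τ 6 0)) ≡ slack ε a b (p i)
      slack≡ {i} A ctr
        rewrite ≡.trans (Agree.real A {1} 0 (ℕₚ.m≤m+n 2 4)) (accuracy I)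
              | ≡.trans (Agree-lookup {a = 2} {b = 2} 0 A (ℕₚ.m≤m+n 3 3) (ℕₚ.m≤m+n 3 3)) ≡a
              | ≡.trans (Agree-lookup {a = 0} {b = 4} 0 A (ℕₚ.m≤m+n 1 5) (ℕₚ.m≤m+n 5 1)) ≡b
              | ctr
              | ≡.trans (Agree.real A {0} i (ℕₚ.m≤m+n 1 5)) (contents I i)
        = ≡.refl

    shares-run : ∀ {a b} σ → Input σ → knotAt σ ≡ a → reals σ 5 0 ≡ b → reals σ 7 0 ≡ 0# → reals σ 8 0 ≡ 0# →
      Run (for 6 addShares) (forTime n 4) σ (λ τ → Agree 6 σ τ ×
        reals τ 7 0 ≡ Σ n (λ i → toLeft a b (p i)) × reals τ 8 0 ≡ Σ n (λ i → toRight a b (p i)))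
    shares-run {a} {b} σ I ≡a ≡b left≡0 right≡0 = Run-for
      (λ i τ → reals τ 7 0 ≡ Σ i (λ j → toLeft a b (p j)) × reals τ 8 0 ≡ Σ i (λ j → toRight a b (p j)))
      (λ inv → inv)
      (λ i τ i<n A ctr (l , r) → Run-map
        (λ { (B , l′ , r′) → B , ≡.trans l′ (≡.cong₂ _+_ l (share≡ toLeft A ctr))
                               , ≡.trans r′ (≡.cong₂ _+_ r (share≡ toRight A ctr)) })
        (addShares-run τ))
      (size I) (left≡0 , right≡0)
      where
      share≡ : ∀ (f : ℝ → ℝ → ℝ → ℝ) {i τ} → Agree 6 σ τ → nats τ 6 0 ≡ i →
        f (knotAt τ) (reals τ 5 0) (reals τ 0 (nats τ 6 0)) ≡ f a b (p i)
      share≡ f {i} A ctr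
        rewrite ≡.trans (Agree-lookup {a = 2} {b = 2} 0 A (ℕₚ.m≤m+n 3 3) (ℕₚ.m≤m+n 3 3)) ≡a
              | ≡.trans (Agree.real A {5} 0 ℕₚ.≤-refl) ≡b
              | ctr
              | ≡.trans (Agree.real A {0} i (ℕₚ.m≤m+n 1 5)) (contents I i)
        = ≡.refl

    -- The search invariant after i candidates. `good` is conditional because the search starts at b
    -- = a, where the shares divide by zero.
    record Best (a : ℝ) (i : ℕ) (b : ℝ) : Set where
      field
        isPoint : IsPoint′ b
        a≤b     : a ≤ b
        good    : ¬ (b ≤ a) → Good′ a b
        maximal : ∀ j → j ℕ.< i → ¬ (p j ≤ b) → ¬ Good′ a (p j)

    open Best

    Best-suc : ∀ {a i b} → Best a i b → (¬ (p i ≤ b) → ¬ Good′ a (p i)) → Best a (suc i) b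
    Best-suc best last = record
      { isPoint = isPoint best ; a≤b = a≤b best ; good = good best
      ; maximal = λ j j<1+i → [ maximal best j , (λ { ≡.refl → last }) ]′ (ℕₚ.m≤n⇒m<n∨m≡n (ℕₚ.≤-pred j<1+i))
      }

    Best-new : ∀ {a i b} → i ℕ.< n → Best a i b → ¬ (p i ≤ b) → Good′ a (p i) → Best a (suc i) (p i)
    Best-new {i = i} i<n best pi≰b gd = record
      { isPoint = i , i<n , ≡.refl
      ; a≤b     = ≤-trans (a≤b best) (≰⇒≥ pi≰b)
      ; good    = λ _ → gd
      ; maximal = λ j j<1+i pj≰pi →
          [ (λ j<i → maximal best j j<i (λ pj≤b → pj≰pi (≤-trans pj≤b (≰⇒≥ pi≰b))))
          , (λ { ≡.refl → contradiction ≤-refl pj≰pi }) ]′ (ℕₚ.m≤n⇒m<n∨m≡n (ℕₚ.≤-pred j<1+i))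
      }

    candidateTime : ℕ
    candidateTime = suc (1 ℕ.+ (forTime n 3 ℕ.+ 2))

    tryCandidate-run : ∀ {a} i τ → i ℕ.< n → Input τ → knotAt τ ≡ a → nats τ 4 0 ≡ i → Best a i (reals τ 5 0) →
      Run tryCandidate candidateTime τ (λ υ → Agree 5 τ υ × Best a (suc i) (reals υ 5 0))
    tryCandidate-run {a} i τ i<n I ≡a ctr best = Run-ifte
      (λ x≤b → Run-≤ (ℕ.s≤s ℕ.z≤n) (Run-skip (Agree-refl ,
        Best-suc best (λ pi≰b → contradiction (≡.subst (_≤ _) candidate≡ (witness (_ ≤? _) x≤b)) pi≰b))))
      (λ x≰b → Run-⨾ (Run-setReal (Run-⨾ (Run-map (λ (A , total≡) → decide x≰b A total≡)
        (slacks-run τ₀ (Agree-Input (Agree-writeReal 0 0# τ (ℕₚ.m≤m+n 2 5)) I) ≡a candidate≡ ≡.refl)))))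
      where
      τ₀ : State
      τ₀ = writeReal 7 0 0# τ
      candidate≡ : reals τ 0 (nats τ 4 0) ≡ p i
      candidate≡ = ≡.trans (contents I _) (≡.cong p ctr)
      decide : does (reals τ 0 (nats τ 4 0) ≤? reals τ 5 0) ≡ false → ∀ {υ} → Agree 6 τ₀ υ →
        reals υ 7 0 ≡ Σ n (λ j → slack ε a (p i) (p j)) →
        Run (ifte (realLeq (realCell 7) zeroR) (setReal 5 (lit 0) (point 4)) skip) 2 υ
          (λ φ → Agree 5 τ φ × Best a (suc i) (reals φ 5 0))
      decide x≰b {υ} A total≡ = Run-ifte
        (λ s≤0 → Run-setReal (Agree-trans frame (Agree-writeReal 0 _ υ ℕₚ.≤-refl) ,
          ≡.subst (Best a (suc i)) (≡.sym value≡) (Best-new i<n best pi≰b (≡.subst (_≤ 0#) total≡ (witness (_ ≤? _) s≤0)))))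
        (λ s≰0 → Run-skip (frame , ≡.subst (Best a (suc i)) (≡.sym (Agree.real A {5} 0 ℕₚ.≤-refl))
          (Best-suc best (λ _ gd → refutation (_ ≤? _) s≰0 (≡.subst (_≤ 0#) (≡.sym total≡) gd)))))
        where
        frame : Agree 5 τ υ
        frame = Agree-trans (Agree-writeReal 0 0# τ (ℕₚ.m≤m+n 5 2)) (Agree-weaken (ℕₚ.n≤1+n 5) A)
        value≡ : reals υ 0 (nats υ 4 0) ≡ p i
        value≡ = ≡.trans (Agree-lookup {a = 0} {b = 4} 0 A (ℕₚ.m≤m+n 1 5) (ℕₚ.m≤m+n 5 1)) candidate≡
        pi≰b : ¬ (p i ≤ reals τ 5 0)
        pi≰b pi≤b = refutation (_ ≤? _) x≰b (≡.subst (_≤ _) (≡.sym candidate≡) pi≤b)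

    candidates-run : ∀ {a} σ → Input σ → knotAt σ ≡ a → Best a 0 (reals σ 5 0) →
      Run (for 4 tryCandidate) (forTime n candidateTime) σ (λ τ → Agree 4 σ τ × Best a n (reals τ 5 0))
    candidates-run {a} σ I ≡a best = Run-for
      (λ i τ → Best a i (reals τ 5 0))
      (λ inv → inv)
      (λ i τ i<n A ctr inv → tryCandidate-run i τ i<n (Agree-Input (Agree-weaken (ℕₚ.m≤m+n 2 2) A) I)
        (≡.trans (Agree-lookup {a = 2} {b = 2} 0 A (ℕₚ.m≤m+n 3 1) (ℕₚ.m≤m+n 3 1)) ≡a) ctr inv)
      (size I) best

    -- The knots and weights in memory are described by functions s and w,
    -- because without function extensionality equal memory contents need not
    -- be equal functions.
    record Progress (i : ℕ) (σ : State) : Set where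
      field
        {k}      : ℕ
        {s w}    : ℕ → ℝ
        index    : nats σ 2 0 ≡ k
        knots    : ∀ j → reals σ 2 j ≡ s j
        weights  : ∀ j → reals σ 3 j ≡ w j
        chain    : Chain′ k s w
        progress : (∀ j → j ℕ.< n → p j ≤ s k) ⊎ i ℕ.≤ k

    appendTime : ℕ
    appendTime = 1 ℕ.+ (1 ℕ.+ (forTime n 4 ℕ.+ (1 ℕ.+ (1 ℕ.+ (1 ℕ.+ 1)))))

    appendKnot-run : ∀ {k s w} σ → Input σ → nats σ 2 0 ≡ k → Chain′ k s w →
      (∀ j → reals σ 2 j ≡ s j) → (∀ j → reals σ 3 j ≡ w j) →
      ¬ (reals σ 5 0 ≤ s k) → Best (s k) n (reals σ 5 0) →
      Run appendKnot appendTime σ (λ τ → Agree 2 σ τ × nats τ 2 0 ≡ suc k × Chain′ (suc k) (reals τ 2) (reals τ 3))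
    appendKnot-run {k} {s} {w} σ I k≡ chain s≡ w≡ b≰a best =
      Run-⨾ (Run-setReal (Run-⨾ (Run-setReal (Run-⨾ (Run-map (λ {τ} (A , l , r) →
        Run-⨾ (Run-setReal (Run-⨾ (Run-setReal (Run-⨾ (Run-setReal (Run-setNat (finish τ A l r))))))))
        (shares-run {s k} {b} σ₀ I₀ (≡.trans (≡.cong (reals σ 2) k≡) (s≡ k)) ≡.refl ≡.refl ≡.refl))))))
      where
      b : ℝ
      b = reals σ 5 0
      σ₀ : State
      σ₀ = writeReal 8 0 0# (writeReal 7 0 0# σ)
      frame₀ : Agree 7 σ σ₀
      frame₀ = Agree-trans (Agree-writeReal 0 0# σ ℕₚ.≤-refl) (Agree-writeReal 0 0# (writeReal 7 0 0# σ) (ℕₚ.n≤1+n 7))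
      I₀ : Input σ₀
      I₀ = Agree-Input (Agree-weaken (ℕₚ.m≤m+n 2 5) frame₀) I
      finish : ∀ τ → Agree 6 σ₀ τ → reals τ 7 0 ≡ Σ n (λ i → toLeft (s k) b (p i)) →
        reals τ 8 0 ≡ Σ n (λ i → toRight (s k) b (p i)) →
        let k′ = nats τ 2 0
            τ₁ = writeReal 3 k′ (reals τ 3 k′ + reals τ 7 0) τ
            τ₂ = writeReal 3 (suc k′) (reals τ 8 0) τ₁
            τ₃ = writeReal 2 (suc k′) (reals τ 5 0) τ₂
            τ₄ = writeNat 2 0 (suc k′) τ₃
        in Agree 2 σ τ₄ × nats τ₄ 2 0 ≡ suc k × Chain′ (suc k) (reals τ₄ 2) (reals τ₄ 3)
      finish τ A l r
        rewrite ≡.trans (nat A {2} 0 (ℕₚ.m≤m+n 3 3)) k≡ =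
        Agree-trans (Agree-weaken (ℕₚ.m≤m+n 2 5) frame₀) (Agree-trans (Agree-weaken (ℕₚ.m≤m+n 2 4) A)
          (Agree-trans (Agree-writeReal k _ τ (ℕₚ.m≤m+n 2 1)) (Agree-trans (Agree-writeReal (suc k) _ τ₁ (ℕₚ.m≤m+n 2 1))
            (Agree-trans (Agree-writeReal (suc k) _ τ₂ ℕₚ.≤-refl) (Agree-writeNat 0 _ τ₃ ℕₚ.≤-refl)))))
        , ≡.refl
        , extend-chain n p ε 0<ε ε<1 chain extends
            (≡.subst IsPoint′ (≡.sym new≡) (isPoint best))
            (≡.subst (λ u → ¬ (u ≤ s k)) (≡.sym new≡) b≰a)
            (≡.subst (Good′ (s k)) (≡.sym new≡) (good best b≰a))
            (≡.subst (λ u → ∀ i → i ℕ.< n → ¬ (p i ≤ u) → ¬ Good′ (s k) (p i)) (≡.sym new≡) (maximal best))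
        where
        τ₁ = writeReal 3 k (reals τ 3 k + reals τ 7 0) τ
        τ₂ = writeReal 3 (suc k) (reals τ 8 0) τ₁
        τ₃ = writeReal 2 (suc k) (reals τ 5 0) τ₂
        s′ w′ : ℕ → ℝ
        s′ = reals τ₃ 2
        w′ = reals τ₃ 3
        new≡ : s′ (suc k) ≡ b
        new≡ = ≡.trans (update-same (reals τ₂) 2 (suc k) _) (Agree.real A {5} 0 ℕₚ.≤-refl)
        extends : Extends n p ε 0<ε ε<1 k s w s′ w′
        extends = record
          { s-old  = λ j j≤k → ≡.trans (update-index (reals τ₂) 2 _ (λ 1+k≡j → ℕₚ.<⇒≢ (ℕ.s≤s j≤k) (≡.sym 1+k≡j)))
                       (≡.trans (Agree.real A {2} j (ℕₚ.m≤m+n 3 3)) (s≡ j))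
          ; w-old  = λ j j<k → ≡.trans (update-index (reals τ₁) 3 _ (λ 1+k≡j → ℕₚ.<⇒≢ (ℕₚ.m<n⇒m<1+n j<k) (≡.sym 1+k≡j)))
                       (≡.trans (update-index (reals τ) 3 _ (λ k≡j → ℕₚ.<⇒≢ j<k (≡.sym k≡j)))
                         (≡.trans (Agree.real A {3} j (ℕₚ.m≤m+n 4 2)) (w≡ j)))
          ; w-last = ≡.trans (update-index (reals τ₁) 3 _ (λ 1+k≡k → ℕₚ.<⇒≢ (ℕₚ.n<1+n k) (≡.sym 1+k≡k)))
                       (≡.trans (update-same (reals τ) 3 k _)
                         (≡.cong₂ _+_ (≡.trans (Agree.real A {3} k (ℕₚ.m≤m+n 4 2)) (w≡ k))
                           (≡.trans l (≡.cong (λ u → Σ n (λ i → toLeft (s k) u (p i))) (≡.sym new≡)))))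
          ; w-new  = ≡.trans (update-same (reals τ₁) 3 (suc k) _)
                       (≡.trans r (≡.cong (λ u → Σ n (λ i → toRight (s k) u (p i))) (≡.sym new≡)))
          }

    roundTime : ℕ
    roundTime = 1 ℕ.+ (forTime n candidateTime ℕ.+ suc appendTime)

    greedyRound-run : ∀ i σ → Input σ → Progress i σ →
      Run greedyRound roundTime σ (λ τ → Agree 2 σ τ × Progress (suc i) τ)
    greedyRound-run i σ I P = Run-⨾ (Run-setReal (Run-⨾ (Run-map (λ {τ} (A , best) → choose τ A best)
      (candidates-run σ₀ (Agree-Input (Agree-writeReal 0 _ σ (ℕₚ.m≤m+n 2 3)) I) knot≡ start-best))))
      where
      open Progress P
      a : ℝ
      a = s k
      knot≡ : knotAt σ ≡ a
      knot≡ = ≡.trans (knots _) (≡.cong s index)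
      σ₀ : State
      σ₀ = writeReal 5 0 (knotAt σ) σ
      start-best : Best a 0 (knotAt σ)
      start-best = ≡.subst (Best a 0) (≡.sym knot≡) (record
        { isPoint = Chain.points chain k ℕₚ.≤-refl
        ; a≤b     = ≤-refl
        ; good    = λ a≰a → contradiction ≤-refl a≰a
        ; maximal = λ _ ()
        })
      choose : ∀ τ → Agree 4 σ₀ τ → Best a n (reals τ 5 0) →
        Run (ifte (realLeq (realCell 5) lastKnot) skip appendKnot) (suc appendTime) τ
          (λ υ → Agree 2 σ υ × Progress (suc i) υ)
      choose τ A best = Run-ifte
        (λ b≤a → Run-≤ (ℕ.s≤s ℕ.z≤n) (Run-skip (Agree-weaken (ℕₚ.m≤m+n 2 2) frame , record
          { index    = index′
          ; knots    = knots′
          ; weights  = weights′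
          ; chain    = chain
          ; progress = inj₁ (none-good⇒last n p ε 0<ε ε<1 (λ j j<n pj≰a → maximal best j j<n
              (λ pj≤b → pj≰a (≤-trans pj≤b (≡.subst (reals τ 5 0 ≤_) knot≡′ (witness (_ ≤? _) b≤a))))))
          })))
        (λ b≰a → Run-map
          (λ { (B , index″ , chain′) → Agree-trans (Agree-weaken (ℕₚ.m≤m+n 2 2) frame) B , record
            { index    = index″
            ; knots    = λ _ → ≡.refl
            ; weights  = λ _ → ≡.refl
            ; chain    = chain′
            ; progress = [ (λ last → contradiction (last-maximal last best)
                             (λ b≤a → refutation (_ ≤? _) b≰a (≡.subst (reals τ 5 0 ≤_) (≡.sym knot≡′) b≤a)))
                         , (λ i≤k → inj₂ (ℕ.s≤s i≤k)) ]′ progress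
            } })
          (appendKnot-run τ (Agree-Input (Agree-weaken (ℕₚ.m≤m+n 2 2) frame) I) index′ chain knots′ weights′
            (λ b≤a → refutation (_ ≤? _) b≰a (≡.subst (reals τ 5 0 ≤_) (≡.sym knot≡′) b≤a)) best))
        where
        frame : Agree 4 σ τ
        frame = Agree-trans (Agree-writeReal 0 _ σ (ℕₚ.n≤1+n 4)) A
        index′ : nats τ 2 0 ≡ k
        index′ = ≡.trans (nat frame {2} 0 (ℕₚ.m≤m+n 3 1)) index
        knots′ : ∀ j → reals τ 2 j ≡ s j
        knots′ j = ≡.trans (Agree.real frame {2} j (ℕₚ.m≤m+n 3 1)) (knots j)
        weights′ : ∀ j → reals τ 3 j ≡ w j
        weights′ j = ≡.trans (Agree.real frame {3} j ℕₚ.≤-refl) (weights j)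
        knot≡′ : knotAt τ ≡ a
        knot≡′ = ≡.trans (knots′ _) (≡.cong s index′)
        last-maximal : (∀ j → j ℕ.< n → p j ≤ a) → ∀ {b} → Best a n b → b ≤ a
        last-maximal last bst = let j , j<n , b≡ = isPoint bst in ≡.subst (_≤ a) (≡.sym b≡) (last j j<n)

-- Verification of the whole program and translation to coresets.

module Correctness (𝓡 : RealNumbers) where
  open OrderedField 𝓡
  open GreedyChain 𝓡
  open RealFunctions 𝓡 using (sizeBound)
  open Coresets 𝓡
  open Semantics 𝓡
  open TotalCorrectness 𝓡
  open Verification 𝓡
  open Sum (CommutativeRing.+-commutativeMonoid commutativeRing) using (sum-cong-≋)

  module _ (n : ℕ) (p : ℕ → ℝ) (ε : ℝ) (0<ε : 0# < ε) (ε<1 : ε < 1#) where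

    private
      Input′ : State → Set
      Input′ = Input n p ε 0<ε ε<1

      Progress′ : ℕ → State → Set
      Progress′ = Progress n p ε 0<ε ε<1

      IsPoint′ : ℝ → Set
      IsPoint′ = IsPoint n p ε 0<ε ε<1

    -- Array names are literals, so `update` computes away and the old fields have the new types.
    writeCounter : ∀ {x τ} → Input′ τ → Input′ (writeNat 1 0 x τ)
    writeCounter I = record { size = size I ; contents = contents I ; accuracy = accuracy I }
      where open Input

    minimum-run : ∀ i τ → i ℕ.< n → Input′ τ → nats τ 1 0 ≡ i →
      IsPoint′ (reals τ 2 0) → (∀ j → j ℕ.< i → reals τ 2 0 ≤ p j) →
      Run minimum 2 τ (λ υ → Agree 2 τ υ × nats υ 2 0 ≡ nats τ 2 0 ×
        IsPoint′ (reals υ 2 0) × (∀ j → j ℕ.< suc i → reals υ 2 0 ≤ p j))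
    minimum-run i τ i<n I ctr isPoint min = Run-ifte
      (λ x≤m → Run-setReal (Agree-writeReal 0 _ τ ℕₚ.≤-refl , ≡.refl , (i , i<n , x≡) , λ j j<1+i →
        [ (λ j<i → ≤-trans (witness (_ ≤? _) x≤m) (min j j<i)) , (λ { ≡.refl → ≤-reflexive (reflexive x≡) }) ]′
        (ℕₚ.m≤n⇒m<n∨m≡n (ℕₚ.≤-pred j<1+i))))
      (λ x≰m → Run-skip (Agree-refl , ≡.refl , isPoint , λ j j<1+i →
        [ min j , (λ { ≡.refl → ≰⇒≥ (≡.subst (λ u → ¬ (u ≤ reals τ 2 0)) x≡ (refutation (_ ≤? _) x≰m)) }) ]′
        (ℕₚ.m≤n⇒m<n∨m≡n (ℕₚ.≤-pred j<1+i))))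
      where
      x≡ : reals τ 0 (nats τ 1 0) ≡ p i
      x≡ = ≡.trans (Input.contents I _) (≡.cong p ctr)

    mainTime : ℕ
    mainTime = 1 ℕ.+ (forTime n 2 ℕ.+ (1 ℕ.+ (forTime n (roundTime n p ε 0<ε ε<1) ℕ.+ 1)))

    record Output (σ : State) : Set where
      field
        {k}     : ℕ
        {s w}   : ℕ → ℝ
        size    : outSize σ ≡ suc k
        knots   : ∀ j → reals σ 2 j ≡ s j
        weights : ∀ j → reals σ 3 j ≡ w j
        chain   : Chain n p ε 0<ε ε<1 k s w
        last    : ∀ i → i ℕ.< n → p i ≤ s k

    coreset-run : ∀ σ → Input′ σ → nats σ 2 0 ≡ 0 → 0 ℕ.< n →
      (∀ i j → i ℕ.< n → j ℕ.< n → p i ≈ p j → i ≡ j) → Run coreset (suc mainTime) σ Output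
    coreset-run σ I k≡0 0<n distinct = Run-ifte
      (λ n≤0 → contradiction (≡.subst (ℕ._≤ 0) (Input.size I) (witness (_ ℕ.≤? 0) n≤0)) (ℕₚ.<⇒≱ 0<n))
      (λ _ → Run-⨾ (Run-setReal (Run-⨾ (Run-map
        (λ {τ} (_ , I₁ , k≡0 , isPoint , min) → Run-⨾ (Run-setReal (Run-⨾ (Run-map
          (λ {υ} (_ , _ , P) → Run-setNat (output υ P))
          (Run-for (λ i υ → Input′ υ × Progress′ i υ)
            (λ (I , P) → writeCounter I , record { Progress P })
            (λ i υ i<n _ ctr (I , P) → Run-map (λ (B , P′) → B , Agree-Input n p ε 0<ε ε<1 B I , P′)
              (greedyRound-run n p ε 0<ε ε<1 i υ I P))
            (Input.size I₁)
            (record { size = Input.size I₁ ; contents = Input.contents I₁ ; accuracy = Input.accuracy I₁ }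
            , record
              { index    = k≡0
              ; knots    = λ _ → ≡.refl
              ; weights  = λ _ → ≡.refl
              ; chain    = start n p ε 0<ε ε<1 distinct isPoint min ≡.refl
              ; progress = inj₂ ℕ.z≤n
              }))))))
        (Run-for (λ i τ → Input′ τ × nats τ 2 0 ≡ 0 × IsPoint′ (reals τ 2 0) × (∀ j → j ℕ.< i → reals τ 2 0 ≤ p j))
          (λ (I , rest) → writeCounter I , rest)
          (λ i τ i<n _ ctr (I , k≡0 , isPoint , min) → Run-map
            (λ (B , same , rest) → B , Agree-Input n p ε 0<ε ε<1 B I , ≡.trans same k≡0 , rest)
            (minimum-run i τ i<n I ctr isPoint min))
          (Input.size I)
          (record { size = Input.size I ; contents = Input.contents I ; accuracy = Input.accuracy I }
          , k≡0 , (0 , 0<n , Input.contents I 0) , λ _ ()))))))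
      where
      output : ∀ υ → Progress′ n υ → Output (writeNat 0 0 (suc (nats υ 2 0)) υ)
      output υ P = record
        { size    = ≡.cong suc index
        ; knots   = knots
        ; weights = weights
        ; chain   = chain
        -- Each round adds a knot or shows that the last knot is the rightmost point. If n rounds
        -- all added one, there would be n + 1 distinct knots.
        ; last    = [ (λ last → last) , (λ n≤k → contradiction n≤k (ℕₚ.<⇒≱ (chain-bound n p ε 0<ε ε<1 chain))) ]′ progress
        }
        where open Progress P

  load-fromℕ< : ∀ {n} (P : Vector ℝ n) {i} (i<n : i ℕ.< n) → load P i ≡ P (Fin.fromℕ< i<n)
  load-fromℕ< {n} P {i} i<n with i ℕ.<? n
  ... | yes i<n′ = ≡.cong (λ q → P (Fin.fromℕ< q)) (ℕₚ.<-irrelevant i<n′ i<n)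
  ... | no i≮n = contradiction i<n i≮n

  load-toℕ : ∀ {n} (P : Vector ℝ n) i → load P (toℕ i) ≡ P i
  load-toℕ P i = ≡.trans (load-fromℕ< P (toℕ<n i)) (≡.cong P (fromℕ<-toℕ i (toℕ<n i)))

  module _ {n : ℕ} (P : Vector ℝ n) (ε : ℝ) (0<ε : 0# < ε) (ε<1 : ε < 1#) where

    load-distinct : IsFiniteSet P → ∀ i j → i ℕ.< n → j ℕ.< n → load P i ≈ load P j → i ≡ j
    load-distinct inj i j i<n j<n q = fromℕ<-injective _ _ i<n j<n (inj (≡.subst₂ _≈_ (load-fromℕ< P i<n) (load-fromℕ< P j<n) q))

    cost≈ : ∀ c → cost P c ≈ costAt n (load P) ε 0<ε ε<1 c
    cost≈ c = trans (sum-cong-≋ (λ i → reflexive (≡.cong (λ x → ∣ x - c ∣) (≡.sym (load-toℕ P i)))))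
      (sum≈Σ n (λ i → ∣ load P i - c ∣))

    output-coreset : ∀ {σ} → Output n (load P) ε 0<ε ε<1 σ →
      IsCoreset ε P (outPoints σ) (outWeights σ) × fromℕ (outSize σ) ≤ sizeBound 41 ε 0<ε ε<1
    output-coreset {σ} O = record
      { isFiniteSet = λ {i} {j} q → toℕ-injective (injective n (load P) ε 0<ε ε<1 chain (toℕ i) (toℕ j) (index≤ i) (index≤ j)
                        (≡.subst₂ _≈_ (knots _) (knots _) q))
      ; subset      = λ j → let i , i<n , eq = Chain.points chain (toℕ j) (index≤ j) in
                        Fin.fromℕ< i<n , reflexive (≡.trans (knots _) (≡.trans eq (load-fromℕ< P i<n)))
      ; nonneg      = λ j → ≡.subst (0# ≤_) (≡.sym (weights _)) (Chain.nonneg chain (toℕ j) (index≤ j))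
      ; lower       = λ c → ≤-resp (*-congˡ (sym (cost≈ c))) (sym (weightedCost≈ c))
                        (coreset-lower n (load P) ε 0<ε ε<1 chain last c)
      ; upper       = λ c → ≤-resp (sym (weightedCost≈ c)) (*-congˡ (sym (cost≈ c)))
                        (coreset-upper n (load P) ε 0<ε ε<1 chain last c)
      } , ≡.subst (λ m → fromℕ m ≤ sizeBound 41 ε 0<ε ε<1) (≡.sym size) (chain-size n (load P) ε 0<ε ε<1 chain)
      where
      open Output O
      index≤ : (j : Fin.Fin (outSize σ)) → toℕ j ℕ.≤ k
      index≤ j = ℕₚ.≤-pred (≡.subst (toℕ j ℕ.<_) size (toℕ<n j))
      weightedCost≈ : ∀ c → weightedCost (outPoints σ) (outWeights σ) c ≈ chainCost n (load P) ε 0<ε ε<1 k s w c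
      weightedCost≈ c = trans (sum≈Σ (outSize σ) (λ j → reals σ 3 j * ∣ reals σ 2 j - c ∣))
        (trans (reflexive (≡.cong (λ m → Σ m (λ j → reals σ 3 j * ∣ reals σ 2 j - c ∣)) size))
          (Σ-cong (suc k) (λ j _ → reflexive (≡.cong₂ (λ u v → u * ∣ v - c ∣) (weights j) (knots j)))))

-- Polynomial time.

module PowerBounds (n : ℕ) where

  const-bound : ∀ c e → c ℕ.≤ c ℕ.* suc n ℕ.^ e
  const-bound c e = ℕₚ.m≤m*n c (suc n ℕ.^ e) {{ℕₚ.m^n≢0 (suc n) e}}

  sum-bound : ∀ {s t} k l e → s ℕ.≤ k ℕ.* suc n ℕ.^ e → t ℕ.≤ l ℕ.* suc n ℕ.^ e → s ℕ.+ t ℕ.≤ (k ℕ.+ l) ℕ.* suc n ℕ.^ e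
  sum-bound k l e s≤ t≤ = ℕₚ.≤-trans (ℕₚ.+-mono-≤ s≤ t≤) (ℕₚ.≤-reflexive (≡.sym (ℕₚ.*-distribʳ-+ (suc n ℕ.^ e) k l)))

  degree-bound : ∀ {t} k {d e} → d ℕ.≤ e → t ℕ.≤ k ℕ.* suc n ℕ.^ d → t ℕ.≤ k ℕ.* suc n ℕ.^ e
  degree-bound k d≤e t≤ = ℕₚ.≤-trans t≤ (ℕₚ.*-monoʳ-≤ k (ℕₚ.^-monoʳ-≤ (suc n) d≤e))

  -- A loop raises the degree by one and the coefficient by 4, namely 2 for its set-up and exit and
  -- 2 for the overhead of an iteration.
  loop-bound : ∀ {t} k e → t ℕ.≤ k ℕ.* suc n ℕ.^ e → 2 ℕ.+ n ℕ.* (2 ℕ.+ t) ℕ.≤ (4 ℕ.+ k) ℕ.* suc n ℕ.^ suc e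
  loop-bound {t} k e t≤ = sum-bound 2 (2 ℕ.+ k) (suc e) (const-bound 2 (suc e)) (ℕₚ.≤-trans
    (ℕₚ.*-mono-≤ {n} {suc n} (ℕₚ.n≤1+n n) (sum-bound 2 k e (const-bound 2 e) t≤)) (ℕₚ.≤-reflexive swap))
    where
    swap : suc n ℕ.* ((2 ℕ.+ k) ℕ.* suc n ℕ.^ e) ≡ (2 ℕ.+ k) ℕ.* (suc n ℕ.* suc n ℕ.^ e)
    swap = ≡.trans (≡.sym (ℕₚ.*-assoc (suc n) (2 ℕ.+ k) (suc n ℕ.^ e)))
      (≡.trans (≡.cong (ℕ._* suc n ℕ.^ e) (ℕₚ.*-comm (suc n) (2 ℕ.+ k))) (ℕₚ.*-assoc (2 ℕ.+ k) (suc n) (suc n ℕ.^ e)))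

time-bound : ∀ (𝓡 : RealNumbers) n p ε 0<ε ε<1 → suc (Correctness.mainTime 𝓡 n p ε 0<ε ε<1) ℕ.≤ 45 ℕ.* suc n ℕ.^ 45
-- Three nested loops give a cubic bound with coefficient 45; the degree is raised to 45 because the
-- theorem has one constant d for both.
time-bound 𝓡 n p ε 0<ε ε<1 = PowerBounds.degree-bound n 45 {3} {45} (ℕₚ.m≤m+n 3 42) cubic
  where
  open Verification 𝓡
  open PowerBounds n
  candidate : candidateTime n p ε 0<ε ε<1 ℕ.≤ 11 ℕ.* suc n ℕ.^ 1
  candidate = sum-bound 2 9 1 (const-bound 2 1) (sum-bound 7 2 1 (loop-bound 3 0 (const-bound 3 0)) (const-bound 2 1))
  append : suc (appendTime n p ε 0<ε ε<1) ℕ.≤ 15 ℕ.* suc n ℕ.^ 2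
  append = degree-bound 15 {1} {2} (ℕₚ.m≤m+n 1 1)
    (sum-bound 3 12 1 (const-bound 3 1) (sum-bound 8 4 1 (loop-bound 4 0 (const-bound 4 0)) (const-bound 4 1)))
  round : roundTime n p ε 0<ε ε<1 ℕ.≤ 31 ℕ.* suc n ℕ.^ 2
  round = sum-bound 1 30 2 (const-bound 1 2) (sum-bound 15 15 2 (loop-bound 11 1 candidate) append)
  cubic : suc (Correctness.mainTime 𝓡 n p ε 0<ε ε<1) ℕ.≤ 45 ℕ.* suc n ℕ.^ 3
  cubic = sum-bound 2 43 3 (const-bound 2 3)
    (sum-bound 6 37 3 (degree-bound 6 {1} {3} (ℕₚ.m≤m+n 1 2) (loop-bound 2 0 (const-bound 2 0)))
      (sum-bound 1 36 3 (const-bound 1 3) (sum-bound 35 1 3 (loop-bound 31 2 round) (const-bound 1 3))))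

theorem2p1 : Σ[ algorithm ∈ Program ] Σ[ d ∈ ℕ ] Σ[ C ∈ ℕ ] (0 ℕ.< C ×
    ((𝓡 : RealNumbers) → let open Theory 𝓡 in
    ∀ {n : ℕ} (P : Vector ℝ n) → IsFiniteSet P →
    ∀ (ε : ℝ) (0<ε : 0# < ε) (ε<1 : ε < 1#) →
    Σ[ t ∈ ℕ ] Σ[ σ ∈ State ] (
    (⟨ algorithm , input P ε ⟩⇓[ t ] σ) ×
    (t ℕ.≤ d ℕ.* suc n ℕ.^ d) ×
    IsCoreset ε P (outPoints σ) (outWeights σ) ×
    (fromℕ (outSize σ) ≤ sizeBound C ε 0<ε ε<1))))
theorem2p1 = coreset , 45 , 41 , ℕ.s≤s ℕ.z≤n , λ 𝓡 → correct 𝓡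
  where
  correct : (𝓡 : RealNumbers) → let open Theory 𝓡 in
    ∀ {n : ℕ} (P : Vector ℝ n) → IsFiniteSet P →
    ∀ (ε : ℝ) (0<ε : 0# < ε) (ε<1 : ε < 1#) →
    Σ[ t ∈ ℕ ] Σ[ σ ∈ State ] (
    (⟨ coreset , input P ε ⟩⇓[ t ] σ) ×
    (t ℕ.≤ 45 ℕ.* suc n ℕ.^ 45) ×
    IsCoreset ε P (outPoints σ) (outWeights σ) ×
    (fromℕ (outSize σ) ≤ sizeBound 41 ε 0<ε ε<1))
  -- For the empty set the input size 0 already is the output size, and the program stops after one
  -- test and one skip.
  correct 𝓡 {zero} P _ ε 0<ε ε<1 =
    2 , _ , ifTrue⇓ ≡.refl skip⇓ , ℕₚ.≤-trans (ℕₚ.m≤m+n 2 43) (PowerBounds.const-bound 0 45 45) , record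
      { isFiniteSet = λ {}
      ; subset      = λ ()
      ; nonneg      = λ ()
      ; lower       = λ _ → ≤-reflexive (zeroʳ _)
      ; upper       = λ _ → ≤-reflexive (sym (zeroʳ _))
      } , 0≤sizeBound 0 (load P) ε 0<ε ε<1 41
    where
    open OrderedField 𝓡 using (≤-reflexive; zeroʳ; sym)
    open GreedyChain 𝓡 using (0≤sizeBound)
    open Semantics 𝓡
  correct 𝓡 {suc n} P inj ε 0<ε ε<1 =
    _ , _ , execution , ℕₚ.≤-trans steps≤t (time-bound 𝓡 (suc n) (load P) ε 0<ε ε<1) ,
    output-coreset P ε 0<ε ε<1 post
    where
    open Semantics 𝓡
    open Correctness 𝓡
    input-correct : Verification.Input 𝓡 (suc n) (load P) ε 0<ε ε<1 (input P ε)
    input-correct = record { size = ≡.refl ; contents = λ _ → ≡.refl ; accuracy = ≡.refl }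
    open TotalCorrectness.Run (coreset-run (suc n) (load P) ε 0<ε ε<1 (input P ε)
      input-correct ≡.refl (ℕ.s≤s ℕ.z≤n) (load-distinct P ε 0<ε ε<1 inj))
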